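{- Consider non-adaptive $s$-way Quickselect with a fixed number of segments $s\ge2$ and a fixed pivot-sampling vector $\boldsymbol t=(t_1,\dots,t_s)\in\mathbb N_0^s$, and let $k=\sum_{\ell=1}^s(t_\ell+1)-1$. Let $F_n$ be the random cost of selecting an element of uniformly random rank $M_n\sim\mathcal U\{1,\dots,n\}$ out of $n$ elements, and suppose the cost $A_{\mathcal F}(n)$ of the first partitioning round satisfies $\mathbb E[A_{\mathcal F}(n)]\sim a_{\mathcal F}\cdot n$ as $n\to\infty$ for a constant $a_{\mathcal F}>0$. Then $$H = 1-\sum_{\ell=1}^s\frac{(t_\ell+1)(t_\ell+2)}{(k+1)(k+2)} > 0 \qquad\text{and}\qquad \mathbb E[F_n]\sim\frac{a_{\mathcal F}}{H}\cdot n\qquad(n\to\infty).$$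
   Context: Quickselect selects the element of given rank among $n$ distinct elements given in random order. Non-adaptive $s$-way Quickselect in each step takes a random sample of $k$ elements and picks $s-1$ pivots from it so that $t_1$ sample elements are smaller than the first pivot, $t_\ell$ lie between pivots $\ell-1$ and $\ell$, and $t_s$ are larger than the last pivot; it partitions the input into $s$ segments and recurses only into the segment that contains the sought element (it stops if that element is a pivot). Partitioning preserves randomness. Formally, there is a constant $n_0$ such that costs are $O(1)$ for $n<n_0$, and for $n\ge n_0$ $$F_n\ \stackrel{\mathcal D}{=}\ A_{\mathcal F}(n)+\sum_{\ell=1}^s\mathbf 1_{\{R_{\ell-1}<M_n<R_\ell\}}\,F^{(\ell)}_{J_\ell},$$ where $M_n$ is uniform on $\{1,\dots,n\}$ and independent of the subproblem sizes $\boldsymbol J=(J_1,\dots,J_s)=\boldsymbol t+\boldsymbol I$. Here $\boldsymbol I$ is multinomial with $n-k$ trials and random probability vector $\boldsymbol D\sim\mathrm{Dirichlet}(t_1+1,\dots,t_s+1)$, and the pivot ranks are $R_0=0$, $R_\ell=R_{\ell-1}+J_\ell+1$ (so $R_s=n+1$). The families $(F^{(\ell)}_j)_j$, $\ell=1,\dots,s$, are independent copies of $(F_j)_j$, also independent of $\boldsymbol J$, $A_{\mathcal F}(n)$ and $M_n$. The notation $f\sim g$ means $f/g\to1$. -}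

module Defs where

open import Level using (0ℓ)
open import Algebra.Apartness.Bundles using (HeytingCommutativeRing; HeytingField)
open import Algebra.Apartness.Structures using (IsHeytingField)
open import Algebra.Bundles using (CommutativeRing; Semiring)
import Algebra.Definitions.RawSemiring as RawSemiringDefs
open import Data.Bool.Base using (if_then_else_)
open import Data.Fin.Base using (Fin; zero; suc; toℕ; inject₁)
import Data.Fin.Properties as Fin
open import Data.Nat.Base as ℕ using (ℕ; zero; suc; NonZero; _!)
import Data.Nat.Properties as ℕ
open import Data.Product.Base using (Σ; ∃; _×_; _,_; proj₁; proj₂)
open import Data.Sum.Base using (_⊎_; inj₂)
open import Data.Vec.Base as Vec using (Vec; []; _∷_; lookup)
open import Data.Vec.Functional using (Vector)
import Data.Vec.Properties as Vec
open import Relation.Binary.Core using (Rel)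
open import Relation.Binary.PropositionalEquality.Core using (_≡_)
open import Relation.Binary.Structures using (IsStrictPartialOrder)
open import Relation.Nullary using (¬_; Dec; does; _×-dec_)

-- The real numbers, as a Cauchy-complete Archimedean ordered field.
-- Classically ℝ is the only model up to isomorphism.  The axioms are phrased
-- so that constructive (Cauchy) reals satisfy them too: the order need not be
-- decidable, and only elements apart from 0 are invertible.
record RealNumbers : Set₁ where
  infix  8 -_
  infixl 7 _*_
  infixl 6 _+_ _-_
  infix  4 _≈_ _<_ _≤_ _#_
  field
    Carrier : Set
    _≈_ _<_ : Rel Carrier 0ℓ
    _+_ _*_ : Carrier → Carrier → Carrier
    -_      : Carrier → Carrier
    0# 1#   : Carrier

  _#_ : Rel Carrier 0ℓ
  x # y = x < y ⊎ y < x

  _≤_ : Rel Carrier 0ℓ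
  x ≤ y = ¬ (y < x)

  _-_ : Carrier → Carrier → Carrier
  x - y = x + (- y)

  field
    isHeytingField       : IsHeytingField _≈_ _#_ _+_ _*_ -_ 0# 1#
    isStrictPartialOrder : IsStrictPartialOrder _≈_ _<_
    0<1                  : 0# < 1#
    +-monoˡ-<            : ∀ {x y} z → x < y → x + z < y + z
    *-pos                : ∀ {x y} → 0# < x → 0# < y → 0# < x * y

  heytingField : HeytingField 0ℓ 0ℓ 0ℓ
  heytingField = record { isHeytingField = isHeytingField }

  open HeytingField heytingField public using (heytingCommutativeRing)
  open HeytingCommutativeRing heytingCommutativeRing public using (commutativeRing)
  open RawSemiringDefs (Semiring.rawSemiring (CommutativeRing.semiring commutativeRing)) public
    using (sum; product; _^_) renaming (_×_ to _·_)

  ι : ℕ → Carrier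
  ι n = n · 1#

  Within : Carrier → Rel Carrier 0ℓ
  Within ε x y = (x - y < ε) × (y - x < ε)

  Tendsto : (ℕ → Carrier) → Carrier → Set
  Tendsto u c = ∀ ε → 0# < ε → ∃ λ N → ∀ n → N ℕ.≤ n → Within ε (u n) c

  Cauchy : (ℕ → Carrier) → Set
  Cauchy u = ∀ ε → 0# < ε → ∃ λ N → ∀ m n → N ℕ.≤ m → N ℕ.≤ n → Within ε (u m) (u n)

  field
    archimedean : ∀ x → ∃ λ n → x < ι n
    complete    : ∀ u → Cauchy u → ∃ (Tendsto u)

module Analysis (𝓡 : RealNumbers) where

  open RealNumbers 𝓡 public renaming (Carrier to ℝ)

  private
    module R = CommutativeRing commutativeRing
    module O = IsStrictPartialOrder isStrictPartialOrder

  0<⇒#0 : ∀ {x} → 0# < x → x # 0#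
  0<⇒#0 = inj₂

  ι-pos : ∀ n .{{_ : NonZero n}} → 0# < ι n
  ι-pos (suc zero)    = proj₁ O.<-resp-≈ (R.sym (R.+-identityʳ 1#)) 0<1
  ι-pos (suc (suc n)) =
    O.trans (ι-pos (suc n))
      (proj₂ O.<-resp-≈ (R.+-identityˡ (ι (suc n))) (+-monoˡ-< (ι (suc n)) 0<1))

  -- The library makes differences x - y invertible for x # y, so this is
  -- literally the inverse of x - 0#.
  inverse : ∀ x → x # 0# → ℝ
  inverse x x#0 = proj₁ (IsHeytingField.#⇒invertible isHeytingField x#0)

  infixl 7 _÷_[_] _÷ℕ_

  _÷_[_] : ℝ → ∀ y → y # 0# → ℝ
  x ÷ y [ y#0 ] = x * inverse y y#0

  _÷ℕ_ : ℝ → ∀ n → .{{NonZero n}} → ℝ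
  x ÷ℕ n = x ÷ ι n [ 0<⇒#0 (ι-pos n) ]

  -- f n / g n → 1, where the quotient need only be defined for large n.
  infix 4 _∼_
  _∼_ : (f g : ℕ → ℝ) → Set
  f ∼ g = ∀ ε → 0# < ε → ∃ λ N → ∀ n → N ℕ.≤ n →
            Σ (g n # 0#) λ gn#0 → Within ε (f n ÷ g n [ gn#0 ]) 1#

  -- Uniform continuity on bounded sets, which on ℝᵈ is classically the same
  -- as continuity.
  Continuous : ∀ {d} → (Vector ℝ d → ℝ) → Set
  Continuous {d} φ = ∀ B ε → 0# < ε → ∃ λ δ → (0# < δ) ×
    (∀ x y → Bounded B x → Bounded B y →
      (∀ i → Within δ (x i) (y i)) → Within ε (φ x) (φ y))
    where
    Bounded : ℝ → Vector ℝ d → Set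
    Bounded B x = ∀ i → (- B < x i) × (x i < B)

  𝟏 : ∀ {P : Set} → Dec P → ℝ
  𝟏 P? = if does P? then 1# else 0#

  -- The sum of f over all (i₁,…,iₛ) ∈ ℕˢ with i₁ + … + iₛ = N.
  sumCompositions : ∀ s → ℕ → (Vec ℕ s → ℝ) → ℝ
  sumCompositions zero    zero    f = f []
  sumCompositions zero    (suc N) f = 0#
  sumCompositions (suc s) N       f =
    sum {suc N} λ i → sumCompositions s (N ℕ.∸ toℕ i) λ v → f (toℕ i ∷ v)

  -- SimplexIntegral f c: the integral of f over the standard simplex
  -- { x ∈ ℝˢ | x ≥ 0, x₁ + … + xₛ = 1 } with respect to dx₁ … dxₛ₋₁ is c.
  -- It is the limit of the Riemann sums over the grid points i / m with
  -- i₁ + … + iₛ = m, each of which stands for a cell of volume 1 / mˢ⁻¹.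
  -- Used for continuous f only.
  SimplexIntegral : ∀ {s} → (Vector ℝ s → ℝ) → ℝ → Set
  SimplexIntegral {s} f c = Tendsto riemannSum c
    where
    riemannSum : ℕ → ℝ
    riemannSum N =
      _÷ℕ_ (sumCompositions s (suc N) λ i → f λ ℓ → ι (lookup i ℓ) ÷ℕ suc N)
           (suc N ℕ.^ (s ℕ.∸ 1)) {{ℕ.m^n≢0 (suc N) (s ℕ.∸ 1)}}

  -- The density of Dirichlet(α) for positive integers α, with respect to
  -- dx₁ … dxₛ₋₁:  Γ(α₁ + … + αₛ) · ∏ x_ℓ ^ (α_ℓ - 1) / Γ(α_ℓ),  Γ(m) = (m - 1)!.
  dirichletDensity : ∀ {s} → Vec ℕ s → Vector ℝ s → ℝ
  dirichletDensity α x = ι ((Vec.sum α ℕ.∸ 1) !) *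
    product λ ℓ → let m = lookup α ℓ ℕ.∸ 1 in _÷ℕ_ (x ℓ ^ m) (m !) {{m ℕ.!≢0}}

  -- The probability that m trials with outcome probabilities x give the counts
  -- i, for i₁ + … + iₛ = m.
  multinomialPMF : ∀ {s} → ℕ → Vector ℝ s → Vec ℕ s → ℝ
  multinomialPMF m x i = ι (m !) *
    product λ ℓ → let j = lookup i ℓ in _÷ℕ_ (x ℓ ^ j) (j !) {{j ℕ.!≢0}}

  -- A probability space, given through its expectation (Whittle's axioms).
  -- X HasMean e says that X is an integrable random variable with 𝔼[X] = e.
  -- Every measure-theoretic probability space is an instance.
  record ProbabilitySpace : Set₁ where
    infix 4 _HasMean_
    field
      Ω         : Set
      _HasMean_ : (Ω → ℝ) → ℝ → Set
      mean-cong   : ∀ {X Y e e′} → (∀ ω → X ω ≈ Y ω) → e ≈ e′ → X HasMean e → Y HasMean e′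
      mean-unique : ∀ {X e e′} → X HasMean e → X HasMean e′ → e ≈ e′
      mean-1      : (λ _ → 1#) HasMean 1#
      mean-+      : ∀ {X Y e e′} → X HasMean e → Y HasMean e′ → (λ ω → X ω + Y ω) HasMean (e + e′)
      mean-*      : ∀ {X e} c → X HasMean e → (λ ω → c * X ω) HasMean (c * e)
      mean-≥0     : ∀ {X e} → (∀ ω → 0# ≤ X ω) → X HasMean e → 0# ≤ e
      monotone-convergence :
        ∀ {X : ℕ → Ω → ℝ} {Y e e′} →
        (∀ i ω → X i ω ≤ X (suc i) ω) → (∀ ω → Tendsto (λ i → X i ω) (Y ω)) →
        (∀ i → X i HasMean e i) → Y HasMean e′ → Tendsto e e′

  open ProbabilitySpace using (Ω; _HasMean_)

  -- X and Y have the same distribution: for continuous φ, φ(X) is integrable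
  -- iff φ(Y) is, with the same expectation.  Bounded φ already determine the
  -- distribution; unbounded φ are then covered by change of variables.
  EqualInLaw : ∀ (P Q : ProbabilitySpace) {d} →
               (Ω P → Vector ℝ d) → (Ω Q → Vector ℝ d) → Set
  EqualInLaw P Q {d} X Y = ∀ (φ : Vector ℝ d → ℝ) → Continuous φ → ∀ e →
    (_HasMean_ P (λ ω → φ (X ω)) e → _HasMean_ Q (λ ω → φ (Y ω)) e) ×
    (_HasMean_ Q (λ ω → φ (Y ω)) e → _HasMean_ P (λ ω → φ (X ω)) e)

  -- X as a random vector of dimension 1.
  scalar : ∀ {A : Set} → (A → ℝ) → A → Vector ℝ 1
  scalar X a _ = X a

  -- The vector (X₀,…,X_{d-1}); equality in law and independence of families of
  -- random variables are those of all such initial segments.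
  initial : ∀ {A : Set} d → (ℕ → A → ℝ) → A → Vector ℝ d
  initial d X a j = X (toℕ j) a

  sampleSize : ∀ {s} → Vec ℕ s → ℕ
  sampleSize t = Vec.sum (Vec.map suc t) ℕ.∸ 1

  H : ∀ {s} → Vec ℕ s → ℝ
  H t = 1# - sum λ ℓ →
    ι (suc (lookup t ℓ) ℕ.* suc (suc (lookup t ℓ))) ÷ℕ (suc k ℕ.* suc (suc k))
    where k = sampleSize t

  -- The pivot ranks: R₀ = 0 and R_ℓ = R_{ℓ-1} + J_ℓ + 1.
  R : ∀ {s} → Vec ℕ s → Fin (suc s) → ℕ
  R J       zero    = 0
  R (j ∷ J) (suc ℓ) = suc j ℕ.+ R J ℓ

  -- R_{ℓ-1} < r < R_ℓ; segments are numbered from 0 here.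
  inSegment? : ∀ {s} (J : Vec ℕ s) (ℓ : Fin s) (r : ℕ) →
               Dec (R J (inject₁ ℓ) ℕ.< r × r ℕ.< R J (suc ℓ))
  inSegment? J ℓ r = (R J (inject₁ ℓ) ℕ.<? r) ×-dec (r ℕ.<? R J (suc ℓ))

  -- One partitioning step on n elements, for costs F on the probability space 𝓕.
  -- The step lives on a space of its own, as only the law of F n matters.
  record PartitioningStep {s} (t : Vec ℕ s) (𝓕 : ProbabilitySpace) (F : ℕ → Ω 𝓕 → ℝ)
                          (n : ℕ) : Set₁ where
    k : ℕ
    k = sampleSize t
    field
      space : ProbabilitySpace
    open ProbabilitySpace space public using () renaming (Ω to Ωₙ; _HasMean_ to _HasMeanₙ_)
    field
      D : Ωₙ → Vector ℝ s
      D-dirichlet : ∀ φ → Continuous φ → ∀ c →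
        SimplexIntegral (λ x → φ x * dirichletDensity (Vec.map suc t) x) c →
        (λ ω → φ (D ω)) HasMeanₙ c

      -- Conditionally on D, I is multinomial with n - k trials.
      I : Ωₙ → Vec ℕ s
      I-sum : ∀ ω → Vec.sum (I ω) ≡ n ℕ.∸ k
      I-multinomial : ∀ i → Vec.sum i ≡ n ℕ.∸ k → ∀ φ → Continuous φ → ∀ e →
        (λ ω → multinomialPMF (n ℕ.∸ k) (D ω) i * φ (D ω)) HasMeanₙ e →
        (λ ω → 𝟏 (Vec.≡-dec ℕ._≟_ (I ω) i) * φ (D ω)) HasMeanₙ e

    J : Ωₙ → Vec ℕ s
    J ω = Vec.zipWith ℕ._+_ t (I ω)

    field
      -- The rank Mₙ ∈ {1,…,n} is rank below; M itself counts from 0.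
      M : Ωₙ → Fin n
      M-uniform : ∀ r →
        (λ ω → 𝟏 (M ω Fin.≟ r)) HasMeanₙ (_÷ℕ_ 1# n {{Fin.nonZeroIndex r}})
      M-indep-J : ∀ r j p q →
        (λ ω → 𝟏 (M ω Fin.≟ r)) HasMeanₙ p →
        (λ ω → 𝟏 (Vec.≡-dec ℕ._≟_ (J ω) j)) HasMeanₙ q →
        (λ ω → 𝟏 (M ω Fin.≟ r) * 𝟏 (Vec.≡-dec ℕ._≟_ (J ω) j)) HasMeanₙ (p * q)

      A : Ωₙ → ℝ

      copy : Fin s → ℕ → Ωₙ → ℝ
      copy-law : ∀ ℓ d → EqualInLaw space 𝓕 (initial d (copy ℓ)) (initial d F)
      -- Mutual independence of the copies and of the triple (J, M, A).
      copy-indep : ∀ d (φ : Fin s → Vector ℝ d → ℝ) (ψ : Vec ℕ s → Fin n → Vector ℝ 1 → ℝ) →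
        (∀ ℓ → Continuous (φ ℓ)) → (∀ j r → Continuous (ψ j r)) → ∀ e e′ →
        (λ ω → ψ (J ω) (M ω) (scalar A ω)) HasMeanₙ e →
        (∀ ℓ → (λ ω → φ ℓ (initial d (copy ℓ) ω)) HasMeanₙ e′ ℓ) →
        (λ ω → ψ (J ω) (M ω) (scalar A ω) * product λ ℓ → φ ℓ (initial d (copy ℓ) ω))
          HasMeanₙ (e * product e′)

    rank : Ωₙ → ℕ
    rank ω = suc (toℕ (M ω))

    totalCost : Ωₙ → ℝ
    totalCost ω = A ω + sum λ ℓ →
      𝟏 (inSegment? (J ω) ℓ (rank ω)) * copy ℓ (lookup (J ω) ℓ) ω

    field
      recurrence : EqualInLaw 𝓕 space (scalar (F n)) (scalar totalCost)

  record Quickselect {s} (t : Vec ℕ s) : Set₁ where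
    field
      𝓕 : ProbabilitySpace
      F : ℕ → Ω 𝓕 → ℝ
      n₀ : ℕ
      -- Sampling k elements needs at least k elements.
      k≤n₀ : sampleSize t ℕ.≤ n₀
      small-integrable : ∀ n → n ℕ.< n₀ → ∃ (_HasMean_ 𝓕 (F n))
      small-bounded : ∃ λ C → ∀ n → n ℕ.< n₀ → ∀ ω → (- C ≤ F n ω) × (F n ω ≤ C)
      step : ∀ n → n₀ ℕ.≤ n → PartitioningStep t 𝓕 F n
    open ProbabilitySpace 𝓕 public using () renaming (_HasMean_ to _HasMeanᶠ_)

    -- e n = 𝔼[A(n)] for all n to which the recurrence applies.
    TollMean : (ℕ → ℝ) → Set
    TollMean e = ∀ n (n₀≤n : n₀ ℕ.≤ n) →
      let open PartitioningStep (step n n₀≤n) in A HasMeanₙ e n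

{-# OPTIONS --safe #-}
-- Conditionally on the subproblem sizes J, segment ℓ is recursed into with probability J_ℓ / n, so that
-- 𝔼[F_n] = 𝔼[A(n)] + ∑_ℓ 𝔼[(J_ℓ / n) 𝔼[F_{J_ℓ}]].  Evaluating the Dirichlet integral as a limit of
-- Riemann sums over compositions gives P(J = j) = ∏ C(j_ℓ, t_ℓ) / C(n, k), hence the exact moments
-- 𝔼[(J_ℓ+1)(J_ℓ+2)] = (t_ℓ+1)(t_ℓ+2)(n+1)(n+2) / ((k+1)(k+2)).  The step thus maps n ↦ c n to
-- (1 - H) c n + O(1), so c = a / H reproduces the toll a n up to o(n), and since 1 - H < 1 the
-- recursion contracts the difference between 𝔼[F_n] and c n down to o(n).
module Submission where

open import Defs
open import Data.Bool.Base using (true; false; if_then_else_)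
open import Data.Fin.Base using (Fin; zero; suc; toℕ; fromℕ<; inject₁)
import Data.Fin.Properties as Fin
open import Data.Nat.Base as ℕ using (ℕ; zero; suc; NonZero; _!)
open import Data.Nat.Combinatorics using (_C_; nCk≡nC[n∸k]; nCn≡1; k>n⇒nCk≡0; nCk+nC[k+1]≡[n+1]C[k+1])
open import Data.Nat.Induction using (<-rec)
import Data.Nat.Properties as ℕ
open import Data.Nat.Tactic.RingSolver using (solve-∀)
open import Data.Product.Base using (Σ; ∃; _×_; _,_; proj₁; proj₂)
open import Data.Sum.Base using (_⊎_; inj₁; inj₂; [_,_]′)
open import Data.Vec.Base as Vec using (Vec; []; _∷_; lookup; updateAt)
open import Data.Vec.Functional using (Vector)
import Data.Vec.Properties as Vec
open import Function.Base using (_∘_)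
open import Relation.Binary.PropositionalEquality as ≡ using (_≡_; _≢_)
open import Relation.Nullary using (¬_; Dec; yes; no; does; contradiction)

-- Two features of the setting shape the proof: the order on ℝ is not decidable, and `D-dirichlet`
-- yields a mean only for an integral whose value is exhibited as the limit of its Riemann sums.
-- Weights and moments are therefore handled as integer identities and inequalities, cleared of the
-- denominators n and C(n, k), and carried to ℝ by `ι`; minima, absolute values and sign
-- distinctions give way to explicit witnesses and pairs of one-sided bounds. The Riemann sums of a
-- monomial are squeezed by replacing each power by a falling or a rising factorial, whose sums over
-- compositions are exact by Vandermonde convolution. The same convolution gives the total weight
-- C(n, k) and the moments. The factors (J+1)(J+2) are preferred to J² because the weight C(J, t)
-- absorbs them: the result is again such a weight, with t + 2 in place of t. That F_n has a mean
-- for n ≥ n₀ is part of the conclusion: equality in law carries the mean of the right-hand side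
-- back to F_n. As the random size J_ℓ is the index of the copy, the cost is split by the value of
-- J_ℓ, so that independence applies to a copy of fixed index.

module Compositions where

  open import Data.Nat.Base
  open import Data.Nat.Properties
  open import Relation.Binary.PropositionalEquality hiding ([_])
  open import Algebra.Properties.Semiring.Sum +-*-semiring public
    using (sum; sum-cong-≗; ∑-distrib-+; ∑-comm; sum-replicate-zero; *-distribˡ-sum; *-distribʳ-sum)
  open import Algebra.Properties.CommutativeMonoid.Sum *-1-commutativeMonoid public
    using () renaming (sum to ∏; sum-cong-≗ to ∏-cong; ∑-distrib-+ to ∏-distrib-*)

  -- Binomial coefficients without division

  pascal : ∀ n k → suc n C suc k ≡ n C k + n C suc k
  pascal n k = sym (nCk+nC[k+1]≡[n+1]C[k+1] n k)

  nC0≡1 : ∀ n → n C 0 ≡ 1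
  nC0≡1 n = trans (nCk≡nC[n∸k] {0} {n} z≤n) (nCn≡1 n)

  -- Absorption: a linear factor becomes a shift of both arguments. This is the mechanism behind the
  -- factorial and moment formulas below.
  [1+k]*[1+n]C[1+k]≡[1+n]*nCk : ∀ n k → suc k * (suc n C suc k) ≡ suc n * (n C k)
  [1+k]*[1+n]C[1+k]≡[1+n]*nCk zero zero = refl
  [1+k]*[1+n]C[1+k]≡[1+n]*nCk zero (suc k) = *-zeroʳ (suc (suc k))
  [1+k]*[1+n]C[1+k]≡[1+n]*nCk (suc n) zero = begin
    1 * (suc (suc n) C 1)              ≡⟨ cong (1 *_) (pascal (suc n) 0) ⟩
    1 * (suc n C 0 + suc n C 1)        ≡⟨ cong (λ x → 1 * (x + suc n C 1)) (nC0≡1 (suc n)) ⟩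
    suc (1 * (suc n C 1))              ≡⟨ cong suc ([1+k]*[1+n]C[1+k]≡[1+n]*nCk n 0) ⟩
    suc (suc n * (n C 0))              ≡⟨ cong (λ x → suc (suc n * x)) (nC0≡1 n) ⟩
    suc (suc n * 1)                    ≡⟨ solve-1 n ⟩
    suc (suc n) * 1                    ≡⟨ cong (suc (suc n) *_) (nC0≡1 (suc n)) ⟨
    suc (suc n) * (suc n C 0)          ∎
    where
    open ≡-Reasoning
    solve-1 : ∀ n → suc (suc n * 1) ≡ suc (suc n) * 1
    solve-1 = solve-∀
  [1+k]*[1+n]C[1+k]≡[1+n]*nCk (suc n) (suc k) = begin
    suc (suc k) * (suc (suc n) C suc (suc k))
      ≡⟨ cong (suc (suc k) *_) (pascal (suc n) (suc k)) ⟩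
    suc (suc k) * (X + Y)
      ≡⟨ regroup k X Y ⟩
    suc k * X + suc (suc k) * Y + X
      ≡⟨ cong₂ (λ x y → x + y + X) ([1+k]*[1+n]C[1+k]≡[1+n]*nCk n k) ([1+k]*[1+n]C[1+k]≡[1+n]*nCk n (suc k)) ⟩
    suc n * (n C k) + suc n * (n C suc k) + X
      ≡⟨ cong (_+ X) (*-distribˡ-+ (suc n) (n C k) (n C suc k)) ⟨
    suc n * (n C k + n C suc k) + X
      ≡⟨ cong (λ x → suc n * x + X) (pascal n k) ⟨
    suc n * X + X
      ≡⟨ +-comm (suc n * X) X ⟩
    suc (suc n) * X ∎
    where
    open ≡-Reasoning
    X = suc n C suc k
    Y = suc n C suc (suc k)
    regroup : ∀ k x y → suc (suc k) * (x + y) ≡ suc k * x + suc (suc k) * y + x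
    regroup = solve-∀

  [m+n]Cn*m!n!≡[m+n]! : ∀ m n → ((m + n) C n) * (m ! * n !) ≡ (m + n) !
  [m+n]Cn*m!n!≡[m+n]! m zero = begin
    ((m + 0) C 0) * (m ! * 1) ≡⟨ cong₂ _*_ (nC0≡1 (m + 0)) (*-identityʳ (m !)) ⟩
    1 * m !                   ≡⟨ *-identityˡ (m !) ⟩
    m !                       ≡⟨ cong _! (+-identityʳ m) ⟨
    (m + 0) !                 ∎
    where open ≡-Reasoning
  [m+n]Cn*m!n!≡[m+n]! m (suc n) = begin
    ((m + suc n) C suc n) * (m ! * (suc n * n !))
      ≡⟨ cong (λ x → (x C suc n) * (m ! * (suc n * n !))) (+-suc m n) ⟩
    (suc (m + n) C suc n) * (m ! * (suc n * n !))
      ≡⟨ regroup (suc (m + n) C suc n) (m !) (suc n) (n !) ⟩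
    suc n * (suc (m + n) C suc n) * (m ! * n !)
      ≡⟨ cong (_* (m ! * n !)) ([1+k]*[1+n]C[1+k]≡[1+n]*nCk (m + n) n) ⟩
    suc (m + n) * ((m + n) C n) * (m ! * n !)
      ≡⟨ *-assoc (suc (m + n)) ((m + n) C n) (m ! * n !) ⟩
    suc (m + n) * (((m + n) C n) * (m ! * n !))
      ≡⟨ cong (suc (m + n) *_) ([m+n]Cn*m!n!≡[m+n]! m n) ⟩
    suc (m + n) !
      ≡⟨ cong _! (+-suc m n) ⟨
    (m + suc n) ! ∎
    where
    open ≡-Reasoning
    regroup : ∀ c a b d → c * (a * (b * d)) ≡ b * c * (a * d)
    regroup = solve-∀

  -- Sums over compositions

  sumComp : ∀ s → ℕ → (Vec ℕ s → ℕ) → ℕ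
  sumComp zero    zero    f = f []
  sumComp zero    (suc N) f = 0
  sumComp (suc s) N       f = sum {suc N} λ i → sumComp s (N ∸ toℕ i) λ v → f (toℕ i ∷ v)

  sum-mono : ∀ {n} {f g : Fin n → ℕ} → (∀ i → f i ≤ g i) → sum f ≤ sum g
  sum-mono {zero}  f≤g = z≤n
  sum-mono {suc n} f≤g = +-mono-≤ (f≤g zero) (sum-mono (f≤g ∘ suc))

  ∏-mono : ∀ {n} {f g : Fin n → ℕ} → (∀ i → f i ≤ g i) → ∏ f ≤ ∏ g
  ∏-mono {zero}  f≤g = ≤-refl
  ∏-mono {suc n} f≤g = *-mono-≤ (f≤g zero) (∏-mono (f≤g ∘ suc))

  sumComp-mono : ∀ s N {f g} → (∀ v → Vec.sum v ≡ N → f v ≤ g v) → sumComp s N f ≤ sumComp s N g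
  sumComp-mono zero    zero    f≤g = f≤g [] refl
  sumComp-mono zero    (suc N) f≤g = z≤n
  sumComp-mono (suc s) N       f≤g = sum-mono {suc N} λ i →
    sumComp-mono s (N ∸ toℕ i) λ v Σv → f≤g (toℕ i ∷ v) (toℕ+[∸] i Σv)
    where
    toℕ+[∸] : ∀ {N} (i : Fin (suc N)) {x} → x ≡ N ∸ toℕ i → toℕ i + x ≡ N
    toℕ+[∸] i x≡ = trans (cong (toℕ i +_) x≡) (m+[n∸m]≡n (Fin.toℕ≤pred[n] i))

  sumComp-cong : ∀ s N {f g} → (∀ v → f v ≡ g v) → sumComp s N f ≡ sumComp s N g
  sumComp-cong s N f≡g = ≤-antisym
    (sumComp-mono s N λ v _ → ≤-reflexive (f≡g v)) (sumComp-mono s N λ v _ → ≤-reflexive (sym (f≡g v)))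

  sumComp-∑ : ∀ s N {m} (f : Fin m → Vec ℕ s → ℕ) →
    sumComp s N (λ v → sum λ ℓ → f ℓ v) ≡ sum λ ℓ → sumComp s N (f ℓ)
  sumComp-∑ zero    zero    f = refl
  sumComp-∑ zero    (suc N) {m} f = sym (sum-replicate-zero m)
  sumComp-∑ (suc s) N       {m} f = trans
    (sum-cong-≗ {suc N} λ i → sumComp-∑ s (N ∸ toℕ i) λ ℓ v → f ℓ (toℕ i ∷ v))
    (∑-comm {suc N} {m} λ i ℓ → sumComp s (N ∸ toℕ i) λ v → f ℓ (toℕ i ∷ v))

  sumComp-+ : ∀ s N f g → sumComp s N (λ v → f v + g v) ≡ sumComp s N f + sumComp s N g
  sumComp-+ zero    zero    f g = refl
  sumComp-+ zero    (suc N) f g = refl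
  sumComp-+ (suc s) N       f g = trans
    (sum-cong-≗ {suc N} λ i → sumComp-+ s (N ∸ toℕ i) (λ v → f (toℕ i ∷ v)) (λ v → g (toℕ i ∷ v)))
    (∑-distrib-+ {suc N} (λ i → sumComp s (N ∸ toℕ i) λ v → f (toℕ i ∷ v)) (λ i → sumComp s (N ∸ toℕ i) λ v → g (toℕ i ∷ v)))

  sumComp-*ˡ : ∀ s N c f → sumComp s N (λ v → c * f v) ≡ c * sumComp s N f
  sumComp-*ˡ zero    zero    c f = refl
  sumComp-*ˡ zero    (suc N) c f = sym (*-zeroʳ c)
  sumComp-*ˡ (suc s) N       c f = trans
    (sum-cong-≗ {suc N} λ i → sumComp-*ˡ s (N ∸ toℕ i) c λ v → f (toℕ i ∷ v))
    (sym (*-distribˡ-sum {suc N} c λ i → sumComp s (N ∸ toℕ i) λ v → f (toℕ i ∷ v)))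

  -- Only i = N leaves the remainder 0 that the empty tail needs: the last part of a composition is
  -- forced.
  sumComp-0 : ∀ N (g : ℕ → Vec ℕ 0 → ℕ) → sum {suc N} (λ i → sumComp 0 (N ∸ toℕ i) (g (toℕ i))) ≡ g N []
  sumComp-0 zero    g = +-identityʳ (g 0 [])
  sumComp-0 (suc N) g = sumComp-0 N (g ∘ suc)

  convolution : ℕ → (ℕ → ℕ) → (ℕ → ℕ) → ℕ
  convolution N f g = sum {suc N} λ i → f (toℕ i) * g (N ∸ toℕ i)

  convolution-+ˡ : ∀ N {f f₁ f₂} g → (∀ i → f i ≡ f₁ i + f₂ i) →
    convolution N f g ≡ convolution N f₁ g + convolution N f₂ g
  convolution-+ˡ N {f} {f₁} {f₂} g eq = trans
    (sum-cong-≗ {suc N} λ i → trans (cong (_* g (N ∸ toℕ i)) (eq (toℕ i)))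
                          (*-distribʳ-+ (g (N ∸ toℕ i)) (f₁ (toℕ i)) (f₂ (toℕ i))))
    (∑-distrib-+ {suc N} (λ i → f₁ (toℕ i) * g (N ∸ toℕ i)) (λ i → f₂ (toℕ i) * g (N ∸ toℕ i)))

  -- Compare coefficients of x^(b-a)/(1-x)^(b+1) · x^(d-e)/(1-x)^(d+1).
  vandermonde : ∀ N a b e d → a ≤ b → e ≤ d →
    convolution N (λ i → (i + a) C b) (λ i → (i + e) C d) ≡ suc (N + a + e) C suc (b + d)
  vandermonde zero zero zero e d _ e≤d = begin
    (0 C 0) * (e C d) + 0   ≡⟨ +-identityʳ _ ⟩
    1 * (e C d)             ≡⟨ *-identityˡ (e C d) ⟩
    e C d                   ≡⟨ +-identityʳ (e C d) ⟨
    e C d + 0               ≡⟨ cong (e C d +_) (k>n⇒nCk≡0 (s≤s e≤d)) ⟨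
    e C d + e C suc d       ≡⟨ pascal e d ⟨
    suc e C suc d           ∎
    where open ≡-Reasoning
  vandermonde (suc N) zero zero e d _ e≤d = begin
    ((0 + 0) C 0) * X + convolution N (λ i → (suc i + 0) C 0) (λ i → (i + e) C d)
      ≡⟨ cong₂ (λ x y → x * X + y) (nC0≡1 0) (sum-cong-≗ {suc N} λ i →
           cong (_* ((N ∸ toℕ i + e) C d)) (trans (nC0≡1 (suc (toℕ i + 0))) (sym (nC0≡1 (toℕ i + 0))))) ⟩
    1 * X + convolution N (λ i → (i + 0) C 0) (λ i → (i + e) C d)
      ≡⟨ cong₂ _+_ (*-identityˡ X) (vandermonde N 0 0 e d z≤n e≤d) ⟩
    X + suc (N + 0 + e) C suc d
      ≡⟨ cong (λ x → X + suc (x + e) C suc d) (+-identityʳ N) ⟩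
    (suc N + e) C d + (suc N + e) C suc d
      ≡⟨ pascal (suc N + e) d ⟨
    suc (suc N + e) C suc d
      ≡⟨ cong (λ x → suc (suc x + e) C suc d) (+-identityʳ N) ⟨
    suc (suc N + 0 + e) C suc d ∎
    where
    open ≡-Reasoning
    X = (suc N + e) C d
  vandermonde zero zero (suc b) e d _ e≤d = sym (k>n⇒nCk≡0 (s≤s (s≤s (m≤n⇒m≤o+n b e≤d))))
  vandermonde (suc N) zero (suc b) e d _ e≤d = begin
    ((0 + 0) C suc b) * X + convolution N (λ i → (suc i + 0) C suc b) g
      -- The term i = 0 vanishes by computation, as `0 C suc b` is 0; Pascal's rule splits the
      -- others.
      ≡⟨ convolution-+ˡ N {f₁ = λ i → (i + 0) C b} {λ i → (i + 0) C suc b} g (λ i → pascal (i + 0) b) ⟩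
    convolution N (λ i → (i + 0) C b) g + convolution N (λ i → (i + 0) C suc b) g
      ≡⟨ cong₂ _+_ (vandermonde N 0 b e d z≤n e≤d) (vandermonde N 0 (suc b) e d z≤n e≤d) ⟩
    suc (N + 0 + e) C suc (b + d) + suc (N + 0 + e) C suc (suc b + d)
      ≡⟨ pascal (suc (N + 0 + e)) (suc (b + d)) ⟨
    suc (suc N + 0 + e) C suc (suc b + d) ∎
    where
    open ≡-Reasoning
    X = (suc N + e) C d
    g : ℕ → ℕ
    g i = (i + e) C d
  vandermonde N (suc a) (suc b) e d (s≤s a≤b) e≤d = begin
    convolution N (λ i → (i + suc a) C suc b) g
      ≡⟨ convolution-+ˡ N {f₁ = λ i → (i + a) C b} {λ i → (i + a) C suc b} g (λ i → trans (cong (_C suc b) (+-suc i a)) (pascal (i + a) b)) ⟩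
    convolution N (λ i → (i + a) C b) g + convolution N (λ i → (i + a) C suc b) g
      ≡⟨ cong₂ _+_ (vandermonde N a b e d a≤b e≤d) (vandermonde N a (suc b) e d (m≤n⇒m≤1+n a≤b) e≤d) ⟩
    suc (N + a + e) C suc (b + d) + suc (N + a + e) C suc (suc b + d)
      ≡⟨ pascal (suc (N + a + e)) (suc (b + d)) ⟨
    suc (suc (N + a) + e) C suc (suc b + d)
      ≡⟨ cong (λ x → suc (x + e) C suc (suc b + d)) (+-suc N a) ⟨
    suc (N + suc a + e) C suc (suc b + d) ∎
    where
    open ≡-Reasoning
    g : ℕ → ℕ
    g i = (i + e) C d

  binomials : ∀ {s} → Vec ℕ s → Vec ℕ s → Vec ℕ s → ℕ
  binomials a b v = ∏ λ ℓ → (lookup v ℓ + lookup a ℓ) C lookup b ℓ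

  sum-vec-mono : ∀ {s} (a b : Vec ℕ s) → (∀ ℓ → lookup a ℓ ≤ lookup b ℓ) → Vec.sum a ≤ Vec.sum b
  sum-vec-mono []      []      _   = z≤n
  sum-vec-mono (x ∷ a) (y ∷ b) a≤b = +-mono-≤ (a≤b zero) (sum-vec-mono a b (a≤b ∘ suc))

  -- Coordinate ℓ has the generating function x^(b_ℓ - a_ℓ) / (1-x)^(b_ℓ + 1), and the product over
  -- s + 1 coordinates has the same form, so `vandermonde` removes one coordinate at a time. The
  -- cases a = b and a = 0 give sums of rising and of falling factorials.
  sumComp-binomials : ∀ s N (a b : Vec ℕ (suc s)) → (∀ ℓ → lookup a ℓ ≤ lookup b ℓ) →
    sumComp (suc s) N (binomials a b) ≡ (N + Vec.sum a + s) C (Vec.sum b + s)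
  sumComp-binomials zero N (a₀ ∷ []) (b₀ ∷ []) a≤b = begin
    sum {suc N} (λ i → sumComp 0 (N ∸ toℕ i) λ v → binomials (a₀ ∷ []) (b₀ ∷ []) (toℕ i ∷ v))
      ≡⟨ sumComp-0 N (λ i v → binomials (a₀ ∷ []) (b₀ ∷ []) (i ∷ v)) ⟩
    ((N + a₀) C b₀) * 1
      ≡⟨ *-identityʳ _ ⟩
    (N + a₀) C b₀
      ≡⟨ cong₂ _C_ (ids₂ N a₀) (ids₁ b₀) ⟩
    (N + (a₀ + 0) + 0) C (b₀ + 0 + 0) ∎
    where
    open ≡-Reasoning
    ids₁ : ∀ b → b ≡ b + 0 + 0
    ids₁ = solve-∀
    ids₂ : ∀ n a → n + a ≡ n + (a + 0) + 0
    ids₂ = solve-∀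
  sumComp-binomials (suc s) N (a₀ ∷ a) (b₀ ∷ b) a≤b = begin
    sum {suc N} (λ i → sumComp (suc s) (N ∸ toℕ i) λ v → ((toℕ i + a₀) C b₀) * binomials a b v)
      ≡⟨ sum-cong-≗ {suc N} (λ i → sumComp-*ˡ (suc s) (N ∸ toℕ i) ((toℕ i + a₀) C b₀) (binomials a b)) ⟩
    sum {suc N} (λ i → ((toℕ i + a₀) C b₀) * sumComp (suc s) (N ∸ toℕ i) (binomials a b))
      ≡⟨ sum-cong-≗ {suc N} (λ i → cong (((toℕ i + a₀) C b₀) *_)
           (trans (sumComp-binomials s (N ∸ toℕ i) a b (a≤b ∘ suc))
                  (cong (_C (Vec.sum b + s)) (+-assoc (N ∸ toℕ i) (Vec.sum a) s)))) ⟩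
    convolution N (λ i → (i + a₀) C b₀) (λ i → (i + (Vec.sum a + s)) C (Vec.sum b + s))
      ≡⟨ vandermonde N a₀ b₀ (Vec.sum a + s) (Vec.sum b + s) (a≤b zero)
           (+-monoˡ-≤ s (sum-vec-mono a b (a≤b ∘ suc))) ⟩
    suc (N + a₀ + (Vec.sum a + s)) C suc (b₀ + (Vec.sum b + s))
      ≡⟨ cong₂ _C_ (regroup N a₀ (Vec.sum a) s) (regroup′ b₀ (Vec.sum b) s) ⟩
    (N + (a₀ + Vec.sum a) + suc s) C (b₀ + Vec.sum b + suc s) ∎
    where
    open ≡-Reasoning
    regroup : ∀ n a b c → suc (n + a + (b + c)) ≡ n + (a + b) + suc c
    regroup = solve-∀
    regroup′ : ∀ a b c → suc (a + (b + c)) ≡ a + b + suc c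
    regroup′ = solve-∀

  -- Powers against falling and rising factorials

  C-mono : ∀ m n k → m C k ≤ (m + n) C k
  C-mono m zero    k = ≤-reflexive (cong (_C k) (sym (+-identityʳ m)))
  C-mono m (suc n) zero = ≤-reflexive (trans (nC0≡1 m) (sym (nC0≡1 (m + suc n))))
  C-mono m (suc n) (suc k) = begin
    m C suc k                          ≤⟨ C-mono m n (suc k) ⟩
    (m + n) C suc k                    ≤⟨ m≤n+m _ _ ⟩
    (m + n) C k + (m + n) C suc k      ≡⟨ pascal (m + n) k ⟨
    suc (m + n) C suc k                ≡⟨ cong (_C suc k) (+-suc m n) ⟨
    (m + suc n) C suc k                ∎
    where open ≤-Reasoning

  -- `k ! * (n C k)` is the falling factorial n(n-1)⋯(n-k+1). Its next factor n - k is split over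
  -- the two sides to avoid subtraction.
  falling-suc : ∀ n k → (suc k) ! * (n C suc k) + k * (k ! * (n C k)) ≡ n * (k ! * (n C k))
  falling-suc n k = +-cancelʳ-≡ (k ! * (n C k)) _ _ (begin
    suc k * k ! * Y + k * (k ! * X) + k ! * X ≡⟨ regroup k (k !) X Y ⟩
    k ! * (suc k * (X + Y))                   ≡⟨ cong (λ x → k ! * (suc k * x)) (pascal n k) ⟨
    k ! * (suc k * (suc n C suc k))           ≡⟨ cong (k ! *_) ([1+k]*[1+n]C[1+k]≡[1+n]*nCk n k) ⟩
    k ! * (suc n * X)                         ≡⟨ regroup′ n (k !) X ⟩
    n * (k ! * X) + k ! * X                   ∎)
    where
    open ≡-Reasoning
    X = n C k
    Y = n C suc k
    regroup : ∀ k f x y → suc k * f * y + k * (f * x) + f * x ≡ f * (suc k * (x + y))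
    regroup = solve-∀
    regroup′ : ∀ n f x → f * (suc n * x) ≡ n * (f * x) + f * x
    regroup′ = solve-∀

  -- `k ! * ((n + k) C k)` is the rising factorial (n+1)⋯(n+k).
  rising-suc : ∀ n k → (suc k) ! * ((n + suc k) C suc k) ≡ suc (n + k) * (k ! * ((n + k) C k))
  rising-suc n k = begin
    suc k * k ! * ((n + suc k) C suc k)  ≡⟨ cong (λ x → suc k * k ! * (x C suc k)) (+-suc n k) ⟩
    suc k * k ! * (suc (n + k) C suc k)  ≡⟨ regroup (suc k) (k !) (suc (n + k) C suc k) ⟩
    k ! * (suc k * (suc (n + k) C suc k)) ≡⟨ cong (k ! *_) ([1+k]*[1+n]C[1+k]≡[1+n]*nCk (n + k) k) ⟩
    k ! * (suc (n + k) * ((n + k) C k))  ≡⟨ regroup₂ (suc (n + k)) (k !) _ ⟩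
    suc (n + k) * (k ! * ((n + k) C k))  ∎
    where
    open ≡-Reasoning
    regroup : ∀ a b c → a * b * c ≡ b * (a * c)
    regroup = solve-∀
    regroup₂ : ∀ a b c → b * (a * c) ≡ a * (b * c)
    regroup₂ = solve-∀

  falling≤^ : ∀ n k → k ! * (n C k) ≤ n ^ k
  falling≤^ n zero = ≤-reflexive (trans (+-identityʳ _) (nC0≡1 n))
  falling≤^ n (suc k) = begin
    (suc k) ! * (n C suc k)                          ≤⟨ m≤m+n _ _ ⟩
    (suc k) ! * (n C suc k) + k * (k ! * (n C k))    ≡⟨ falling-suc n k ⟩
    n * (k ! * (n C k))                              ≤⟨ *-monoʳ-≤ n (falling≤^ n k) ⟩
    n * n ^ k                                        ∎
    where open ≤-Reasoning

  ^≤rising : ∀ n k → n ^ k ≤ k ! * ((n + k) C k)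
  ^≤rising n zero = ≤-reflexive (sym (trans (+-identityʳ _) (nC0≡1 (n + 0))))
  ^≤rising n (suc k) = begin
    n * n ^ k                              ≤⟨ *-mono-≤ (m≤n⇒m≤1+n (m≤m+n n k)) (^≤rising n k) ⟩
    suc (n + k) * (k ! * ((n + k) C k))    ≡⟨ rising-suc n k ⟨
    (suc k) ! * ((n + suc k) C suc k)      ∎
    where open ≤-Reasoning

  -- The falling factorial loses at most a relative error K / n against the power; the additional
  -- factor n states this without division. The factors n - j contribute j each, so K is 0 + 1 + ⋯ +
  -- (k - 1).
  ^≲falling : ∀ k → ∃ λ K → ∀ n → n * n ^ k ≤ n * (k ! * (n C k)) + K * n ^ k
  ^≲falling zero = 0 , λ n → ≤-reflexive (cong (n *_) (sym (trans (+-identityʳ _) (nC0≡1 n)))) ⟨≤⟩ m≤m+n _ _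
    where _⟨≤⟩_ = ≤-trans
  ^≲falling (suc k) with ^≲falling k
  ... | K , h = K + k , λ n → begin
    n * (n * n ^ k)
      ≤⟨ *-monoʳ-≤ n (h n) ⟩
    n * (n * (k ! * (n C k)) + K * n ^ k)
      ≡⟨ cong (λ x → n * (x + K * n ^ k)) (falling-suc n k) ⟨
    n * ((suc k) ! * (n C suc k) + k * (k ! * (n C k)) + K * n ^ k)
      ≤⟨ *-monoʳ-≤ n (+-monoˡ-≤ (K * n ^ k) (+-monoʳ-≤ ((suc k) ! * (n C suc k)) (*-monoʳ-≤ k (falling≤^ n k)))) ⟩
    n * ((suc k) ! * (n C suc k) + k * n ^ k + K * n ^ k)
      ≡⟨ regroup n ((suc k) ! * (n C suc k)) k K (n ^ k) ⟩
    n * ((suc k) ! * (n C suc k)) + (K + k) * (n * n ^ k) ∎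
    where
    open ≤-Reasoning
    regroup : ∀ n f k K p → n * (f + k * p + K * p) ≡ n * f + (K + k) * (n * p)
    regroup = solve-∀

  rising≲^ : ∀ k → ∃ λ K → ∀ n → suc n * (k ! * ((suc n + k) C k)) ≤ (suc n + K) * suc n ^ k
  rising≲^ zero = 0 , λ n → *-mono-≤ (m≤m+n (suc n) 0) (≤-reflexive (trans (+-identityʳ _) (nC0≡1 (suc n + 0))))
  rising≲^ (suc k) with rising≲^ k
  ... | K , h = suc k + K + K * suc k , λ n → let m = suc n in begin
    m * ((suc k) ! * ((m + suc k) C suc k))
      ≡⟨ cong (m *_) (rising-suc m k) ⟩
    m * (suc (m + k) * (k ! * ((m + k) C k)))
      ≡⟨ regroup m (suc (m + k)) (k ! * ((m + k) C k)) ⟩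
    suc (m + k) * (m * (k ! * ((m + k) C k)))
      ≤⟨ *-monoʳ-≤ (suc (m + k)) (h n) ⟩
    suc (m + k) * ((m + K) * m ^ k)
      -- (m + k + 1)(m + K) has the constant term K(k + 1), which is at most K(k + 1)m because m = n
      -- + 1 is positive; the added term is the difference.
      ≤⟨ m≤m+n _ (K * suc k * n * m ^ k) ⟩
    suc (m + k) * ((m + K) * m ^ k) + K * suc k * n * m ^ k
      ≡⟨ regroup₂ n k K (m ^ k) ⟩
    (m + (suc k + K + K * suc k)) * (m * m ^ k) ∎
    where
    open ≤-Reasoning
    regroup : ∀ a b c → a * (b * c) ≡ b * (a * c)
    regroup = solve-∀
    regroup₂ : ∀ n k K p → suc (suc n + k) * ((suc n + K) * p) + K * suc k * n * p
                 ≡ (suc n + (suc k + K + K * suc k)) * (suc n * p)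
    regroup₂ = solve-∀

  powers : ∀ {s} → Vec ℕ s → Vec ℕ s → ℕ
  powers b v = ∏ λ ℓ → lookup v ℓ ^ lookup b ℓ

  factorials : ∀ {s} → Vec ℕ s → ℕ
  factorials b = ∏ λ ℓ → lookup b ℓ !

  -- Divided by p! m^(p+1), both bounds say that the sum of the monomial is m^p ∏ b_ℓ! / p! up to a
  -- relative error K / m. The limit ∏ b_ℓ! / (∑ b_ℓ + s)! is the Dirichlet integral of x^b.
  sumComp-powers : ∀ s (b : Vec ℕ (suc s)) → let p = Vec.sum b + s in ∃ λ K → ∀ n → let m = suc n in
    (p ! * sumComp (suc s) m (powers b) * m ≤ factorials b * ((m + K) * m ^ p)) ×
    (factorials b * (m * m ^ p) ≤ p ! * sumComp (suc s) m (powers b) * m + factorials b * (K * m ^ p))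
  sumComp-powers s b = K₁ + K₂ , λ n → upper n , lower n
    where
    open ≤-Reasoning
    p = Vec.sum b + s
    B = factorials b
    K₁ = let (K , _) = rising≲^ p in K
    K₂ = let (K , _) = ^≲falling p in K
    S : ℕ → ℕ
    S m = sumComp (suc s) m (powers b)

    sum-zeros : ∀ n → Vec.sum (Vec.replicate n 0) ≡ 0
    sum-zeros zero    = refl
    sum-zeros (suc n) = sum-zeros n

    lookup-zeros : ∀ {n} (ℓ : Fin n) → lookup (Vec.replicate n 0) ℓ ≡ 0
    lookup-zeros zero    = refl
    lookup-zeros (suc ℓ) = lookup-zeros ℓ

    S≤ : ∀ m → S m ≤ B * ((m + p) C p)
    S≤ m = begin
      S m
        ≤⟨ sumComp-mono (suc s) m (λ v _ → ∏-mono λ ℓ → ^≤rising (lookup v ℓ) (lookup b ℓ)) ⟩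
      sumComp (suc s) m (λ v → ∏ λ ℓ → lookup b ℓ ! * ((lookup v ℓ + lookup b ℓ) C lookup b ℓ))
        ≡⟨ sumComp-cong (suc s) m (λ v → ∏-distrib-* (λ ℓ → lookup b ℓ !) (λ ℓ → (lookup v ℓ + lookup b ℓ) C lookup b ℓ)) ⟩
      sumComp (suc s) m (λ v → B * binomials b b v)
        ≡⟨ sumComp-*ˡ (suc s) m B (binomials b b) ⟩
      B * sumComp (suc s) m (binomials b b)
        ≡⟨ cong (B *_) (sumComp-binomials s m b b (λ _ → ≤-refl)) ⟩
      B * ((m + Vec.sum b + s) C p)
        ≡⟨ cong (λ x → B * (x C p)) (+-assoc m (Vec.sum b) s) ⟩
      B * ((m + p) C p) ∎

    -- With zero shifts `binomials` is a product of falling factorials over `B`, and its sum C(m +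
    -- s, p) is at least C(m, p).
    ≤S : ∀ m → B * (m C p) ≤ S m
    ≤S m = begin
      B * (m C p)
        ≤⟨ *-monoʳ-≤ B (C-mono m s p) ⟩
      B * ((m + s) C p)
        ≡⟨ cong (λ x → B * ((x + s) C p)) (+-identityʳ m) ⟨
      B * ((m + 0 + s) C p)
        ≡⟨ cong (λ x → B * ((m + x + s) C p)) (sum-zeros (suc s)) ⟨
      B * ((m + Vec.sum zeros + s) C p)
        ≡⟨ cong (B *_) (sumComp-binomials s m zeros b λ ℓ → subst (_≤ lookup b ℓ) (sym (lookup-zeros ℓ)) z≤n) ⟨
      B * sumComp (suc s) m (binomials zeros b)
        ≡⟨ sumComp-*ˡ (suc s) m B (binomials zeros b) ⟨
      sumComp (suc s) m (λ v → B * binomials zeros b v)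
        ≡⟨ sumComp-cong (suc s) m (λ v → ∏-distrib-* (λ ℓ → lookup b ℓ !) (λ ℓ → (lookup v ℓ + lookup zeros ℓ) C lookup b ℓ)) ⟨
      sumComp (suc s) m (λ v → ∏ λ ℓ → lookup b ℓ ! * ((lookup v ℓ + lookup zeros ℓ) C lookup b ℓ))
        ≡⟨ sumComp-cong (suc s) m (λ v → ∏-cong λ ℓ → cong (λ x → lookup b ℓ ! * (x C lookup b ℓ))
             (trans (cong (lookup v ℓ +_) (lookup-zeros ℓ)) (+-identityʳ (lookup v ℓ)))) ⟩
      sumComp (suc s) m (λ v → ∏ λ ℓ → lookup b ℓ ! * (lookup v ℓ C lookup b ℓ))
        ≤⟨ sumComp-mono (suc s) m (λ v _ → ∏-mono λ ℓ → falling≤^ (lookup v ℓ) (lookup b ℓ)) ⟩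
      S m ∎
      where
      zeros : Vec ℕ (suc s)
      zeros = Vec.replicate (suc s) 0

    regroup : ∀ f b c m → f * (b * c) * m ≡ b * (m * (f * c))
    regroup = solve-∀

    upper : ∀ n → let m = suc n in p ! * S m * m ≤ B * ((m + (K₁ + K₂)) * m ^ p)
    upper n = let m = suc n; (_ , h) = rising≲^ p in begin
      p ! * S m * m                         ≤⟨ *-monoˡ-≤ m (*-monoʳ-≤ (p !) (S≤ m)) ⟩
      p ! * (B * ((m + p) C p)) * m         ≡⟨ regroup (p !) B _ m ⟩
      B * (m * (p ! * ((m + p) C p)))       ≤⟨ *-monoʳ-≤ B (h n) ⟩
      B * ((m + K₁) * m ^ p)                ≤⟨ *-monoʳ-≤ B (*-monoˡ-≤ (m ^ p) (+-monoʳ-≤ m (m≤m+n K₁ K₂))) ⟩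
      B * ((m + (K₁ + K₂)) * m ^ p)         ∎

    lower : ∀ n → let m = suc n in B * (m * m ^ p) ≤ p ! * S m * m + B * ((K₁ + K₂) * m ^ p)
    lower n = let m = suc n; (_ , h) = ^≲falling p in begin
      B * (m * m ^ p)                                     ≤⟨ *-monoʳ-≤ B (h m) ⟩
      B * (m * (p ! * (m C p)) + K₂ * m ^ p)              ≡⟨ *-distribˡ-+ B _ _ ⟩
      B * (m * (p ! * (m C p))) + B * (K₂ * m ^ p)        ≡⟨ cong (_+ B * (K₂ * m ^ p)) (regroup (p !) B _ m) ⟨
      p ! * (B * (m C p)) * m + B * (K₂ * m ^ p)
        ≤⟨ +-mono-≤ (*-monoˡ-≤ m (*-monoʳ-≤ (p !) (≤S m))) (*-monoʳ-≤ B (*-monoˡ-≤ (m ^ p) (m≤n+m K₂ K₁))) ⟩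
      p ! * S m * m + B * ((K₁ + K₂) * m ^ p)             ∎

  -- Exact moments of the subproblem sizes

  ∏-modify : ∀ {n} (f g : Fin n → ℕ) ℓ x y → (∀ i → i ≢ ℓ → f i ≡ g i) → x * f ℓ ≡ y * g ℓ → x * ∏ f ≡ y * ∏ g
  ∏-modify f g zero x y off at = begin
    x * (f zero * ∏ (f ∘ suc))   ≡⟨ *-assoc x _ _ ⟨
    x * f zero * ∏ (f ∘ suc)     ≡⟨ cong₂ _*_ at (∏-cong λ i → off (suc i) λ ()) ⟩
    y * g zero * ∏ (g ∘ suc)     ≡⟨ *-assoc y _ _ ⟩
    y * (g zero * ∏ (g ∘ suc))   ∎
    where open ≡-Reasoning
  ∏-modify f g (suc ℓ) x y off at = begin
    x * (f zero * ∏ (f ∘ suc))   ≡⟨ regroup x (f zero) _ ⟩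
    f zero * (x * ∏ (f ∘ suc))   ≡⟨ cong₂ _*_ (off zero λ ()) (∏-modify (f ∘ suc) (g ∘ suc) ℓ x y
                                      (λ i i≢ℓ → off (suc i) λ { refl → i≢ℓ refl }) at) ⟩
    g zero * (y * ∏ (g ∘ suc))   ≡⟨ regroup y (g zero) _ ⟨
    y * (g zero * ∏ (g ∘ suc))   ∎
    where
    open ≡-Reasoning
    regroup : ∀ a b c → a * (b * c) ≡ b * (a * c)
    regroup = solve-∀

  sum-updateAt-+ : ∀ {n} (t : Vec ℕ n) ℓ x → Vec.sum (updateAt t ℓ (x +_)) ≡ x + Vec.sum t
  sum-updateAt-+ (t₀ ∷ t) zero    x = +-assoc x t₀ (Vec.sum t)
  sum-updateAt-+ (t₀ ∷ t) (suc ℓ) x = trans (cong (t₀ +_) (sum-updateAt-+ t ℓ x)) (regroup t₀ x (Vec.sum t))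
    where
    regroup : ∀ a b c → a + (b + c) ≡ b + (a + c)
    regroup = solve-∀

  -- Absorption applied twice. It is used in both directions: with n = J_ℓ, k = t_ℓ to absorb the
  -- moment into the weight, and with the input and sample size to recover `total`.
  [1+k][2+k]*[2+n]C[2+k]≡[1+n][2+n]*nCk : ∀ n k →
    suc k * suc (suc k) * (suc (suc n) C suc (suc k)) ≡ suc n * suc (suc n) * (n C k)
  [1+k][2+k]*[2+n]C[2+k]≡[1+n][2+n]*nCk n k = begin
    suc k * suc (suc k) * (suc (suc n) C suc (suc k))
      ≡⟨ *-assoc (suc k) (suc (suc k)) (suc (suc n) C suc (suc k)) ⟩
    suc k * (suc (suc k) * (suc (suc n) C suc (suc k)))
      ≡⟨ cong (suc k *_) ([1+k]*[1+n]C[1+k]≡[1+n]*nCk (suc n) (suc k)) ⟩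
    suc k * (suc (suc n) * (suc n C suc k))
      ≡⟨ regroup (suc k) (suc (suc n)) (suc n C suc k) ⟩
    suc (suc n) * (suc k * (suc n C suc k))
      ≡⟨ cong (suc (suc n) *_) ([1+k]*[1+n]C[1+k]≡[1+n]*nCk n k) ⟩
    suc (suc n) * (suc n * (n C k))
      ≡⟨ regroup′ (suc n) (suc (suc n)) (n C k) ⟩
    suc n * suc (suc n) * (n C k) ∎
    where
    open ≡-Reasoning
    regroup : ∀ a b c → a * (b * c) ≡ b * (a * c)
    regroup = solve-∀
    regroup′ : ∀ a b c → b * (a * c) ≡ a * b * c
    regroup′ = solve-∀

  pronic : ℕ → ℕ
  pronic x = suc x * suc (suc x)

  -- y ↦ y(y+1) is superadditive: the value at y + z exceeds the sum of the values by 2yz.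
  ∑pronic≤ : ∀ {s} (t : Vec ℕ s) → let σ = Vec.sum (Vec.map suc t) in
    sum (λ ℓ → pronic (lookup t ℓ)) ≤ σ * suc σ
  ∑pronic≤ []      = z≤n
  ∑pronic≤ (x ∷ t) = begin
    pronic x + sum (λ ℓ → pronic (lookup t ℓ))    ≤⟨ +-monoʳ-≤ (pronic x) (∑pronic≤ t) ⟩
    pronic x + σ * suc σ                          ≤⟨ m≤m+n _ (2 * (suc x * σ)) ⟩
    pronic x + σ * suc σ + 2 * (suc x * σ)        ≡⟨ expand x σ ⟩
    (suc x + σ) * suc (suc x + σ)                 ∎
    where
    open ≤-Reasoning
    σ = Vec.sum (Vec.map suc t)
    expand : ∀ x y → suc x * suc (suc x) + y * suc y + 2 * (suc x * y) ≡ (suc x + y) * suc (suc x + y)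
    expand = solve-∀

  -- The cross terms 2(t₁+1)(t₂+1) of the square make this strict.
  ∑pronic< : ∀ {s} (t : Vec ℕ (suc (suc s))) → let σ = Vec.sum (Vec.map suc t) in
    sum (λ ℓ → pronic (lookup t ℓ)) < σ * suc σ
  ∑pronic< (x ∷ y ∷ t) = begin
    suc (pronic x + sum (λ ℓ → pronic (lookup (y ∷ t) ℓ))) ≤⟨ s≤s (+-monoʳ-≤ (pronic x) (∑pronic≤ (y ∷ t))) ⟩
    suc (pronic x + suc τ * suc (suc τ))           ≤⟨ m≤m+n _ (1 + 2 * (x + τ + x * τ)) ⟩
    suc (pronic x + suc τ * suc (suc τ)) + (1 + 2 * (x + τ + x * τ)) ≡⟨ expand x τ ⟩
    (suc x + suc τ) * suc (suc x + suc τ)          ∎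
    where
    open ≤-Reasoning
    τ = y + Vec.sum (Vec.map suc t)
    expand : ∀ x y → suc (suc x * suc (suc x) + suc y * suc (suc y)) + (1 + 2 * (x + y + x * y))
               ≡ (suc x + suc y) * suc (suc x + suc y)
    expand = solve-∀

  sum-map-suc : ∀ {s} (t : Vec ℕ s) → Vec.sum (Vec.map suc t) ≡ Vec.sum t + s
  sum-map-suc []            = refl
  sum-map-suc (x ∷ t) = trans (cong (suc x +_) (sum-map-suc t)) (regroup x (Vec.sum t) _)
    where
    regroup : ∀ a b c → suc a + (b + c) ≡ a + b + suc c
    regroup = solve-∀

  sum-lookup : ∀ {s} (v : Vec ℕ s) → sum (lookup v) ≡ Vec.sum v
  sum-lookup []      = refl
  sum-lookup (x ∷ v) = cong (x +_) (sum-lookup v)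

  -- The law of the subproblem sizes J = t + I: it gives t + v the probability
  -- weight v / total.
  module SubproblemSizes {s : ℕ} (t : Vec ℕ (suc s)) (N : ℕ) where

    -- Sums free of truncated subtraction; `sampleSize≡` and `n≡` match them with the sample size
    -- and the input size.
    k = Vec.sum t + s
    n = N + Vec.sum t + s

    size : Vec ℕ (suc s) → Fin (suc s) → ℕ
    size v ℓ = lookup t ℓ + lookup v ℓ

    weight : Vec ℕ (suc s) → ℕ
    weight = binomials t t

    total : ℕ
    total = n C k

    ∑weight : sumComp (suc s) N weight ≡ total
    ∑weight = sumComp-binomials s N t t λ _ → ≤-refl

    -- Unnormalised: `total` times the expectation of the sum of f over all segments.
    expect : (Vec ℕ (suc s) → Fin (suc s) → ℕ) → ℕ
    expect f = sum λ ℓ → sumComp (suc s) N λ v → weight v * f v ℓ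

    firstMoment secondMoment : ℕ
    firstMoment  = expect size
    secondMoment = expect λ v ℓ → size v ℓ * size v ℓ

    C₂ = pronic k
    T₂ = sum λ ℓ → pronic (lookup t ℓ)

    ∑size≤n : ∀ v → Vec.sum v ≡ N → sum (size v) ≤ n
    ∑size≤n v Σv≡N = begin
      sum (size v)                     ≡⟨ ∑-distrib-+ (lookup t) (lookup v) ⟩
      sum (lookup t) + sum (lookup v)  ≡⟨ cong₂ _+_ (sum-lookup t) (trans (sum-lookup v) Σv≡N) ⟩
      Vec.sum t + N                    ≡⟨ +-comm (Vec.sum t) N ⟩
      N + Vec.sum t                    ≤⟨ m≤m+n _ s ⟩
      n                                ∎
      where open ≤-Reasoning

    firstMoment≤ : firstMoment ≤ n * total
    firstMoment≤ = begin
      firstMoment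
        ≡⟨ sumComp-∑ (suc s) N (λ ℓ v → weight v * size v ℓ) ⟨
      sumComp (suc s) N (λ v → sum λ ℓ → weight v * size v ℓ)
        ≡⟨ sumComp-cong (suc s) N (λ v → *-distribˡ-sum (weight v) (size v)) ⟨
      sumComp (suc s) N (λ v → weight v * sum (size v))
        ≤⟨ sumComp-mono (suc s) N (λ v Σv → ≤-trans (*-monoʳ-≤ (weight v) (∑size≤n v Σv)) (≤-reflexive (*-comm (weight v) n))) ⟩
      sumComp (suc s) N (λ v → n * weight v)
        ≡⟨ sumComp-*ˡ (suc s) N n weight ⟩
      n * sumComp (suc s) N weight
        ≡⟨ cong (n *_) ∑weight ⟩
      n * total ∎
      where open ≤-Reasoning

    -- Absorbing (J_ℓ+1)(J_ℓ+2) raises t_ℓ by 2 and leaves the other factors alone, so the sum is a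
    -- total weight for the parameters n + 2 and k + 2. Absorption for that binomial leads back to
    -- `total`.
    ∑pronicWeights : ∀ ℓ → C₂ * sumComp (suc s) N (λ v → weight v * pronic (size v ℓ))
                       ≡ pronic (lookup t ℓ) * (pronic n * total)
    ∑pronicWeights ℓ = begin
      C₂ * sumComp (suc s) N (λ v → weight v * pronic (size v ℓ))
        ≡⟨ cong (C₂ *_) (sumComp-cong (suc s) N pointwise) ⟩
      C₂ * sumComp (suc s) N (λ v → pronic (lookup t ℓ) * binomials t″ t″ v)
        ≡⟨ cong (C₂ *_) (sumComp-*ˡ (suc s) N (pronic (lookup t ℓ)) (binomials t″ t″)) ⟩
      C₂ * (pronic (lookup t ℓ) * sumComp (suc s) N (binomials t″ t″))
        ≡⟨ cong (λ x → C₂ * (pronic (lookup t ℓ) * x)) (sumComp-binomials s N t″ t″ λ _ → ≤-refl) ⟩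
      C₂ * (pronic (lookup t ℓ) * ((N + Vec.sum t″ + s) C (Vec.sum t″ + s)))
        ≡⟨ cong (λ x → C₂ * (pronic (lookup t ℓ) * ((N + x + s) C (x + s)))) (sum-updateAt-+ t ℓ 2) ⟩
      C₂ * (pronic (lookup t ℓ) * ((N + (2 + Vec.sum t) + s) C suc (suc k)))
        ≡⟨ cong (λ x → C₂ * (pronic (lookup t ℓ) * (x C suc (suc k)))) (shift N (Vec.sum t) s) ⟩
      C₂ * (pronic (lookup t ℓ) * (suc (suc n) C suc (suc k)))
        ≡⟨ regroup C₂ (pronic (lookup t ℓ)) (suc (suc n) C suc (suc k)) ⟩
      pronic (lookup t ℓ) * (C₂ * (suc (suc n) C suc (suc k)))
        ≡⟨ cong (pronic (lookup t ℓ) *_) ([1+k][2+k]*[2+n]C[2+k]≡[1+n][2+n]*nCk n k) ⟩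
      pronic (lookup t ℓ) * (pronic n * total) ∎
      where
      open ≡-Reasoning
      t″ = updateAt t ℓ (2 +_)
      shift : ∀ a b c → a + (2 + b) + c ≡ suc (suc (a + b + c))
      shift = solve-∀
      regroup : ∀ a b c → a * (b * c) ≡ b * (a * c)
      regroup = solve-∀
      binomial : Vec ℕ (suc s) → Vec ℕ (suc s) → Fin (suc s) → ℕ
      binomial a v i = (lookup v i + lookup a i) C lookup a i
      pointwise : ∀ v → weight v * pronic (size v ℓ) ≡ pronic (lookup t ℓ) * binomials t″ t″ v
      pointwise v = trans (*-comm (weight v) (pronic (size v ℓ)))
        (∏-modify (binomial t v) (binomial t″ v) ℓ (pronic (size v ℓ)) (pronic (lookup t ℓ))
          (λ i i≢ℓ → cong (λ x → (lookup v i + x) C x) (sym (Vec.lookup∘updateAt′ i ℓ i≢ℓ t)))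
          (begin
            pronic (lookup t ℓ + lookup v ℓ) * ((lookup v ℓ + lookup t ℓ) C lookup t ℓ)
              ≡⟨ cong (λ x → pronic x * ((lookup v ℓ + lookup t ℓ) C lookup t ℓ)) (+-comm (lookup t ℓ) (lookup v ℓ)) ⟩
            pronic (lookup v ℓ + lookup t ℓ) * ((lookup v ℓ + lookup t ℓ) C lookup t ℓ)
              ≡⟨ [1+k][2+k]*[2+n]C[2+k]≡[1+n][2+n]*nCk (lookup v ℓ + lookup t ℓ) (lookup t ℓ) ⟨
            pronic (lookup t ℓ) * (suc (suc (lookup v ℓ + lookup t ℓ)) C (2 + lookup t ℓ))
              ≡⟨ cong (λ x → pronic (lookup t ℓ) * (x C (2 + lookup t ℓ))) (+-suc₂ (lookup v ℓ) (lookup t ℓ)) ⟩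
            pronic (lookup t ℓ) * ((lookup v ℓ + (2 + lookup t ℓ)) C (2 + lookup t ℓ))
              ≡⟨ cong (λ x → pronic (lookup t ℓ) * ((lookup v ℓ + x) C x)) (Vec.lookup∘updateAt ℓ t) ⟨
            pronic (lookup t ℓ) * binomial t″ v ℓ ∎))
        where
        +-suc₂ : ∀ a b → suc (suc (a + b)) ≡ a + suc (suc b)
        +-suc₂ = solve-∀

    pronicMoment : C₂ * expect (λ v ℓ → pronic (size v ℓ)) ≡ T₂ * (pronic n * total)
    pronicMoment = begin
      C₂ * expect (λ v ℓ → pronic (size v ℓ))
        ≡⟨ *-distribˡ-sum C₂ (λ ℓ → sumComp (suc s) N λ v → weight v * pronic (size v ℓ)) ⟩
      sum (λ ℓ → C₂ * sumComp (suc s) N λ v → weight v * pronic (size v ℓ))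
        ≡⟨ sum-cong-≗ ∑pronicWeights ⟩
      sum (λ ℓ → pronic (lookup t ℓ) * (pronic n * total))
        ≡⟨ *-distribʳ-sum (pronic n * total) (λ ℓ → pronic (lookup t ℓ)) ⟨
      T₂ * (pronic n * total) ∎
      where open ≡-Reasoning

    expect-mono : ∀ {f g} → (∀ v ℓ → f v ℓ ≤ g v ℓ) → expect f ≤ expect g
    expect-mono f≤g = sum-mono λ ℓ → sumComp-mono (suc s) N λ v _ → *-monoʳ-≤ (weight v) (f≤g v ℓ)

    expect-+ : ∀ f g → expect (λ v ℓ → f v ℓ + g v ℓ) ≡ expect f + expect g
    expect-+ f g = trans
      (sum-cong-≗ λ ℓ → trans
        (sumComp-cong (suc s) N λ v → *-distribˡ-+ (weight v) (f v ℓ) (g v ℓ))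
        (sumComp-+ (suc s) N (λ v → weight v * f v ℓ) (λ v → weight v * g v ℓ)))
      (∑-distrib-+ (λ ℓ → sumComp (suc s) N λ v → weight v * f v ℓ) (λ ℓ → sumComp (suc s) N λ v → weight v * g v ℓ))

    expect-const : ∀ c → expect (λ _ _ → c) ≡ suc s * (c * total)
    expect-const c = trans
      (sum-cong-≗ {suc s} λ ℓ → trans (sumComp-cong (suc s) N λ v → *-comm (weight v) c)
        (trans (sumComp-*ˡ (suc s) N c weight) (cong (c *_) ∑weight)))
      (sum-const (suc s) (c * total))
      where
      sum-const : ∀ m x → sum {m} (λ _ → x) ≡ m * x
      sum-const zero    x = refl
      sum-const (suc m) x = cong (x +_) (sum-const m x)

    -- Passing from (J+1)(J+2) = J² + 3J + 2 to J² costs three first moments, each at most n ·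
    -- total, and 2 for each of the s + 1 segments: 3 + 2(s + 1). The other bound needs only 5, from
    -- (n+1)(n+2) ≤ n² + 5n.
    slack : ℕ
    slack = 5 + 2 * s

    secondMoment≤ : T₂ ≤ C₂ → 1 ≤ n → C₂ * secondMoment ≤ T₂ * (n * n * total) + C₂ * (slack * (n * total))
    secondMoment≤ T₂≤C₂ 1≤n = begin
      C₂ * secondMoment
        ≤⟨ *-monoʳ-≤ C₂ (expect-mono λ v ℓ → *-mono-≤ (n≤1+n (size v ℓ)) (m≤n⇒m≤1+n (n≤1+n (size v ℓ)))) ⟩
      C₂ * expect (λ v ℓ → pronic (size v ℓ))
        ≡⟨ pronicMoment ⟩
      T₂ * (pronic n * total)
        ≡⟨ expand T₂ n total ⟩
      -- The redundant factor 1 is the place where `1≤n` puts n.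
      T₂ * (n * n * total) + T₂ * (3 * (n * total)) + T₂ * (2 * (1 * total))
        ≤⟨ +-mono-≤ (+-monoʳ-≤ (T₂ * (n * n * total)) (*-monoˡ-≤ (3 * (n * total)) T₂≤C₂))
             (*-mono-≤ T₂≤C₂ (*-monoʳ-≤ 2 (*-monoˡ-≤ total 1≤n))) ⟩
      T₂ * (n * n * total) + C₂ * (3 * (n * total)) + C₂ * (2 * (n * total))
        ≡⟨ collect (T₂ * (n * n * total)) C₂ (n * total) ⟩
      T₂ * (n * n * total) + C₂ * (5 * (n * total))
        ≤⟨ +-monoʳ-≤ (T₂ * (n * n * total)) (*-monoʳ-≤ C₂ (*-monoˡ-≤ (n * total) (m≤m+n 5 (2 * s)))) ⟩
      T₂ * (n * n * total) + C₂ * (slack * (n * total)) ∎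
      where
      open ≤-Reasoning
      expand : ∀ t n w → t * (suc n * suc (suc n) * w) ≡ t * (n * n * w) + t * (3 * (n * w)) + t * (2 * (1 * w))
      expand = solve-∀
      collect : ∀ x c y → x + c * (3 * y) + c * (2 * y) ≡ x + c * (5 * y)
      collect = solve-∀

    ≤secondMoment : 1 ≤ n → T₂ * (n * n * total) ≤ C₂ * secondMoment + C₂ * (slack * (n * total))
    ≤secondMoment 1≤n = begin
      T₂ * (n * n * total)
        ≤⟨ *-monoʳ-≤ T₂ (*-monoˡ-≤ total (*-mono-≤ (n≤1+n n) (m≤n⇒m≤1+n (n≤1+n n)))) ⟩
      T₂ * (pronic n * total)
        ≡⟨ pronicMoment ⟨
      C₂ * expect (λ v ℓ → pronic (size v ℓ))
        ≡⟨ cong (C₂ *_) pronicExpand ⟩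
      C₂ * (secondMoment + (firstMoment + (firstMoment + (firstMoment + suc s * (2 * (1 * total))))))
        ≤⟨ *-monoʳ-≤ C₂ (+-monoʳ-≤ secondMoment (+-mono-≤ firstMoment≤ (+-mono-≤ firstMoment≤ (+-mono-≤ firstMoment≤
             (*-monoʳ-≤ (suc s) (*-monoʳ-≤ 2 (*-monoˡ-≤ total 1≤n))))))) ⟩
      C₂ * (secondMoment + (n * total + (n * total + (n * total + suc s * (2 * (n * total))))))
        ≡⟨ collect C₂ secondMoment (n * total) s ⟩
      C₂ * secondMoment + C₂ * (slack * (n * total)) ∎
      where
      open ≤-Reasoning
      expand : ∀ j → suc j * suc (suc j) ≡ j * j + (j + (j + (j + 2)))
      expand = solve-∀
      collect : ∀ c v x s → c * (v + (x + (x + (x + suc s * (2 * x))))) ≡ c * v + c * ((5 + 2 * s) * x)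
      collect = solve-∀
      pronicExpand : expect (λ v ℓ → pronic (size v ℓ))
                       ≡ secondMoment + (firstMoment + (firstMoment + (firstMoment + suc s * (2 * (1 * total)))))
      pronicExpand = trans
        (sum-cong-≗ λ ℓ → sumComp-cong (suc s) N λ v → cong (weight v *_) (expand (size v ℓ)))
        (trans (expect-+ (λ v ℓ → size v ℓ * size v ℓ) (λ v ℓ → size v ℓ + (size v ℓ + (size v ℓ + 2))))
        (cong (secondMoment +_) (trans (expect-+ size (λ v ℓ → size v ℓ + (size v ℓ + 2)))
        (cong (firstMoment +_) (trans (expect-+ size (λ v ℓ → size v ℓ + 2))
        (cong (firstMoment +_) (trans (expect-+ size (λ _ _ → 2))
        (cong (firstMoment +_) (trans (expect-const 2) (cong (λ x → suc s * (2 * x)) (sym (*-identityˡ total))))))))))))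

-- Constructive ordered field arithmetic

module OrderedField (𝓡 : RealNumbers) where

  open import Algebra.Bundles using (CommutativeRing)
  open import Algebra.Apartness.Structures using (IsHeytingField)
  open import Algebra.Solver.Ring.AlmostCommutativeRing
    using (AlmostCommutativeRing; fromCommutativeRing; _-Raw-AlmostCommutative⟶_)
  import Algebra.Solver.Ring as RingSolver
  import Algebra.Properties.Ring as RingProperties
  import Algebra.Properties.AbelianGroup as AbelianGroupProperties
  open import Data.Integer.Base as ℤ using (ℤ; +_; -[1+_])
  import Data.Integer.Properties as ℤ
  open import Data.Maybe.Base using (Maybe; just; nothing)
  open import Relation.Binary.Definitions using (Trans)
  open import Relation.Binary.Structures using (IsStrictPartialOrder; IsPreorder)
  import Relation.Binary.Reasoning.Base.Triple as Triple

  open Analysis 𝓡 public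

  open CommutativeRing commutativeRing public using
    ( refl; sym; trans; reflexive; isEquivalence; setoid
    ; +-cong; +-congˡ; +-congʳ; +-assoc; +-comm; +-identityˡ; +-identityʳ
    ; *-cong; *-congˡ; *-congʳ; *-assoc; *-comm; *-identityˡ; *-identityʳ
    ; distribˡ; distribʳ; zeroˡ; zeroʳ; -‿cong; -‿inverseʳ
    ; semiring; commutativeSemiring; ring; +-abelianGroup; *-commutativeMonoid)
  open RingProperties ring using (-‿distribˡ-*; -‿distribʳ-*; -0#≈0#; -‿involutive)
  open AbelianGroupProperties +-abelianGroup using (⁻¹-∙-comm)
  open import Algebra.Properties.Semiring.Mult semiring using (×-homo-+; ×1-homo-*; ×-homo-1)

  ι-cong : ∀ {m n} → m ≡ n → ι m ≈ ι n
  ι-cong m≡n = reflexive (≡.cong ι m≡n)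

  ι-+ : ∀ m n → ι (m ℕ.+ n) ≈ ι m + ι n
  ι-+ = ×-homo-+ 1#

  ι-* : ∀ m n → ι (m ℕ.* n) ≈ ι m * ι n
  ι-* = ×1-homo-*

  ι-1 : ι 1 ≈ 1#
  ι-1 = ×-homo-1 1#

  private
    -- Equality of reals is not decidable, so the ring solver takes its coefficients from ℤ, where
    -- they can be compared.
    ιℤ : ℤ → ℝ
    ιℤ (+ n)      = ι n
    ιℤ (-[1+ n ]) = - ι (suc n)

    cancel-1 : ∀ a b → a + - b ≈ (1# + a) + - (1# + b)
    cancel-1 a b = sym (trans (+-congˡ (sym (⁻¹-∙-comm 1# b)))
      (trans (+-congʳ (+-comm 1# a)) (trans (+-assoc a 1# _)
        (+-congˡ (trans (sym (+-assoc 1# (- 1#) (- b))) (trans (+-congʳ (-‿inverseʳ 1#)) (+-identityˡ (- b))))))))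

    ιℤ-⊖ : ∀ m n → ιℤ (m ℤ.⊖ n) ≈ ι m + - ι n
    ιℤ-⊖ m       zero    = sym (trans (+-congˡ -0#≈0#) (+-identityʳ (ι m)))
    ιℤ-⊖ zero    (suc n) = sym (+-identityˡ _)
    ιℤ-⊖ (suc m) (suc n) = trans (reflexive (≡.cong ιℤ (ℤ.[1+m]⊖[1+n]≡m⊖n m n)))
      (trans (ιℤ-⊖ m n) (cancel-1 (ι m) (ι n)))

    ιℤ-neg : ∀ i → ιℤ (ℤ.- i) ≈ - ιℤ i
    ιℤ-neg (+ zero)   = sym -0#≈0#
    ιℤ-neg (+ suc n)  = refl
    ιℤ-neg (-[1+ n ]) = sym (-‿involutive _)

    ιℤ-+ : ∀ i j → ιℤ (i ℤ.+ j) ≈ ιℤ i + ιℤ j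
    ιℤ-+ (+ m)      (+ n)      = ι-+ m n
    ιℤ-+ (+ m)      (-[1+ n ]) = ιℤ-⊖ m (suc n)
    ιℤ-+ (-[1+ m ]) (+ n)      = trans (ιℤ-⊖ n (suc m)) (+-comm _ _)
    ιℤ-+ (-[1+ m ]) (-[1+ n ]) = trans
      (-‿cong (trans (ι-cong (≡.cong suc (≡.sym (ℕ.+-suc m n)))) (ι-+ (suc m) (suc n)))) (sym (⁻¹-∙-comm _ _))

    ιℤ-*⁺ : ∀ m j → ιℤ (+ m ℤ.* j) ≈ ι m * ιℤ j
    ιℤ-*⁺ m (+ n)      = trans (reflexive (≡.cong ιℤ (≡.sym (ℤ.pos-* m n)))) (ι-* m n)
    ιℤ-*⁺ m (-[1+ n ]) = trans (reflexive (≡.cong ιℤ (≡.trans (≡.sym (ℤ.neg-distribʳ-* (+ m) (+ suc n)))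
                            (≡.cong ℤ.-_ (≡.sym (ℤ.pos-* m (suc n)))))))
      (trans (ιℤ-neg (+ (m ℕ.* suc n))) (trans (-‿cong (ι-* m (suc n))) (-‿distribʳ-* _ _)))

    ιℤ-* : ∀ i j → ιℤ (i ℤ.* j) ≈ ιℤ i * ιℤ j
    ιℤ-* (+ m)      j = ιℤ-*⁺ m j
    ιℤ-* (-[1+ m ]) j = trans (reflexive (≡.cong ιℤ (≡.sym (ℤ.neg-distribˡ-* (+ suc m) j))))
      (trans (ιℤ-neg (+ suc m ℤ.* j)) (trans (-‿cong (ιℤ-*⁺ (suc m) j)) (-‿distribˡ-* _ _)))

    almostCommutativeRing : AlmostCommutativeRing _ _
    almostCommutativeRing = fromCommutativeRing commutativeRing

    ℤ⟶ℝ : ℤ.+-*-rawRing -Raw-AlmostCommutative⟶ almostCommutativeRing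
    ℤ⟶ℝ = record
      { ⟦_⟧ = ιℤ ; +-homo = ιℤ-+ ; *-homo = ιℤ-* ; -‿homo = ιℤ-neg ; 0-homo = refl ; 1-homo = ι-1 }

    _coeff≟_ : ∀ i j → Maybe (ιℤ i ≈ ιℤ j)
    i coeff≟ j with i ℤ.≟ j
    ... | yes i≡j = just (reflexive (≡.cong ιℤ i≡j))
    ... | no  _   = nothing

  open RingSolver ℤ.+-*-rawRing almostCommutativeRing ℤ⟶ℝ _coeff≟_ public
    using (solve; _:=_; _:+_; _:*_; _:-_; :-_; con)

  private
    module Field = IsHeytingField isHeytingField
    module Order = IsStrictPartialOrder isStrictPartialOrder

  open Order public using () renaming (irrefl to <-irrefl; trans to <-trans; asym to <-asym)

  <-respʳ : ∀ {x y z} → y ≈ z → x < y → x < z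
  <-respʳ = proj₁ Order.<-resp-≈

  <-respˡ : ∀ {x y z} → y ≈ z → y < x → z < x
  <-respˡ = proj₂ Order.<-resp-≈

  -- The substitute for trichotomy. Cotransitivity of apartness may give a comparison in the wrong
  -- direction, which `x<y` then turns into one of the two wanted.
  <-cotrans : ∀ {x y} → x < y → ∀ z → x < z ⊎ z < y
  <-cotrans {x} {y} x<y z with Field.#-cotrans (inj₁ x<y) z
  ... | inj₁ (inj₁ x<z) = inj₁ x<z
  ... | inj₁ (inj₂ z<x) = inj₂ (<-trans z<x x<y)
  ... | inj₂ (inj₁ z<y) = inj₂ z<y
  ... | inj₂ (inj₂ y<z) = inj₁ (<-trans x<y y<z)

  <⇒≤ : ∀ {x y} → x < y → x ≤ y
  <⇒≤ x<y y<x = <-asym x<y y<x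

  ≤-reflexive : ∀ {x y} → x ≈ y → x ≤ y
  ≤-reflexive x≈y y<x = <-irrefl (sym x≈y) y<x

  ≤-refl : ∀ {x} → x ≤ x
  ≤-refl = ≤-reflexive refl

  ≤-trans : ∀ {x y z} → x ≤ y → y ≤ z → x ≤ z
  ≤-trans {y = y} x≤y y≤z z<x = [ y≤z , x≤y ]′ (<-cotrans z<x y)

  <-≤-trans : Trans _<_ _≤_ _<_
  <-≤-trans {k = z} x<y y≤z with <-cotrans x<y z
  ... | inj₁ x<z = x<z
  ... | inj₂ z<y = contradiction z<y y≤z

  ≤-<-trans : Trans _≤_ _<_ _<_
  ≤-<-trans {i = x} x≤y y<z with <-cotrans y<z x
  ... | inj₁ y<x = contradiction y<x x≤y
  ... | inj₂ x<z = x<z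

  private
    ≤-isPreorder : IsPreorder _≈_ _≤_
    ≤-isPreorder = record { isEquivalence = isEquivalence ; reflexive = ≤-reflexive ; trans = ≤-trans }

  module ≤-Reasoning =
    Triple ≤-isPreorder <-asym <-trans Order.<-resp-≈ <⇒≤ <-≤-trans ≤-<-trans

  +-monoʳ-< : ∀ {x y} z → x < y → z + x < z + y
  +-monoʳ-< z x<y = <-respˡ (+-comm _ _) (<-respʳ (+-comm _ _) (+-monoˡ-< z x<y))

  +-mono-< : ∀ {w x y z} → w < x → y < z → w + y < x + z
  +-mono-< w<x y<z = <-trans (+-monoˡ-< _ w<x) (+-monoʳ-< _ y<z)

  +-cancelʳ-< : ∀ {x y} z → x + z < y + z → x < y
  +-cancelʳ-< {x} {y} z lt = <-respˡ (cancel x) (<-respʳ (cancel y) (+-monoˡ-< (- z) lt))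
    where
    cancel : ∀ u → (u + z) + - z ≈ u
    cancel u = solve 2 (λ u z → u :+ z :+ (:- z) := u) refl u z

  +-cancelˡ-< : ∀ {x y} z → z + x < z + y → x < y
  +-cancelˡ-< z lt = +-cancelʳ-< z (<-respˡ (+-comm _ _) (<-respʳ (+-comm _ _) lt))

  +-monoˡ-≤ : ∀ {x y} z → x ≤ y → x + z ≤ y + z
  +-monoˡ-≤ z x≤y lt = x≤y (+-cancelʳ-< z lt)

  +-monoʳ-≤ : ∀ {x y} z → x ≤ y → z + x ≤ z + y
  +-monoʳ-≤ z x≤y lt = x≤y (+-cancelˡ-< z lt)

  +-mono-≤ : ∀ {w x y z} → w ≤ x → y ≤ z → w + y ≤ x + z
  +-mono-≤ w≤x y≤z = ≤-trans (+-monoˡ-≤ _ w≤x) (+-monoʳ-≤ _ y≤z)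

  +-cancelʳ-≤ : ∀ {x y} z → x + z ≤ y + z → x ≤ y
  +-cancelʳ-≤ z le y<x = le (+-monoˡ-< z y<x)

  x<y⇒0<y-x : ∀ {x y} → x < y → 0# < y - x
  x<y⇒0<y-x {x} x<y = <-respˡ (-‿inverseʳ x) (+-monoˡ-< (- x) x<y)

  0<y-x⇒x<y : ∀ {x y} → 0# < y - x → x < y
  0<y-x⇒x<y {x} {y} 0<y-x = <-respˡ (+-identityˡ x)
    (<-respʳ (solve 2 (λ y x → y :- x :+ x := y) refl y x) (+-monoˡ-< x 0<y-x))

  *-monoˡ-< : ∀ {x y z} → 0# < z → x < y → z * x < z * y
  *-monoˡ-< {x} {y} {z} 0<z x<y = 0<y-x⇒x<y
    (<-respʳ (solve 3 (λ x y z → z :* (y :- x) := z :* y :- z :* x) refl x y z) (*-pos 0<z (x<y⇒0<y-x x<y)))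

  inverseʳ : ∀ x x#0 → x * inverse x x#0 ≈ 1#
  inverseʳ x x#0 = trans (*-congʳ (sym (trans (+-congˡ -0#≈0#) (+-identityʳ x))))
    (proj₂ (proj₂ (Field.#⇒invertible x#0)))

  -- The inverse is itself invertible, hence apart from 0, and apartness supplies a sign. A negative
  -- sign would give 1 < 0.
  inverse-pos : ∀ {x} (0<x : 0# < x) → 0# < inverse x (0<⇒#0 0<x)
  inverse-pos {x} 0<x with Field.invertible⇒# (x , right , left)
    where
    y = inverse x (0<⇒#0 0<x)
    y-0≈y : y - 0# ≈ y
    y-0≈y = trans (+-congˡ -0#≈0#) (+-identityʳ y)
    right : x * (y - 0#) ≈ 1#
    right = trans (*-congˡ y-0≈y) (inverseʳ x _)
    left : (y - 0#) * x ≈ 1#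
    left = trans (*-comm _ _) right
  ... | inj₂ 0<y = 0<y
  ... | inj₁ y<0 = contradiction 1<0 (<-asym 0<1)
    where
    1<0 : 1# < 0#
    1<0 = <-respˡ (inverseʳ x _) (<-respʳ (zeroʳ x) (*-monoˡ-< 0<x y<0))

  *-cancelˡ-< : ∀ {x y z} → 0# < z → z * x < z * y → x < y
  *-cancelˡ-< {x} {y} {z} 0<z lt = <-respˡ (cancel x) (<-respʳ (cancel y) (*-monoˡ-< (inverse-pos 0<z) lt))
    where
    z⁻¹ = inverse z (0<⇒#0 0<z)
    cancel : ∀ u → z⁻¹ * (z * u) ≈ u
    cancel u = trans (sym (*-assoc _ _ _)) (trans (*-congʳ (trans (*-comm _ _) (inverseʳ z _))) (*-identityˡ u))

  *-monoˡ-≤ : ∀ {x y z} → 0# < z → x ≤ y → z * x ≤ z * y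
  *-monoˡ-≤ 0<z x≤y lt = x≤y (*-cancelˡ-< 0<z lt)

  *-cancelˡ-≤ : ∀ {x y z} → 0# < z → z * x ≤ z * y → x ≤ y
  *-cancelˡ-≤ 0<z le y<x = le (*-monoˡ-< 0<z y<x)

  -- The factor may vanish, as it does for the weight of an empty segment; for a natural number the
  -- two cases can be told apart.
  ι-*-monoˡ-≤ : ∀ n {x y} → x ≤ y → ι n * x ≤ ι n * y
  ι-*-monoˡ-≤ zero    x≤y = ≤-reflexive (trans (zeroˡ _) (sym (zeroˡ _)))
  ι-*-monoˡ-≤ (suc n) x≤y = *-monoˡ-≤ (ι-pos (suc n)) x≤y

  0≤ι : ∀ n → 0# ≤ ι n
  0≤ι zero    = ≤-refl
  0≤ι (suc n) = <⇒≤ (ι-pos (suc n))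

  ι-mono-≤ : ∀ {m n} → m ℕ.≤ n → ι m ≤ ι n
  ι-mono-≤ {n = n} ℕ.z≤n     = 0≤ι n
  ι-mono-≤         (ℕ.s≤s m≤n) = +-monoʳ-≤ 1# (ι-mono-≤ m≤n)

  ι-mono-< : ∀ {m n} → m ℕ.< n → ι m < ι n
  ι-mono-< {zero}  {suc n} _           = ι-pos (suc n)
  ι-mono-< {suc m}         (ℕ.s≤s m<n) = +-monoʳ-< 1# (ι-mono-< m<n)

  half : ∀ {x} → 0# < x → ∃ λ y → 0# < y × y + y ≈ x
  half {x} 0<x = x * inverse (ι 2) 2#0 , *-pos 0<x (inverse-pos (ι-pos 2)) ,
    trans (solve 2 (λ x i → x :* i :+ x :* i := x :* (con (+ 2) :* i)) refl x (inverse (ι 2) 2#0))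
          (trans (*-congˡ (inverseʳ (ι 2) 2#0)) (*-identityʳ x))
    where 2#0 = 0<⇒#0 (ι-pos 2)

  archimedean* : ∀ {ε} → 0# < ε → ∀ x → ∃ λ N → ∀ n → N ℕ.≤ n → x < ε * ι n
  archimedean* {ε} 0<ε x with archimedean (x * inverse ε (0<⇒#0 0<ε))
  ... | N , lt = N , λ n N≤n → begin-strict
    x                   ≈⟨ *-identityʳ x ⟨
    x * 1#              ≈⟨ *-congˡ (inverseʳ ε _) ⟨
    x * (ε * ε⁻¹)       ≈⟨ solve 3 (λ x e i → x :* (e :* i) := e :* (x :* i)) refl x ε ε⁻¹ ⟩
    ε * (x * ε⁻¹)       <⟨ *-monoˡ-< 0<ε lt ⟩
    ε * ι N             ≤⟨ *-monoˡ-≤ 0<ε (ι-mono-≤ N≤n) ⟩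
    ε * ι n             ∎
    where
    open ≤-Reasoning
    ε⁻¹ = inverse ε (0<⇒#0 0<ε)

-- Continuity of the densities and integrals of monomials

module DirichletIntegral (𝓡 : RealNumbers) where

  open Compositions using (sumComp; powers; factorials; sumComp-powers; ∏)
  open OrderedField 𝓡
  open import Data.Integer.Base using (+_)
  open import Algebra.Properties.CommutativeSemiring.Exp commutativeSemiring using (^-homo-*; ^-congˡ; ^-distrib-*)
  import Algebra.Properties.Semiring.Sum semiring as ∑
  import Algebra.Properties.CommutativeMonoid.Sum *-commutativeMonoid as Π
  import Relation.Binary.Reasoning.Setoid setoid as ≈-Reasoning

  InBox : ∀ {d} → ℝ → Vector ℝ d → Set
  InBox B x = ∀ i → (- B < x i) × (x i < B)

  -- The bound is strictly positive so that `tame-*` can divide by it.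
  BoundedOnBoxes : ∀ {d} → (Vector ℝ d → ℝ) → Set
  BoundedOnBoxes φ = ∀ B → ∃ λ K → 0# < K × (∀ x → InBox B x → (- K < φ x) × (φ x < K))

  -- Products preserve uniform continuity only together with boundedness.
  Tame : ∀ {d} → (Vector ℝ d → ℝ) → Set
  Tame φ = Continuous φ × BoundedOnBoxes φ

  x<ι[1+n] : ∀ {x} n → x < ι n → x < ι (suc n)
  x<ι[1+n] n lt = <-trans lt (ι-mono-< (ℕ.n<1+n n))

  -x<y⇒-y<x : ∀ {x y} → - x < y → - y < x
  -x<y⇒-y<x {x} {y} lt = 0<y-x⇒x<y (<-respʳ (solve 2 (λ x y → y :- (:- x) := x :- (:- y)) refl x y) (x<y⇒0<y-x lt))

  -- No signs are distinguished: 2(KL + uv) = (K-u)(L-v) + (K+u)(L+v) and 2(KL - uv) = (K-u)(L+v) +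
  -- (K+u)(L-v), and all factors on the right are positive.
  *-bound : ∀ {u v K L} → (- K < u) × (u < K) → (- L < v) × (v < L) → (- (K * L) < u * v) × (u * v < K * L)
  *-bound {u} {v} {K} {L} (-K<u , u<K) (-L<v , v<L) =
    0<y-x⇒x<y (*-cancelˡ-< (ι-pos 2) (<-respˡ (sym (zeroʳ _)) (<-respʳ
      (solve 4 (λ u v K L → (K :- u) :* (L :- v) :+ (u :- (:- K)) :* (v :- (:- L)) := con (+ 2) :* (u :* v :- (:- (K :* L)))) refl u v K L)
      (pos+pos (*-pos (x<y⇒0<y-x u<K) (x<y⇒0<y-x v<L)) (*-pos (x<y⇒0<y-x -K<u) (x<y⇒0<y-x -L<v)))))) ,
    0<y-x⇒x<y (*-cancelˡ-< (ι-pos 2) (<-respˡ (sym (zeroʳ _)) (<-respʳ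
      (solve 4 (λ u v K L → (K :- u) :* (v :- (:- L)) :+ (u :- (:- K)) :* (L :- v) := con (+ 2) :* (K :* L :- u :* v)) refl u v K L)
      (pos+pos (*-pos (x<y⇒0<y-x u<K) (x<y⇒0<y-x -L<v)) (*-pos (x<y⇒0<y-x -K<u) (x<y⇒0<y-x v<L))))))
    where
    pos+pos : ∀ {x y} → 0# < x → 0# < y → 0# < x + y
    pos+pos 0<x 0<y = <-respˡ (+-identityʳ 0#) (+-mono-< 0<x 0<y)

  -- The witness xy / (x + y) takes the place of the minimum, so it need not be decided which of x
  -- and y is smaller.
  common-radius : ∀ {x y} → 0# < x → 0# < y → ∃ λ z → 0# < z × z < x × z < y
  common-radius {x} {y} 0<x 0<y = z , *-pos (*-pos 0<x 0<y) 0<i , z<x , z<y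
    where
    0<x+y : 0# < x + y
    0<x+y = <-respˡ (+-identityʳ 0#) (+-mono-< 0<x 0<y)
    i = inverse (x + y) (0<⇒#0 0<x+y)
    0<i = inverse-pos 0<x+y
    z = x * y * i
    [x+y]i≈1 = inverseʳ (x + y) (0<⇒#0 0<x+y)
    [x+y]z≈xy : (x + y) * z ≈ x * y
    [x+y]z≈xy = trans (solve 4 (λ x y s i → s :* (x :* y :* i) := x :* y :* (s :* i)) refl x y (x + y) i)
                      (trans (*-congˡ [x+y]i≈1) (*-identityʳ _))
    z<x : z < x
    z<x = *-cancelˡ-< 0<x+y (<-respˡ (sym [x+y]z≈xy) (<-respˡ (+-identityˡ _)
      (<-respʳ (solve 2 (λ x y → x :* x :+ x :* y := (x :+ y) :* x) refl x y) (+-monoˡ-< (x * y) (*-pos 0<x 0<x)))))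
    z<y : z < y
    z<y = *-cancelˡ-< 0<x+y (<-respˡ (sym [x+y]z≈xy) (<-respˡ (+-identityˡ _)
      (<-respʳ (solve 2 (λ x y → y :* y :+ x :* y := (x :+ y) :* y) refl x y) (+-monoˡ-< (x * y) (*-pos 0<y 0<y)))))

  within-refl : ∀ {ε x} → 0# < ε → Within ε x x
  within-refl {x = x} 0<ε = <-respˡ (sym (-‿inverseʳ x)) 0<ε , <-respˡ (sym (-‿inverseʳ x)) 0<ε

  tame-const : ∀ {d} c → Tame {d} λ _ → c
  tame-const c = (λ B ε 0<ε → 1# , 0<1 , λ _ _ _ _ _ → within-refl 0<ε) , λ B →
    let (m , c<m) = archimedean c; (n , -c<n) = archimedean (- c)
    in ι (suc (m ℕ.+ n)) , ι-pos (suc (m ℕ.+ n)) , λ _ _ →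
       0<y-x⇒x<y (<-respʳ (solve 2 (λ c k → k :- (:- c) := c :- (:- k)) refl c (ι (suc (m ℕ.+ n))))
         (x<y⇒0<y-x (<-≤-trans -c<n (ι-mono-≤ (ℕ.m≤n⇒m≤1+n (ℕ.m≤n+m n m)))))) ,
       <-≤-trans c<m (ι-mono-≤ (ℕ.m≤n⇒m≤1+n (ℕ.m≤m+n m n)))

  continuous-coordinate : ∀ {d} (i : Fin d) → Continuous λ x → x i
  continuous-coordinate i B ε 0<ε = ε , 0<ε , λ x y _ _ near → near i

  tame-coordinate : ∀ {d} (i : Fin d) → Tame λ x → x i
  tame-coordinate i = continuous-coordinate i , λ B →
    let (n , B<n) = archimedean B
        B<1+n = x<ι[1+n] n B<n
    in ι (suc n) , ι-pos (suc n) , λ x x∈B →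
       <-trans (0<y-x⇒x<y (<-respʳ (solve 2 (λ b n → n :- b := (:- b) :- (:- n)) refl B (ι (suc n))) (x<y⇒0<y-x B<1+n)))
         (proj₁ (x∈B i)) ,
       <-trans (proj₂ (x∈B i)) B<1+n

  -- ab - a′b′ = a(b - b′) + b′(a - a′). Each modulus is taken at ε/2 divided by the bound of the
  -- other factor, so that `*-bound` leaves ε/2 for each summand.
  tame-* : ∀ {d} {φ ψ : Vector ℝ d → ℝ} → Tame φ → Tame ψ → Tame λ x → φ x * ψ x
  tame-* {φ = φ} {ψ} (φ-cont , φ-bdd) (ψ-cont , ψ-bdd) = cont , bdd
    where
    bdd : BoundedOnBoxes λ x → φ x * ψ x
    bdd B with φ-bdd B | ψ-bdd B
    ... | K , 0<K , φ<K | L , 0<L , ψ<L = K * L , *-pos 0<K 0<L , λ x x∈B → *-bound (φ<K x x∈B) (ψ<L x x∈B)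

    difference : ∀ a b a′ b′ → a * (b - b′) + b′ * (a - a′) ≈ a * b - a′ * b′
    difference = solve 4 (λ a b a′ b′ → a :* (b :- b′) :+ b′ :* (a :- a′) := a :* b :- a′ :* b′) refl

    two-sided : ∀ {ε x y} → Within ε x y → (- ε < x - y) × (x - y < ε)
    two-sided {ε} {x} {y} (x-y<ε , y-x<ε) =
      0<y-x⇒x<y (<-respʳ (solve 3 (λ e x y → e :- (y :- x) := (x :- y) :- (:- e)) refl ε x y) (x<y⇒0<y-x y-x<ε)) , x-y<ε

    divide : ∀ K L e (K#0 : K # 0#) (L#0 : L # 0#) → K * (e * inverse K K#0) + L * (e * inverse L L#0) ≈ e + e
    divide K L e K#0 L#0 = trans
      (solve 5 (λ K L e i j → K :* (e :* i) :+ L :* (e :* j) := e :* (K :* i) :+ e :* (L :* j)) refl K L e _ _)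
      (+-cong (trans (*-congˡ (inverseʳ K K#0)) (*-identityʳ e)) (trans (*-congˡ (inverseʳ L L#0)) (*-identityʳ e)))

    cont : Continuous λ x → φ x * ψ x
    cont B ε 0<ε = let
        (K , 0<K , φ<K) = φ-bdd B
        (L , 0<L , ψ<L) = ψ-bdd B
        (e , 0<e , e+e≈ε) = half 0<ε
        (δ₁ , 0<δ₁ , φ-near) = φ-cont B (e * inverse L (0<⇒#0 0<L)) (*-pos 0<e (inverse-pos 0<L))
        (δ₂ , 0<δ₂ , ψ-near) = ψ-cont B (e * inverse K (0<⇒#0 0<K)) (*-pos 0<e (inverse-pos 0<K))
        (δ , 0<δ , δ<δ₁ , δ<δ₂) = common-radius 0<δ₁ 0<δ₂
      in δ , 0<δ , λ x y x∈B y∈B near →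
      let φ-close : ∀ i → Within δ₁ (x i) (y i)
          φ-close i = <-trans (proj₁ (near i)) δ<δ₁ , <-trans (proj₂ (near i)) δ<δ₁
          ψ-close : ∀ i → Within δ₂ (x i) (y i)
          ψ-close i = <-trans (proj₁ (near i)) δ<δ₂ , <-trans (proj₂ (near i)) δ<δ₂
          (lower₁ , upper₁) = *-bound (φ<K x x∈B) (two-sided (ψ-near x y x∈B y∈B ψ-close))
          (lower₂ , upper₂) = *-bound (ψ<L y y∈B) (two-sided (φ-near x y x∈B y∈B φ-close))
          sum≈ε = trans (divide K L e _ _) e+e≈ε
          upper = <-respˡ (difference (φ x) (ψ x) (φ y) (ψ y)) (<-respʳ sum≈ε (+-mono-< upper₁ upper₂))
          lower = <-respˡ (trans (solve 2 (λ a b → :- a :+ :- b := :- (a :+ b)) refl _ _) (-‿cong sum≈ε))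
                    (<-respʳ (difference (φ x) (ψ x) (φ y) (ψ y)) (+-mono-< lower₁ lower₂))
      in upper , <-respˡ (solve 2 (λ a b → :- (a :- b) := b :- a) refl _ _) (-x<y⇒-y<x lower)

  tame-^ : ∀ {d} {φ : Vector ℝ d → ℝ} → Tame φ → ∀ n → Tame λ x → φ x ^ n
  tame-^ tφ zero    = tame-const 1#
  tame-^ {φ = φ} tφ (suc n) = tame-* {φ = φ} {λ x → φ x ^ n} tφ (tame-^ {φ = φ} tφ n)

  tame-product : ∀ {d n} {φ : Fin n → Vector ℝ d → ℝ} → (∀ ℓ → Tame (φ ℓ)) → Tame λ x → product λ ℓ → φ ℓ x
  tame-product {n = zero}  tφ = tame-const 1#
  tame-product {n = suc n} {φ} tφ =
    tame-* {φ = φ zero} {λ x → product λ ℓ → φ (suc ℓ) x} (tφ zero) (tame-product {φ = φ ∘ suc} (tφ ∘ suc))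

  tame-multinomialPMF : ∀ {s} m (i : Vec ℕ s) → Tame λ x → multinomialPMF m x i
  tame-multinomialPMF {s} m i = tame-* {φ = λ _ → ι (m !)} {λ x → product λ ℓ → factor ℓ x} (tame-const (ι (m !)))
    (tame-product {φ = factor} λ ℓ → tame-* {φ = λ x → x ℓ ^ lookup i ℓ} {λ _ → 1/! ℓ}
      (tame-^ {φ = λ x → x ℓ} (tame-coordinate ℓ) (lookup i ℓ)) (tame-const (1/! ℓ)))
    where
    1/! : Fin s → ℝ
    1/! ℓ = inverse (ι (lookup i ℓ !)) (0<⇒#0 (ι-pos (lookup i ℓ !) {{ℕ._!≢0 (lookup i ℓ)}}))
    factor : Fin s → Vector ℝ s → ℝ
    factor ℓ x = x ℓ ^ lookup i ℓ * 1/! ℓ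

  ι-sum : ∀ {n} (f : Fin n → ℕ) → ι (Compositions.sum f) ≈ sum (ι ∘ f)
  ι-sum {zero}  f = refl
  ι-sum {suc n} f = trans (ι-+ (f zero) _) (+-congˡ (ι-sum (f ∘ suc)))

  ι-∏ : ∀ {n} (f : Fin n → ℕ) → ι (∏ f) ≈ product (ι ∘ f)
  ι-∏ {zero}  f = ι-1
  ι-∏ {suc n} f = trans (ι-* (f zero) _) (*-congˡ (ι-∏ (f ∘ suc)))

  ι-^ : ∀ m n → ι (m ℕ.^ n) ≈ ι m ^ n
  ι-^ m zero    = ι-1
  ι-^ m (suc n) = trans (ι-* m _) (*-congˡ (ι-^ m n))

  -- The bridge by which the exact counts over ℕ reach the Riemann sums and the expectations.
  ι-sumComp : ∀ s N f → ι (sumComp s N f) ≈ sumCompositions s N (ι ∘ f)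
  ι-sumComp zero    zero    f = refl
  ι-sumComp zero    (suc N) f = refl
  ι-sumComp (suc s) N       f = trans (ι-sum {suc N} λ i → sumComp s (N ℕ.∸ toℕ i) λ v → f (toℕ i ∷ v))
    (∑.sum-cong-≋ {suc N} λ i → ι-sumComp s (N ℕ.∸ toℕ i) λ v → f (toℕ i ∷ v))

  sumCompositions-cong : ∀ s N {f g} → (∀ v → Vec.sum v ≡ N → f v ≈ g v) → sumCompositions s N f ≈ sumCompositions s N g
  sumCompositions-cong zero    zero    f≈g = f≈g [] ≡.refl
  sumCompositions-cong zero    (suc N) f≈g = refl
  sumCompositions-cong (suc s) N       f≈g = ∑.sum-cong-≋ {suc N} λ i →
    sumCompositions-cong s (N ℕ.∸ toℕ i) λ v Σv → f≈g (toℕ i ∷ v)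
      (≡.trans (≡.cong (toℕ i ℕ.+_) Σv) (ℕ.m+[n∸m]≡n (Fin.toℕ≤pred[n] i)))

  sumCompositions-*ˡ : ∀ s N c f → sumCompositions s N (λ v → c * f v) ≈ c * sumCompositions s N f
  sumCompositions-*ˡ zero    zero    c f = refl
  sumCompositions-*ˡ zero    (suc N) c f = sym (zeroʳ c)
  sumCompositions-*ˡ (suc s) N       c f = trans
    (∑.sum-cong-≋ {suc N} λ i → sumCompositions-*ˡ s (N ℕ.∸ toℕ i) c λ v → f (toℕ i ∷ v))
    (sym (∑.*-distribˡ-sum {suc N} c λ i → sumCompositions s (N ℕ.∸ toℕ i) λ v → f (toℕ i ∷ v)))

  tendsto-1/n : ∀ {u c} x → (∀ n → let m = suc n in (ι m * u n ≤ ι m * c + x) × (ι m * c ≤ ι m * u n + x)) → Tendsto u c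
  tendsto-1/n {u} {c} x bounds ε 0<ε = N , λ n N≤n → close n N≤n (proj₁ (bounds n)) , close n N≤n (proj₂ (bounds n))
    where
    N = proj₁ (archimedean* 0<ε x)
    x< = proj₂ (archimedean* 0<ε x)
    close : ∀ n → N ℕ.≤ n → ∀ {a b} → ι (suc n) * a ≤ ι (suc n) * b + x → a - b < ε
    close n N≤n {a} {b} le = *-cancelˡ-< (ι-pos (suc n)) (begin-strict
      m * (a - b)                    ≈⟨ solve 3 (λ m a b → m :* (a :- b) := m :* a :+ (:- (m :* b))) refl m a b ⟩
      m * a + - (m * b)              ≤⟨ +-monoˡ-≤ _ le ⟩
      (m * b + x) + - (m * b)        ≈⟨ solve 2 (λ y x → y :+ x :+ (:- y) := x) refl (m * b) x ⟩
      x                              <⟨ x< (suc n) (ℕ.m≤n⇒m≤1+n N≤n) ⟩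
      ε * m                          ≈⟨ *-comm ε m ⟩
      m * ε                          ∎)
      where
      open ≤-Reasoning
      m = ι (suc n)

  product-^ : ∀ {s} x (b : Vec ℕ s) → product (λ ℓ → x ^ lookup b ℓ) ≈ x ^ Vec.sum b
  product-^ x []      = refl
  product-^ x (n ∷ b) = trans (*-congˡ (product-^ x b)) (sym (^-homo-* x n (Vec.sum b)))

  ^-inverse : ∀ x x#0 n → x ^ n * inverse x x#0 ^ n ≈ 1#
  ^-inverse x x#0 n = trans (sym (^-distrib-* x (inverse x x#0) n)) (trans (^-congˡ n (inverseʳ x x#0)) (1^ n))
    where
    1^ : ∀ n → 1# ^ n ≈ 1#
    1^ zero    = refl
    1^ (suc n) = trans (*-identityˡ _) (1^ n)

  -- A grid point v / m contributes m^(-∑b) by homogeneity and its cell has volume m^(-s), so m^p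
  -- times the Riemann sum is exactly κ times the integer sum that `sumComp-powers` bounds. The
  -- value κ ∏ b_ℓ! / p! is specified by an equation cleared of its denominator.
  monomialIntegral : ∀ {s} (b : Vec ℕ (suc s)) {κ c} (f : Vector ℝ (suc s) → ℝ) → 0# < κ →
    (∀ x → f x ≈ κ * product (λ ℓ → x ℓ ^ lookup b ℓ)) →
    ι ((Vec.sum b ℕ.+ s) !) * c ≈ κ * ι (factorials b) → SimplexIntegral f c
  -- The relative error K / m of `sumComp-powers`, times the limit c.
  monomialIntegral {s} b {κ} {c} f 0<κ f≈ p!c≈κB = tendsto-1/n (ι K * c) λ n → upper n , lower n
    where
    p = Vec.sum b ℕ.+ s
    K = proj₁ (sumComp-powers s b)
    B = factorials b
    S : ℕ → ℕ
    S m = sumComp (suc s) m (powers b)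

    riemann : ℕ → ℝ
    riemann n = _÷ℕ_ (sumCompositions (suc s) (suc n) λ i → f λ ℓ → ι (lookup i ℓ) ÷ℕ suc n)
                     (suc n ℕ.^ s) {{ℕ.m^n≢0 (suc n) s}}

    m^p*riemann : ∀ n → ι (suc n ℕ.^ p) * riemann n ≈ κ * ι (S (suc n))
    m^p*riemann n = begin
      ι (m ℕ.^ p) * (sumCompositions (suc s) m (λ i → f λ ℓ → ι (lookup i ℓ) * r) * q)
        ≈⟨ *-congˡ (*-congʳ (sumCompositions-cong (suc s) m λ i _ → monomial i)) ⟩
      ι (m ℕ.^ p) * (sumCompositions (suc s) m (λ i → κ * r ^ Vec.sum b * ι (powers b i)) * q)
        ≈⟨ *-congˡ (*-congʳ (sumCompositions-*ˡ (suc s) m (κ * r ^ Vec.sum b) (ι ∘ powers b))) ⟩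
      ι (m ℕ.^ p) * ((κ * r ^ Vec.sum b * sumCompositions (suc s) m (ι ∘ powers b)) * q)
        ≈⟨ *-cong (trans (ι-cong (ℕ.^-distribˡ-+-* m (Vec.sum b) s)) (ι-* (m ℕ.^ Vec.sum b) (m ℕ.^ s)))
             (*-congʳ (*-congˡ (sym (ι-sumComp (suc s) m (powers b))))) ⟩
      (ι (m ℕ.^ Vec.sum b) * ι (m ℕ.^ s)) * ((κ * r ^ Vec.sum b * ι (S m)) * q)
        ≈⟨ solve 6 (λ u v k r w q → (u :* v) :* ((k :* r :* w) :* q) := (u :* r) :* ((v :* q) :* (k :* w))) refl _ _ _ _ _ _ ⟩
      (ι (m ℕ.^ Vec.sum b) * r ^ Vec.sum b) * ((ι (m ℕ.^ s) * q) * (κ * ι (S m)))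
        ≈⟨ *-cong (trans (*-congʳ (ι-^ m (Vec.sum b))) (^-inverse (ι m) _ (Vec.sum b))) (*-congʳ (inverseʳ (ι (m ℕ.^ s)) _)) ⟩
      1# * (1# * (κ * ι (S m)))
        ≈⟨ trans (*-identityˡ _) (*-identityˡ _) ⟩
      κ * ι (S m) ∎
      where
      open ≈-Reasoning
      m = suc n
      r = inverse (ι m) (0<⇒#0 (ι-pos m))
      q = inverse (ι (m ℕ.^ s)) (0<⇒#0 (ι-pos (m ℕ.^ s) {{ℕ.m^n≢0 m s}}))
      monomial : ∀ i → f (λ ℓ → ι (lookup i ℓ) * r) ≈ κ * r ^ Vec.sum b * ι (powers b i)
      monomial i = begin
        f (λ ℓ → ι (lookup i ℓ) * r)
          ≈⟨ f≈ _ ⟩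
        κ * product (λ ℓ → (ι (lookup i ℓ) * r) ^ lookup b ℓ)
          ≈⟨ *-congˡ (Π.sum-cong-≋ λ ℓ → trans (^-distrib-* (ι (lookup i ℓ)) r (lookup b ℓ))
               (*-congʳ (sym (ι-^ (lookup i ℓ) (lookup b ℓ))))) ⟩
        κ * product (λ ℓ → ι (lookup i ℓ ℕ.^ lookup b ℓ) * r ^ lookup b ℓ)
          ≈⟨ *-congˡ (Π.∑-distrib-+ (λ ℓ → ι (lookup i ℓ ℕ.^ lookup b ℓ)) (λ ℓ → r ^ lookup b ℓ)) ⟩
        κ * (product (λ ℓ → ι (lookup i ℓ ℕ.^ lookup b ℓ)) * product (λ ℓ → r ^ lookup b ℓ))
          ≈⟨ *-congˡ (*-cong (sym (ι-∏ (λ ℓ → lookup i ℓ ℕ.^ lookup b ℓ))) (product-^ r b)) ⟩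
        κ * (ι (powers b i) * r ^ Vec.sum b)
          ≈⟨ solve 3 (λ k u v → k :* (u :* v) := k :* v :* u) refl _ _ _ ⟩
        κ * r ^ Vec.sum b * ι (powers b i) ∎

    0<p!m^p : ∀ n → 0# < ι (p !) * ι (suc n ℕ.^ p)
    0<p!m^p n = *-pos (ι-pos (p !) {{ℕ._!≢0 p}}) (ι-pos (suc n ℕ.^ p) {{ℕ.m^n≢0 (suc n) p}})

    scaled-sum : ∀ n → let m = suc n in
      ι (p !) * ι (m ℕ.^ p) * (ι m * riemann n) ≈ κ * ι (p ! ℕ.* S m ℕ.* m)
    scaled-sum n = begin
      ι (p !) * ι (m ℕ.^ p) * (ι m * riemann n)
        ≈⟨ solve 4 (λ f u m r → f :* u :* (m :* r) := f :* (u :* r) :* m) refl _ _ _ _ ⟩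
      ι (p !) * (ι (m ℕ.^ p) * riemann n) * ι m
        ≈⟨ *-congʳ (*-congˡ (m^p*riemann n)) ⟩
      ι (p !) * (κ * ι (S m)) * ι m
        ≈⟨ solve 4 (λ f k s m → f :* (k :* s) :* m := k :* (f :* s :* m)) refl _ _ _ _ ⟩
      κ * (ι (p !) * ι (S m) * ι m)
        ≈⟨ *-congˡ (trans (ι-* (p ! ℕ.* S m) m) (*-congʳ (ι-* (p !) (S m)))) ⟨
      κ * ι (p ! ℕ.* S m ℕ.* m) ∎
      where
      open ≈-Reasoning
      m = suc n

    scaled-limit : ∀ n x → let m = suc n in
      ι (p !) * ι (m ℕ.^ p) * (ι x * c) ≈ κ * ι (B ℕ.* (x ℕ.* m ℕ.^ p))
    scaled-limit n x = begin
      ι (p !) * ι (m ℕ.^ p) * (ι x * c)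
        ≈⟨ solve 4 (λ f u x c → f :* u :* (x :* c) := (f :* c) :* (x :* u)) refl _ _ _ _ ⟩
      (ι (p !) * c) * (ι x * ι (m ℕ.^ p))
        ≈⟨ *-cong p!c≈κB (sym (ι-* x (m ℕ.^ p))) ⟩
      (κ * ι B) * ι (x ℕ.* m ℕ.^ p)
        ≈⟨ trans (*-assoc κ (ι B) _) (*-congˡ (sym (ι-* B (x ℕ.* m ℕ.^ p)))) ⟩
      κ * ι (B ℕ.* (x ℕ.* m ℕ.^ p)) ∎
      where
      open ≈-Reasoning
      m = suc n

    upper : ∀ n → ι (suc n) * riemann n ≤ ι (suc n) * c + ι K * c
    upper n = *-cancelˡ-≤ (0<p!m^p n) (begin
      ι (p !) * ι (m ℕ.^ p) * (ι m * riemann n)           ≈⟨ scaled-sum n ⟩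
      κ * ι (p ! ℕ.* S m ℕ.* m)                           ≤⟨ *-monoˡ-≤ 0<κ (ι-mono-≤ (proj₁ (proj₂ (sumComp-powers s b) n))) ⟩
      κ * ι (B ℕ.* ((m ℕ.+ K) ℕ.* m ℕ.^ p))               ≈⟨ scaled-limit n (m ℕ.+ K) ⟨
      ι (p !) * ι (m ℕ.^ p) * (ι (m ℕ.+ K) * c)           ≈⟨ *-congˡ (trans (*-congʳ (ι-+ m K)) (distribʳ c (ι m) (ι K))) ⟩
      ι (p !) * ι (m ℕ.^ p) * (ι m * c + ι K * c)         ∎)
      where
      open ≤-Reasoning
      m = suc n

    lower : ∀ n → ι (suc n) * c ≤ ι (suc n) * riemann n + ι K * c
    lower n = *-cancelˡ-≤ (0<p!m^p n) (begin
      ι (p !) * ι (m ℕ.^ p) * (ι m * c)                   ≈⟨ scaled-limit n m ⟩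
      κ * ι (B ℕ.* (m ℕ.* m ℕ.^ p))                       ≤⟨ *-monoˡ-≤ 0<κ (ι-mono-≤ (proj₂ (proj₂ (sumComp-powers s b) n))) ⟩
      κ * ι (p ! ℕ.* S m ℕ.* m ℕ.+ B ℕ.* (K ℕ.* m ℕ.^ p)) ≈⟨ trans (*-congˡ (ι-+ (p ! ℕ.* S m ℕ.* m) _)) (distribˡ κ _ _) ⟩
      κ * ι (p ! ℕ.* S m ℕ.* m) + κ * ι (B ℕ.* (K ℕ.* m ℕ.^ p)) ≈⟨ +-cong (scaled-sum n) (scaled-limit n K) ⟨
      ι (p !) * ι (m ℕ.^ p) * (ι m * riemann n) + ι (p !) * ι (m ℕ.^ p) * (ι K * c) ≈⟨ distribˡ _ _ _ ⟨
      ι (p !) * ι (m ℕ.^ p) * (ι m * riemann n + ι K * c) ∎)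
      where
      open ≤-Reasoning
      m = suc n

-- Segments, indicators and finite expectations

module Recursion (𝓡 : RealNumbers) where

  open Compositions using (factorials; [m+n]Cn*m!n!≡[m+n]!; sum-map-suc; module SubproblemSizes)
  open OrderedField 𝓡
  open DirichletIntegral 𝓡
  import Algebra.Properties.Semiring.Sum semiring as ∑
  import Algebra.Properties.CommutativeMonoid.Sum *-commutativeMonoid as Π
  import Relation.Binary.Reasoning.Setoid setoid as ≈-Reasoning

  𝟏-yes : ∀ {P : Set} (P? : Dec P) → P → 𝟏 P? ≈ 1#
  𝟏-yes (yes _) _ = refl
  𝟏-yes (no ¬p) p = contradiction p ¬p

  𝟏-no : ∀ {P : Set} (P? : Dec P) → ¬ P → 𝟏 P? ≈ 0#
  𝟏-no (yes p) ¬p = contradiction p ¬p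
  𝟏-no (no _)  _  = refl

  𝟏-cong : ∀ {P Q : Set} (P? : Dec P) (Q? : Dec Q) → (P → Q) → (Q → P) → 𝟏 P? ≈ 𝟏 Q?
  𝟏-cong (yes p) Q? P⇒Q _   = sym (𝟏-yes Q? (P⇒Q p))
  𝟏-cong (no ¬p) Q? _   Q⇒P = sym (𝟏-no Q? (¬p ∘ Q⇒P))

  sum-0 : ∀ {n} {f : Fin n → ℝ} → (∀ i → f i ≈ 0#) → sum f ≈ 0#
  sum-0 {zero}  f≈0 = refl
  sum-0 {suc n} f≈0 = trans (+-cong (f≈0 zero) (sum-0 (f≈0 ∘ suc))) (+-identityʳ 0#)

  sum-𝟏 : ∀ {n} {P : Fin n → Set} (P? : ∀ i → Dec (P i)) (g : Fin n → ℝ) x → P x → (∀ i → P i → i ≡ x) →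
    sum (λ i → 𝟏 (P? i) * g i) ≈ g x
  sum-𝟏 P? g zero    Px unique = trans
    (+-cong (trans (*-congʳ (𝟏-yes (P? zero) Px)) (*-identityˡ _))
            (sum-0 λ i → trans (*-congʳ (𝟏-no (P? (suc i)) λ Pi → Fin.0≢1+n (≡.sym (unique (suc i) Pi)))) (zeroˡ _)))
    (+-identityʳ _)
  sum-𝟏 P? g (suc x) Px unique = trans
    (+-cong (trans (*-congʳ (𝟏-no (P? zero) λ P0 → Fin.0≢1+n (unique zero P0))) (zeroˡ _))
            (sum-𝟏 (P? ∘ suc) (g ∘ suc) x Px λ i Pi → Fin.suc-injective (unique (suc i) Pi)))
    (+-identityˡ _)

  sumCompositions-0 : ∀ s N {f} → (∀ v → f v ≈ 0#) → sumCompositions s N f ≈ 0#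
  sumCompositions-0 s N {f} f≈0 = trans
    (sumCompositions-cong s N λ v _ → trans (f≈0 v) (sym (zeroˡ 0#)))
    (trans (sumCompositions-*ˡ s N 0# (λ _ → 0#)) (zeroˡ _))

  sumCompositions-𝟏 : ∀ s N {P : Vec ℕ s → Set} (P? : ∀ v → Dec (P v)) (g : Vec ℕ s → ℝ) v → Vec.sum v ≡ N → P v →
    (∀ w → P w → w ≡ v) → sumCompositions s N (λ w → 𝟏 (P? w) * g w) ≈ g v
  sumCompositions-𝟏 zero    zero P? g []      Σv Pv unique = trans (*-congʳ (𝟏-yes (P? []) Pv)) (*-identityˡ _)
  sumCompositions-𝟏 (suc s) N    {P} P? g (x ∷ v) Σv Pv unique = trans
    (∑.sum-cong-≋ {suc N} slice)
    (sum-𝟏 {suc N} (λ i → toℕ i ℕ.≟ x) (λ _ → g (x ∷ v)) (fromℕ< x<1+N) (Fin.toℕ-fromℕ< x<1+N)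
      λ i i≡x → Fin.toℕ-injective (≡.trans i≡x (≡.sym (Fin.toℕ-fromℕ< x<1+N))))
    where
    x<1+N : x ℕ.< suc N
    x<1+N = ℕ.s≤s (ℕ.≤-trans (ℕ.m≤m+n x (Vec.sum v)) (ℕ.≤-reflexive Σv))
    slice : ∀ i → sumCompositions s (N ℕ.∸ toℕ i) (λ w → 𝟏 (P? (toℕ i ∷ w)) * g (toℕ i ∷ w))
                  ≈ 𝟏 (toℕ i ℕ.≟ x) * g (x ∷ v)
    slice i with toℕ i ℕ.≟ x
    ... | yes i≡x = trans
      (sumCompositions-𝟏 s (N ℕ.∸ toℕ i) (λ w → P? (toℕ i ∷ w)) (λ w → g (toℕ i ∷ w)) v
        (≡.trans (≡.sym (ℕ.m+n∸m≡n (toℕ i) (Vec.sum v)))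
          (≡.cong (ℕ._∸ toℕ i) (≡.trans (≡.cong (ℕ._+ Vec.sum v) i≡x) Σv)))
        (≡.subst (λ y → P (y ∷ v)) (≡.sym i≡x) Pv)
        (λ w Pw → Vec.∷-injectiveʳ (unique (toℕ i ∷ w) Pw)))
      (trans (reflexive (≡.cong (λ y → g (y ∷ v)) i≡x))
        (sym (trans (*-congʳ (𝟏-yes (toℕ i ℕ.≟ x) i≡x)) (*-identityˡ _))))
    ... | no i≢x = trans
      (sumCompositions-0 s (N ℕ.∸ toℕ i) λ w →
        trans (*-congʳ (𝟏-no (P? (toℕ i ∷ w)) λ Pw → i≢x (Vec.∷-injectiveˡ (unique _ Pw)))) (zeroˡ _))
      (sym (trans (*-congʳ (𝟏-no (toℕ i ℕ.≟ x) i≢x)) (zeroˡ _)))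

  sumCompositions-∑ : ∀ s N {m} (f : Fin m → Vec ℕ s → ℝ) →
    sumCompositions s N (λ v → sum λ ℓ → f ℓ v) ≈ sum λ ℓ → sumCompositions s N (f ℓ)
  sumCompositions-∑ zero    zero    f = refl
  sumCompositions-∑ zero    (suc N) {m} f = sym (∑.sum-replicate-zero m)
  sumCompositions-∑ (suc s) N       {m} f = trans
    (∑.sum-cong-≋ {suc N} λ i → sumCompositions-∑ s (N ℕ.∸ toℕ i) λ ℓ v → f ℓ (toℕ i ∷ v))
    (∑.∑-comm {suc N} {m} λ i ℓ → sumCompositions s (N ℕ.∸ toℕ i) λ v → f ℓ (toℕ i ∷ v))

  -- P is described by two implications instead of being fixed as an interval, so that the recursion
  -- can pass to `P? ∘ suc`, for which the interval is shifted.
  count-interval : ∀ n a j {P : Fin n → Set} (P? : ∀ r → Dec (P r)) →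
    (∀ r → P r → a ℕ.≤ toℕ r × toℕ r ℕ.< a ℕ.+ j) → (∀ r → a ℕ.≤ toℕ r → toℕ r ℕ.< a ℕ.+ j → P r) →
    a ℕ.+ j ℕ.≤ n → sum (λ r → 𝟏 (P? r)) ≈ ι j
  count-interval zero    zero    zero    P? sound complete le = refl
  count-interval (suc n) zero    zero    P? sound complete le =
    sum-0 λ r → 𝟏-no (P? r) λ Pr → contradiction (proj₂ (sound r Pr)) ℕ.n≮0
  count-interval (suc n) zero    (suc j) P? sound complete (ℕ.s≤s le) =
    +-cong (𝟏-yes (P? zero) (complete zero ℕ.z≤n ℕ.z<s))
           (count-interval n zero j (P? ∘ suc) (λ r Pr → ℕ.z≤n , ℕ.s<s⁻¹ (proj₂ (sound (suc r) Pr)))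
             (λ r _ r<j → complete (suc r) ℕ.z≤n (ℕ.s<s r<j)) le)
  count-interval (suc n) (suc a) j       P? sound complete (ℕ.s≤s le) = trans
    (+-cong (𝟏-no (P? zero) λ P0 → contradiction (proj₁ (sound zero P0)) ℕ.n≮0)
            (count-interval n a j (P? ∘ suc)
              (λ r Pr → ℕ.s≤s⁻¹ (proj₁ (sound (suc r) Pr)) , ℕ.s<s⁻¹ (proj₂ (sound (suc r) Pr)))
              (λ r a≤r r<a+j → complete (suc r) (ℕ.s≤s a≤r) (ℕ.s<s r<a+j)) le))
    (+-identityˡ (ι j))

  R-suc : ∀ {s} (J : Vec ℕ s) ℓ → R J (suc ℓ) ≡ suc (R J (inject₁ ℓ) ℕ.+ lookup J ℓ)
  R-suc (j ∷ J) zero    = ≡.cong suc (ℕ.+-identityʳ j)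
  R-suc (j ∷ J) (suc ℓ) = ≡.trans (≡.cong (suc j ℕ.+_) (R-suc J ℓ)) (regroup j (R J (inject₁ ℓ)) (lookup J ℓ))
    where
    regroup : ∀ a b c → suc a ℕ.+ suc (b ℕ.+ c) ≡ suc (suc a ℕ.+ b ℕ.+ c)
    regroup = solve-∀

  R≤ : ∀ {s} (J : Vec ℕ s) ℓ → R J ℓ ℕ.≤ Vec.sum J ℕ.+ s
  R≤ J       zero    = ℕ.z≤n
  R≤ {suc s} (j ∷ J) (suc ℓ) = ℕ.≤-trans (ℕ.+-monoʳ-≤ (suc j) (R≤ J ℓ)) (ℕ.≤-reflexive (regroup j (Vec.sum J) s))
    where
    regroup : ∀ a b c → suc a ℕ.+ (b ℕ.+ c) ≡ a ℕ.+ b ℕ.+ suc c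
    regroup = solve-∀

  -- Ranks are `suc (toℕ r)`, so lying strictly between two pivots means R_{ℓ-1} ≤ r < R_{ℓ-1} + J_ℓ
  -- for the zero-based r. The count is n times the conditional probability of recursing into
  -- segment ℓ.
  segment-size : ∀ {s} (J : Vec ℕ s) ℓ n → Vec.sum J ℕ.+ s ℕ.≤ suc n →
    sum {n} (λ r → 𝟏 (inSegment? J ℓ (suc (toℕ r)))) ≈ ι (lookup J ℓ)
  segment-size {s} J ℓ n le = count-interval n (R J (inject₁ ℓ)) (lookup J ℓ) (λ r → inSegment? J ℓ (suc (toℕ r)))
    (λ r (lo , hi) → ℕ.s≤s⁻¹ lo , ℕ.s<s⁻¹ (≡.subst (suc (toℕ r) ℕ.<_) (R-suc J ℓ) hi))
    (λ r lo hi → ℕ.s≤s lo , ≡.subst (suc (toℕ r) ℕ.<_) (≡.sym (R-suc J ℓ)) (ℕ.s<s hi))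
    (ℕ.s≤s⁻¹ (ℕ.≤-trans (ℕ.≤-reflexive (≡.sym (R-suc J ℓ))) (ℕ.≤-trans (R≤ J (suc ℓ)) le)))

  sum-zipWith-+ : ∀ {s} (t v : Vec ℕ s) → Vec.sum (Vec.zipWith ℕ._+_ t v) ≡ Vec.sum t ℕ.+ Vec.sum v
  sum-zipWith-+ []      []      = ≡.refl
  sum-zipWith-+ (x ∷ t) (y ∷ v) = ≡.trans (≡.cong (x ℕ.+ y ℕ.+_) (sum-zipWith-+ t v)) (regroup x y (Vec.sum t) (Vec.sum v))
    where
    regroup : ∀ a b c d → a ℕ.+ b ℕ.+ (c ℕ.+ d) ≡ a ℕ.+ c ℕ.+ (b ℕ.+ d)
    regroup = solve-∀

  zipWith-+-cancelˡ : ∀ {s} (t v w : Vec ℕ s) → Vec.zipWith ℕ._+_ t v ≡ Vec.zipWith ℕ._+_ t w → v ≡ w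
  zipWith-+-cancelˡ []      []      []      eq = ≡.refl
  zipWith-+-cancelˡ (x ∷ t) (y ∷ v) (z ∷ w) eq = ≡.cong₂ _∷_
    (ℕ.+-cancelˡ-≡ x y z (Vec.∷-injectiveˡ eq)) (zipWith-+-cancelˡ t v w (Vec.∷-injectiveʳ eq))

  lookup≤sum : ∀ {s} (v : Vec ℕ s) ℓ → lookup v ℓ ℕ.≤ Vec.sum v
  lookup≤sum (x ∷ v) zero    = ℕ.m≤m+n x (Vec.sum v)
  lookup≤sum (x ∷ v) (suc ℓ) = ℕ.m≤n⇒m≤o+n x (lookup≤sum v ℓ)

  product-select : ∀ {s} (ℓ : Fin s) (a : Fin s → ℝ) →
    product (λ i → if does (i Fin.≟ ℓ) then a i else 1#) ≈ a ℓ
  product-select {suc s} zero a = trans (*-congˡ (Π.sum-replicate-zero s)) (*-identityʳ (a zero))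
  product-select (suc ℓ) a = trans (*-identityˡ _) (product-select ℓ (a ∘ suc))

  product-pos : ∀ {n} {f : Fin n → ℝ} → (∀ i → 0# < f i) → 0# < product f
  product-pos {zero}  pos = 0<1
  product-pos {suc n} pos = *-pos (pos zero) (product-pos (pos ∘ suc))

  module Mean (P : ProbabilitySpace) where

    open ProbabilitySpace P

    mean-0 : (λ _ → 0#) HasMean 0#
    mean-0 = mean-cong (λ _ → zeroˡ 1#) (zeroˡ 1#) (mean-* 0# mean-1)

    mean-sum : ∀ {n} {X : Fin n → Ω → ℝ} {e} → (∀ i → X i HasMean e i) → (λ ω → sum λ i → X i ω) HasMean sum e
    mean-sum {zero}  hX = mean-0
    mean-sum {suc n} hX = mean-+ (hX zero) (mean-sum (hX ∘ suc))

    mean-sumCompositions : ∀ s N {X : Vec ℕ s → Ω → ℝ} {e} → (∀ v → Vec.sum v ≡ N → X v HasMean e v) →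
      (λ ω → sumCompositions s N λ v → X v ω) HasMean sumCompositions s N e
    mean-sumCompositions zero    zero    hX = hX [] ≡.refl
    mean-sumCompositions zero    (suc N) hX = mean-0
    mean-sumCompositions (suc s) N       hX = mean-sum {suc N} λ i → mean-sumCompositions s (N ℕ.∸ toℕ i) λ v Σv →
      hX (toℕ i ∷ v) (≡.trans (≡.cong (toℕ i ℕ.+_) Σv) (ℕ.m+[n∸m]≡n (Fin.toℕ≤pred[n] i)))

  open ProbabilitySpace using (_HasMean_)

  sampleSize≡ : ∀ {s} (t : Vec ℕ (suc s)) → sampleSize t ≡ Vec.sum t ℕ.+ s
  sampleSize≡ {s} t = ≡.cong (ℕ._∸ 1) (≡.trans (sum-map-suc t) (ℕ.+-suc (Vec.sum t) s))

  module Subproblems {s : ℕ} (t : Vec ℕ (suc (suc s))) {n : ℕ} (k≤n : sampleSize t ℕ.≤ n) where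

    N = n ℕ.∸ sampleSize t

    module Sizes = SubproblemSizes t N
    open Sizes using (size; weight; total)

    n≡ : Sizes.n ≡ n
    n≡ = ≡.trans (ℕ.+-assoc N (Vec.sum t) (suc s)) (≡.trans (≡.cong (N ℕ.+_) (≡.sym (sampleSize≡ t))) (ℕ.m∸n+n≡m k≤n))

    total*k!N! : total ℕ.* (N ! ℕ.* Sizes.k !) ≡ Sizes.n !
    total*k!N! = ≡.trans (≡.cong (λ x → (x C Sizes.k) ℕ.* (N ! ℕ.* Sizes.k !)) (ℕ.+-assoc N (Vec.sum t) (suc s)))
      (≡.trans ([m+n]Cn*m!n!≡[m+n]! N Sizes.k) (≡.cong _! (≡.sym (ℕ.+-assoc N (Vec.sum t) (suc s)))))

    total≢0 : NonZero total
    total≢0 = ℕ.m*n≢0⇒m≢0 total {{≡.subst NonZero (≡.sym total*k!N!) (ℕ._!≢0 Sizes.n)}}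

    -- Two or more segments require a pivot, so k ≥ 1 and n ≥ k ≥ 1.
    n≢0 : NonZero n
    n≢0 = ℕ.>-nonZero {n} (≡.subst (0 ℕ.<_) n≡ (ℕ.≤-trans (ℕ.s≤s ℕ.z≤n) (ℕ.m≤n+m (suc s) (N ℕ.+ Vec.sum t))))

    -- Strict because the pivots belong to no segment; this makes the recursion on n well founded.
    size<n : ∀ v ℓ → Vec.sum v ≡ N → size v ℓ ℕ.< n
    size<n v ℓ Σv≡N = ≡.subst (size v ℓ ℕ.<_) n≡ (ℕ.≤-trans
      (ℕ.s≤s (ℕ.+-mono-≤ (lookup≤sum t ℓ) (ℕ.≤-trans (lookup≤sum v ℓ) (ℕ.≤-reflexive Σv≡N))))
      (ℕ.≤-trans (ℕ.m≤m+n _ s) (ℕ.≤-reflexive (regroup (Vec.sum t) N s))))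
      where
      regroup : ∀ a b c → suc (a ℕ.+ b) ℕ.+ c ≡ b ℕ.+ a ℕ.+ suc c
      regroup = solve-∀

    -- n · total · 𝔼[∑ℓ 𝟏{Mₙ in segment ℓ} x(J_ℓ)]: conditionally on J, segment ℓ has probability J_ℓ / n.
    branching : (ℕ → ℝ) → ℝ
    branching x = sum λ ℓ → sumCompositions (suc (suc s)) N λ v → ι (weight v ℕ.* size v ℓ) * x (size v ℓ)

  -- The mean of one partitioning step

  module StepMean {s : ℕ} (t : Vec ℕ (suc (suc s))) {𝓕 : ProbabilitySpace} {F : ℕ → ProbabilitySpace.Ω 𝓕 → ℝ} {n : ℕ}
                  (k≤n : sampleSize t ℕ.≤ n) (step : PartitioningStep t 𝓕 F n) where

    open PartitioningStep step
    open ProbabilitySpace space using (mean-cong; mean-+; mean-*; mean-1)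
    open Mean space
    open Subproblems t k≤n
    open Sizes using (size; weight; total)

    instance
      _ = total≢0
      _ = n≢0

    plus-t : Vec ℕ (suc (suc s)) → Vec ℕ (suc (suc s))
    plus-t = Vec.zipWith ℕ._+_ t

    -- The Dirichlet-multinomial law. Given D the probability of v is a multinomial monomial in D;
    -- times the Dirichlet density it is a multiple of the monomial with exponents t + v, which
    -- `monomialIntegral` evaluates.
    mean-I : ∀ v → Vec.sum v ≡ N → (λ ω → 𝟏 (Vec.≡-dec ℕ._≟_ (I ω) v)) HasMeanₙ (ι (weight v) ÷ℕ total)
    mean-I v Σv≡N = mean-cong (λ ω → *-identityʳ _) refl
      (I-multinomial v Σv≡N (λ _ → 1#) (proj₁ (tame-const 1#)) c
        (D-dirichlet φ (proj₁ (tame-* {φ = λ x → multinomialPMF N x v} {λ _ → 1#} (tame-multinomialPMF N v) (tame-const 1#)))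
          c (monomialIntegral b _ 0<κ density p!c≈κB)))
      where
      c = ι (weight v) ÷ℕ total
      φ : Vector ℝ (suc (suc s)) → ℝ
      φ x = multinomialPMF N x v * 1#
      b = plus-t v
      1/! : ℕ → ℝ
      1/! m = inverse (ι (m !)) (0<⇒#0 (ι-pos (m !) {{ℕ._!≢0 m}}))
      u : Fin (suc (suc s)) → ℝ
      u ℓ = 1/! (lookup v ℓ) * 1/! (lookup t ℓ)
      -- N! comes from the multinomial coefficient, and k! is Γ(∑ (t_ℓ + 1)), as the Dirichlet
      -- parameters sum to k + 1.
      κ = ι (N !) * ι (k !) * product u

      0<1/! : ∀ m → 0# < 1/! m
      0<1/! m = inverse-pos (ι-pos (m !) {{ℕ._!≢0 m}})

      0<κ : 0# < κ
      0<κ = *-pos (*-pos (ι-pos (N !) {{ℕ._!≢0 N}}) (ι-pos (k !) {{ℕ._!≢0 k}}))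
        (product-pos λ ℓ → *-pos (0<1/! (lookup v ℓ)) (0<1/! (lookup t ℓ)))

      density : ∀ x → φ x * dirichletDensity (Vec.map suc t) x ≈ κ * product (λ ℓ → x ℓ ^ lookup b ℓ)
      density x = begin
        (ι (N !) * V * 1#) * (ι (k !) * product (λ ℓ → term ℓ (lookup (Vec.map suc t) ℓ ℕ.∸ 1)))
          ≈⟨ *-congˡ (*-congˡ (Π.sum-cong-≋ λ ℓ → reflexive (≡.cong (λ m → term ℓ (m ℕ.∸ 1)) (Vec.lookup-map ℓ suc t)))) ⟩
        (ι (N !) * V * 1#) * (ι (k !) * T)
          ≈⟨ trans (*-congʳ (*-identityʳ _)) (solve 4 (λ n v k w → (n :* v) :* (k :* w) := n :* k :* (v :* w)) refl _ _ _ _) ⟩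
        ι (N !) * ι (k !) * (V * T)
          ≈⟨ *-congˡ (Π.∑-distrib-+ (λ ℓ → term ℓ (lookup v ℓ)) (λ ℓ → term ℓ (lookup t ℓ))) ⟨
        ι (N !) * ι (k !) * product (λ ℓ → term ℓ (lookup v ℓ) * term ℓ (lookup t ℓ))
          ≈⟨ *-congˡ (Π.sum-cong-≋ λ ℓ → combine ℓ) ⟩
        ι (N !) * ι (k !) * product (λ ℓ → u ℓ * x ℓ ^ lookup b ℓ)
          ≈⟨ *-congˡ (Π.∑-distrib-+ u (λ ℓ → x ℓ ^ lookup b ℓ)) ⟩
        ι (N !) * ι (k !) * (product u * product (λ ℓ → x ℓ ^ lookup b ℓ))
          ≈⟨ *-assoc _ _ _ ⟨
        κ * product (λ ℓ → x ℓ ^ lookup b ℓ) ∎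
        where
        open ≈-Reasoning
        open import Algebra.Properties.CommutativeSemiring.Exp commutativeSemiring using (^-homo-*)
        term : Fin (suc (suc s)) → ℕ → ℝ
        term ℓ m = _÷ℕ_ (x ℓ ^ m) (m !) {{ℕ._!≢0 m}}
        V = product λ ℓ → term ℓ (lookup v ℓ)
        T = product λ ℓ → term ℓ (lookup t ℓ)
        combine : ∀ ℓ → term ℓ (lookup v ℓ) * term ℓ (lookup t ℓ) ≈ u ℓ * x ℓ ^ lookup b ℓ
        combine ℓ = trans
          (solve 4 (λ p q i j → (p :* i) :* (q :* j) := (i :* j) :* (q :* p)) refl _ _ _ _)
          (*-congˡ (trans (sym (^-homo-* (x ℓ) (lookup t ℓ) (lookup v ℓ)))
            (reflexive (≡.cong (x ℓ ^_) (≡.sym (Vec.lookup-zipWith ℕ._+_ ℓ t v))))))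

      u*factorials : product u * ι (factorials b) ≈ ι (weight v)
      u*factorials = begin
        product u * ι (factorials b)
          ≈⟨ *-congˡ (ι-∏ (λ ℓ → lookup b ℓ !)) ⟩
        product u * product (λ ℓ → ι (lookup b ℓ !))
          ≈⟨ Π.∑-distrib-+ u (λ ℓ → ι (lookup b ℓ !)) ⟨
        product (λ ℓ → u ℓ * ι (lookup b ℓ !))
          ≈⟨ Π.sum-cong-≋ binomial ⟩
        product (λ ℓ → ι ((lookup v ℓ ℕ.+ lookup t ℓ) C lookup t ℓ))
          ≈⟨ ι-∏ (λ ℓ → (lookup v ℓ ℕ.+ lookup t ℓ) C lookup t ℓ) ⟨
        ι (weight v) ∎
        where
        open ≈-Reasoning
        binomial : ∀ ℓ → u ℓ * ι (lookup b ℓ !) ≈ ι ((lookup v ℓ ℕ.+ lookup t ℓ) C lookup t ℓ)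
        binomial ℓ = begin
          1/! y * 1/! x * ι (lookup b ℓ !)
            ≈⟨ *-congˡ (ι-cong (≡.cong _! (≡.trans (Vec.lookup-zipWith ℕ._+_ ℓ t v) (ℕ.+-comm x y)))) ⟩
          1/! y * 1/! x * ι ((y ℕ.+ x) !)
            ≈⟨ *-congˡ (ι-cong ([m+n]Cn*m!n!≡[m+n]! y x)) ⟨
          1/! y * 1/! x * ι (((y ℕ.+ x) C x) ℕ.* (y ! ℕ.* x !))
            ≈⟨ *-congˡ (trans (ι-* ((y ℕ.+ x) C x) (y ! ℕ.* x !)) (*-congˡ (ι-* (y !) (x !)))) ⟩
          1/! y * 1/! x * (ι ((y ℕ.+ x) C x) * (ι (y !) * ι (x !)))
            ≈⟨ solve 5 (λ i j c p q → i :* j :* (c :* (p :* q)) := c :* ((p :* i) :* (q :* j))) refl _ _ _ _ _ ⟩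
          ι ((y ℕ.+ x) C x) * ((ι (y !) * 1/! y) * (ι (x !) * 1/! x))
            ≈⟨ *-congˡ (trans (*-cong (inverseʳ (ι (y !)) _) (inverseʳ (ι (x !)) _)) (*-identityˡ 1#)) ⟩
          ι ((y ℕ.+ x) C x) * 1#
            ≈⟨ *-identityʳ _ ⟩
          ι ((y ℕ.+ x) C x) ∎
          where
          x = lookup t ℓ
          y = lookup v ℓ

      -- The degree plus the dimension of the simplex is n, so the factorial is n! = total · N! ·
      -- k!; here `total` cancels the denominator of c.
      p!c≈κB : ι ((Vec.sum b ℕ.+ suc s) !) * c ≈ κ * ι (factorials b)
      p!c≈κB = begin
        ι ((Vec.sum b ℕ.+ suc s) !) * c
          ≈⟨ *-congʳ (ι-cong (≡.trans (≡.cong (λ x → (x ℕ.+ suc s) !)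
               (≡.trans (sum-zipWith-+ t v) (≡.trans (≡.cong (Vec.sum t ℕ.+_) Σv≡N) (ℕ.+-comm (Vec.sum t) N)))) (≡.sym total*k!N!))) ⟩
        ι (total ℕ.* (N ! ℕ.* Sizes.k !)) * (ι (weight v) * inverse (ι total) _)
          ≈⟨ *-congʳ (trans (ι-* total (N ! ℕ.* Sizes.k !)) (*-congˡ (trans (ι-* (N !) (Sizes.k !))
               (*-congˡ (ι-cong (≡.cong _! (≡.sym (sampleSize≡ t)))))))) ⟩
        (ι total * (ι (N !) * ι (k !))) * (ι (weight v) * inverse (ι total) _)
          ≈⟨ solve 5 (λ w m k x i → (w :* (m :* k)) :* (x :* i) := (w :* i) :* (m :* k :* x)) refl _ _ _ _ _ ⟩
        (ι total * inverse (ι total) _) * (ι (N !) * ι (k !) * ι (weight v))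
          ≈⟨ trans (*-congʳ (inverseʳ (ι total) _)) (*-identityˡ _) ⟩
        ι (N !) * ι (k !) * ι (weight v)
          ≈⟨ *-congˡ u*factorials ⟨
        ι (N !) * ι (k !) * (product u * ι (factorials b))
          ≈⟨ *-assoc _ _ _ ⟨
        κ * ι (factorials b) ∎
        where open ≈-Reasoning

    1/n : ℝ
    1/n = inverse (ι n) (0<⇒#0 (ι-pos n))

    probability : Vec ℕ (suc (suc s)) → ℝ
    probability v = ι (weight v) ÷ℕ total

    -- J and M take finitely many values, so any g(J, M) is a finite combination of indicators, and
    -- independence makes each of their means a product.
    mean-JM : ∀ (g : Vec ℕ (suc (suc s)) → Fin n → ℝ) →
      (λ ω → g (J ω) (M ω)) HasMeanₙ
        sumCompositions (suc (suc s)) N λ v → sum λ r → g (plus-t v) r * (1/n * probability v)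
    mean-JM g = mean-cong pointwise refl
      (mean-sumCompositions (suc (suc s)) N λ v Σv≡N → mean-sum λ r → mean-* (g (plus-t v) r)
        (M-indep-J r (plus-t v) 1/n (probability v) (mean-cong (λ _ → refl) (*-identityˡ 1/n) (M-uniform r))
          (mean-cong (λ ω → 𝟏-cong (Vec.≡-dec ℕ._≟_ (I ω) v) (Vec.≡-dec ℕ._≟_ (J ω) (plus-t v))
                       (≡.cong plus-t) (zipWith-+-cancelˡ t (I ω) v))
                     refl (mean-I v Σv≡N))))
      where
      pointwise : ∀ ω → sumCompositions (suc (suc s)) N (λ v → sum λ r →
          g (plus-t v) r * (𝟏 (M ω Fin.≟ r) * 𝟏 (Vec.≡-dec ℕ._≟_ (J ω) (plus-t v)))) ≈ g (J ω) (M ω)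
      pointwise ω = begin
        sumCompositions (suc (suc s)) N (λ v → sum λ r → g (plus-t v) r * (𝟏 (M ω Fin.≟ r) * 𝟏J v))
          ≈⟨ sumCompositions-cong (suc (suc s)) N (λ v _ → trans
               (∑.sum-cong-≋ λ r → solve 3 (λ g m j → g :* (m :* j) := j :* (m :* g)) refl (g (plus-t v) r) (𝟏 (M ω Fin.≟ r)) (𝟏J v))
               (sym (∑.*-distribˡ-sum (𝟏J v) λ r → 𝟏 (M ω Fin.≟ r) * g (plus-t v) r))) ⟩
        sumCompositions (suc (suc s)) N (λ v → 𝟏J v * sum λ r → 𝟏 (M ω Fin.≟ r) * g (plus-t v) r)
          ≈⟨ sumCompositions-𝟏 (suc (suc s)) N (λ v → Vec.≡-dec ℕ._≟_ (J ω) (plus-t v))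
               (λ v → sum λ r → 𝟏 (M ω Fin.≟ r) * g (plus-t v) r) (I ω) (I-sum ω) ≡.refl
               (λ w J≡ → zipWith-+-cancelˡ t w (I ω) (≡.sym J≡)) ⟩
        sum (λ r → 𝟏 (M ω Fin.≟ r) * g (J ω) r)
          ≈⟨ sum-𝟏 (λ r → M ω Fin.≟ r) (g (J ω)) (M ω) ≡.refl (λ _ eq → ≡.sym eq) ⟩
        g (J ω) (M ω) ∎
        where
        open ≈-Reasoning
        𝟏J : Vec ℕ (suc (suc s)) → ℝ
        𝟏J v = 𝟏 (Vec.≡-dec ℕ._≟_ (J ω) (plus-t v))

    -- Splits the branch cost by the value m of J_ℓ: `copy ℓ (lookup (J ω) ℓ)` has a random index,
    -- whereas independence concerns copies of fixed index.
    selects : Fin (suc (suc s)) → Fin n → Vec ℕ (suc (suc s)) → Fin n → ℝ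
    selects ℓ m j r = 𝟏 (lookup j ℓ ℕ.≟ toℕ m) * 𝟏 (inSegment? j ℓ (suc (toℕ r)))

    selectionMean : Fin (suc (suc s)) → Fin n → ℝ
    selectionMean ℓ m = sumCompositions (suc (suc s)) N λ v → sum λ r → selects ℓ m (plus-t v) r * (1/n * probability v)


    -- Independence is stated for a product over all copies. Taking the m-th coordinate as the test
    -- function of copy ℓ and the constant 1 for the others isolates the one factor; initial
    -- segments of length n suffice, as m < n.
    mean-branch : ∀ ℓ m e → _HasMean_ 𝓕 (F (toℕ m)) e →
      (λ ω → selects ℓ m (J ω) (M ω) * copy ℓ (toℕ m) ω) HasMeanₙ (selectionMean ℓ m * e)
    mean-branch ℓ m e hF = mean-cong
      (λ ω → *-congˡ (product-select ℓ λ i → copy i (toℕ m) ω)) (*-congˡ (product-select ℓ λ _ → e))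
      (copy-indep n φ (λ j r _ → selects ℓ m j r) φ-continuous (λ j r → proj₁ (tame-const (selects ℓ m j r)))
        (selectionMean ℓ m) (λ i → if does (i Fin.≟ ℓ) then e else 1#) (mean-JM (selects ℓ m)) φ-mean)
      where
      φ : Fin (suc (suc s)) → Vector ℝ n → ℝ
      φ i x = if does (i Fin.≟ ℓ) then x m else 1#
      φ-continuous : ∀ i → Continuous (φ i)
      φ-continuous i with does (i Fin.≟ ℓ)
      ... | true  = continuous-coordinate m
      ... | false = proj₁ (tame-const 1#)
      φ-mean : ∀ i → (λ ω → φ i (initial n (copy i) ω)) HasMeanₙ (if does (i Fin.≟ ℓ) then e else 1#)
      φ-mean i with does (i Fin.≟ ℓ)
      ... | true  = proj₂ (copy-law i n (λ x → x m) (continuous-coordinate m) e) hF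
      ... | false = mean-1

    lookup-J : ∀ v ℓ → lookup (plus-t v) ℓ ≡ size v ℓ
    lookup-J v ℓ = Vec.lookup-zipWith ℕ._+_ ℓ t v

    mean-totalCost : ∀ {α} (E : Fin n → ℝ) → A HasMeanₙ α → (∀ m → _HasMean_ 𝓕 (F (toℕ m)) (E m)) →
      totalCost HasMeanₙ (α + sum λ ℓ → sum λ m → selectionMean ℓ m * E m)
    mean-totalCost E hA hF = mean-cong (λ ω → +-congˡ (∑.sum-cong-≋ λ ℓ → select ω ℓ)) refl
      (mean-+ hA (mean-sum λ ℓ → mean-sum λ m → mean-branch ℓ m (E m) (hF m)))
      where
      select : ∀ ω ℓ → sum (λ m → selects ℓ m (J ω) (M ω) * copy ℓ (toℕ m) ω)
                     ≈ 𝟏 (inSegment? (J ω) ℓ (rank ω)) * copy ℓ (lookup (J ω) ℓ) ω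
      select ω ℓ = begin
        sum {n} (λ m → 𝟏 (lookup (J ω) ℓ ℕ.≟ toℕ m) * here * copy ℓ (toℕ m) ω)
          ≈⟨ ∑.sum-cong-≋ {n} (λ m → *-assoc (𝟏 (lookup (J ω) ℓ ℕ.≟ toℕ m)) here (copy ℓ (toℕ m) ω)) ⟩
        sum {n} (λ m → 𝟏 (lookup (J ω) ℓ ℕ.≟ toℕ m) * (here * copy ℓ (toℕ m) ω))
          ≈⟨ sum-𝟏 {n} (λ m → lookup (J ω) ℓ ℕ.≟ toℕ m) (λ m → here * copy ℓ (toℕ m) ω) (fromℕ< J<n)
               (≡.sym (Fin.toℕ-fromℕ< J<n)) (λ m J≡m → Fin.toℕ-injective (≡.trans (≡.sym J≡m) (≡.sym (Fin.toℕ-fromℕ< J<n)))) ⟩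
        here * copy ℓ (toℕ (fromℕ< J<n)) ω
          ≈⟨ *-congˡ (reflexive (≡.cong (λ m → copy ℓ m ω) (Fin.toℕ-fromℕ< J<n))) ⟩
        here * copy ℓ (lookup (J ω) ℓ) ω ∎
        where
        open ≈-Reasoning
        here = 𝟏 (inSegment? (J ω) ℓ (rank ω))
        J<n : lookup (J ω) ℓ ℕ.< n
        J<n = ≡.subst (ℕ._< n) (≡.sym (lookup-J (I ω) ℓ)) (size<n (I ω) ℓ (I-sum ω))

    -- For fixed J, summing over the rank r counts segment ℓ and gives the factor J_ℓ, while summing
    -- over m evaluates x at J_ℓ. The factor n · total clears the denominators of the laws of M and
    -- J.
    selectionMean-branching : ∀ (x : ℕ → ℝ) →
      ι (n ℕ.* total) * (sum λ ℓ → sum λ m → selectionMean ℓ m * x (toℕ m)) ≈ branching x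
    selectionMean-branching x = trans (∑.*-distribˡ-sum (ι (n ℕ.* total)) λ ℓ → sum λ m → selectionMean ℓ m * x (toℕ m))
      (∑.sum-cong-≋ λ ℓ → begin
        ι (n ℕ.* total) * sum (λ m → selectionMean ℓ m * x (toℕ m))
          ≈⟨ *-congˡ (∑.sum-cong-≋ λ m → trans (*-comm (selectionMean ℓ m) (x (toℕ m))) (sym (sumCompositions-*ˡ S N (x (toℕ m)) (T ℓ m)))) ⟩
        ι (n ℕ.* total) * sum (λ m → sumCompositions S N λ v → x (toℕ m) * T ℓ m v)
          ≈⟨ *-congˡ (sumCompositions-∑ S N λ m v → x (toℕ m) * T ℓ m v) ⟨
        ι (n ℕ.* total) * sumCompositions S N (λ v → sum λ m → x (toℕ m) * T ℓ m v)
          ≈⟨ sumCompositions-*ˡ S N (ι (n ℕ.* total)) (λ v → sum λ m → x (toℕ m) * T ℓ m v) ⟨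
        sumCompositions S N (λ v → ι (n ℕ.* total) * sum λ m → x (toℕ m) * T ℓ m v)
          ≈⟨ sumCompositions-cong S N (λ v Σv≡N → given v ℓ Σv≡N) ⟩
        sumCompositions S N (λ v → ι (weight v ℕ.* size v ℓ) * x (size v ℓ)) ∎)
      where
      open ≈-Reasoning
      S = suc (suc s)
      T : Fin S → Fin n → Vec ℕ S → ℝ
      T ℓ m v = sum λ r → selects ℓ m (plus-t v) r * (1/n * probability v)
      normalise : ∀ v ℓ → ι (n ℕ.* total) * (ι (size v ℓ) * (1/n * probability v)) ≈ ι (weight v ℕ.* size v ℓ)
      normalise v ℓ = begin
        ι (n ℕ.* total) * (ι (size v ℓ) * (1/n * (ι (weight v) * inverse (ι total) _)))
          ≈⟨ *-congʳ (ι-* n total) ⟩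
        (ι n * ι total) * (ι (size v ℓ) * (1/n * (ι (weight v) * inverse (ι total) _)))
          ≈⟨ solve 6 (λ n w j i c u → (n :* w) :* (j :* (i :* (c :* u))) := ((n :* i) :* (w :* u)) :* (c :* j)) refl _ _ _ _ _ _ ⟩
        ((ι n * 1/n) * (ι total * inverse (ι total) _)) * (ι (weight v) * ι (size v ℓ))
          ≈⟨ *-congʳ (trans (*-cong (inverseʳ (ι n) _) (inverseʳ (ι total) _)) (*-identityˡ 1#)) ⟩
        1# * (ι (weight v) * ι (size v ℓ))
          ≈⟨ trans (*-identityˡ _) (sym (ι-* (weight v) (size v ℓ))) ⟩
        ι (weight v ℕ.* size v ℓ) ∎

      given : ∀ v ℓ → Vec.sum v ≡ N →
        ι (n ℕ.* total) * (sum λ m → x (toℕ m) * sum λ r → selects ℓ m (plus-t v) r * (1/n * probability v))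
        ≈ ι (weight v ℕ.* size v ℓ) * x (size v ℓ)
      given v ℓ Σv≡N = begin
        ι (n ℕ.* total) * (sum λ m → x (toℕ m) * sum λ r → 𝟏m m * 𝟏r r * q)
          ≈⟨ *-congˡ (∑.sum-cong-≋ λ m → trans (*-congˡ (∑.sum-cong-≋ λ r → *-assoc (𝟏m m) (𝟏r r) q))
               (trans (*-congˡ (trans (sym (∑.*-distribˡ-sum (𝟏m m) λ r → 𝟏r r * q)) (*-congˡ (trans (sym (∑.*-distribʳ-sum q 𝟏r)) (*-congʳ ∑𝟏r)))))
                 (solve 4 (λ x m j q → x :* (m :* (j :* q)) := m :* (j :* q :* x)) refl (x (toℕ m)) (𝟏m m) (ι (size v ℓ)) q))) ⟩
        ι (n ℕ.* total) * (sum λ m → 𝟏m m * (ι (size v ℓ) * q * x (toℕ m)))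
          ≈⟨ *-congˡ (sum-𝟏 (λ m → lookup (plus-t v) ℓ ℕ.≟ toℕ m) (λ m → ι (size v ℓ) * q * x (toℕ m)) (fromℕ< j<n)
               (≡.trans (lookup-J v ℓ) (≡.sym (Fin.toℕ-fromℕ< j<n)))
               (λ m J≡m → Fin.toℕ-injective (≡.trans (≡.sym J≡m) (≡.trans (lookup-J v ℓ) (≡.sym (Fin.toℕ-fromℕ< j<n)))))) ⟩
        ι (n ℕ.* total) * (ι (size v ℓ) * q * x (toℕ (fromℕ< j<n)))
          ≈⟨ *-congˡ (*-congˡ (reflexive (≡.cong x (Fin.toℕ-fromℕ< j<n)))) ⟩
        ι (n ℕ.* total) * (ι (size v ℓ) * q * x (size v ℓ))
          ≈⟨ *-assoc _ _ _ ⟨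
        ι (n ℕ.* total) * (ι (size v ℓ) * q) * x (size v ℓ)
          ≈⟨ *-congʳ (normalise v ℓ) ⟩
        ι (weight v ℕ.* size v ℓ) * x (size v ℓ) ∎
        where
        q = 1/n * probability v
        j<n = size<n v ℓ Σv≡N
        𝟏m : Fin n → ℝ
        𝟏m m = 𝟏 (lookup (plus-t v) ℓ ℕ.≟ toℕ m)
        𝟏r : Fin n → ℝ
        𝟏r r = 𝟏 (inSegment? (plus-t v) ℓ (suc (toℕ r)))
        ∑𝟏r : sum 𝟏r ≈ ι (size v ℓ)
        ∑𝟏r = trans (segment-size (plus-t v) ℓ n (ℕ.≤-reflexive (≡.trans (≡.cong (ℕ._+ S)
            (≡.trans (sum-zipWith-+ t v) (≡.cong (Vec.sum t ℕ.+_) Σv≡N)))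
            (≡.trans (regroup (Vec.sum t) N s) (≡.cong suc n≡)))))
          (ι-cong (lookup-J v ℓ))
          where
          regroup : ∀ a b c → a ℕ.+ b ℕ.+ suc (suc c) ≡ suc (b ℕ.+ a ℕ.+ suc c)
          regroup = solve-∀

    stepMean : (α : ℝ) → (Fin n → ℝ) → ℝ
    stepMean α E = α + sum λ ℓ → sum λ m → selectionMean ℓ m * E m

    -- Equality in law transports the existence of the mean along with its value.
    mean-F : ∀ {α} (E : Fin n → ℝ) → A HasMeanₙ α → (∀ m → _HasMean_ 𝓕 (F (toℕ m)) (E m)) →
      _HasMean_ 𝓕 (F n) (stepMean α E)
    mean-F {α} E hA hF =
      proj₂ (recurrence (λ x → x zero) (continuous-coordinate zero) (stepMean α E)) (mean-totalCost E hA hF)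

    scaled-stepMean : ∀ α (x : ℕ → ℝ) →
      ι (n ℕ.* total) * stepMean α (x ∘ toℕ) ≈ ι (n ℕ.* total) * α + branching x
    scaled-stepMean α x = trans (distribˡ _ _ _) (+-congˡ (selectionMean-branching x))

-- The recursion as an approximately linear contraction

module Asymptotics (𝓡 : RealNumbers) where

  open Compositions using (sumComp; pronic; ∑pronic<; sum-map-suc)
  open OrderedField 𝓡
  open DirichletIntegral 𝓡
  open Recursion 𝓡
  import Algebra.Properties.Semiring.Sum semiring as ∑

  sum-mono : ∀ {n} {f g : Fin n → ℝ} → (∀ i → f i ≤ g i) → sum f ≤ sum g
  sum-mono {zero}  f≤g = ≤-refl
  sum-mono {suc n} f≤g = +-mono-≤ (f≤g zero) (sum-mono (f≤g ∘ suc))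

  sumCompositions-mono : ∀ s N {f g} → (∀ v → Vec.sum v ≡ N → f v ≤ g v) → sumCompositions s N f ≤ sumCompositions s N g
  sumCompositions-mono zero    zero    f≤g = f≤g [] ≡.refl
  sumCompositions-mono zero    (suc N) f≤g = ≤-refl
  sumCompositions-mono (suc s) N       f≤g = sum-mono {suc N} λ i →
    sumCompositions-mono s (N ℕ.∸ toℕ i) λ v Σv → f≤g (toℕ i ∷ v)
      (≡.trans (≡.cong (toℕ i ℕ.+_) Σv) (ℕ.m+[n∸m]≡n (Fin.toℕ≤pred[n] i)))

  sumCompositions-+ : ∀ s N f g →
    sumCompositions s N (λ v → f v + g v) ≈ sumCompositions s N f + sumCompositions s N g
  sumCompositions-+ zero    zero    f g = refl
  sumCompositions-+ zero    (suc N) f g = sym (+-identityʳ 0#)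
  sumCompositions-+ (suc s) N       f g = trans
    (∑.sum-cong-≋ {suc N} λ i → sumCompositions-+ s (N ℕ.∸ toℕ i) (λ v → f (toℕ i ∷ v)) (λ v → g (toℕ i ∷ v)))
    (∑.∑-distrib-+ {suc N} (λ i → sumCompositions s (N ℕ.∸ toℕ i) λ v → f (toℕ i ∷ v))
                           (λ i → sumCompositions s (N ℕ.∸ toℕ i) λ v → g (toℕ i ∷ v)))

  module _ {s : ℕ} (t : Vec ℕ (suc (suc s))) where

    private
      k = sampleSize t
      k+1,k+2 = suc k ℕ.* suc (suc k)

    -- The limit of 𝔼[∑ (J_ℓ / n)²] as n → ∞.
    contraction : ℝ
    contraction = sum λ ℓ → ι (suc (lookup t ℓ) ℕ.* suc (suc (lookup t ℓ))) ÷ℕ k+1,k+2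

    pronicSum : ℕ
    pronicSum = Compositions.sum λ ℓ → pronic (lookup t ℓ)

    pronic*contraction : ι (pronic k) * contraction ≈ ι pronicSum
    pronic*contraction = trans (∑.*-distribˡ-sum (ι (pronic k)) λ ℓ → ι (pronic (lookup t ℓ)) ÷ℕ k+1,k+2)
      (trans (∑.sum-cong-≋ {suc (suc s)} λ ℓ → trans (solve 3 (λ c x i → c :* (x :* i) := c :* i :* x) refl (ι (pronic k)) (ι (pronic (lookup t ℓ))) (inverse (ι (pronic k)) pronic#0))
               (trans (*-congʳ (inverseʳ (ι (pronic k)) pronic#0)) (*-identityˡ _)))
        (sym (ι-sum λ ℓ → pronic (lookup t ℓ))))

      where
      pronic#0 = 0<⇒#0 (ι-pos (pronic k))

    pronicSum< : pronicSum ℕ.< pronic k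
    pronicSum< = ≡.subst (λ σ → pronicSum ℕ.< σ ℕ.* suc σ)
      (≡.trans (sum-map-suc t) (≡.trans (ℕ.+-suc (Vec.sum t) (suc s)) (≡.cong suc (≡.sym (sampleSize≡ t))))) (∑pronic< t)

    contraction<1 : contraction < 1#
    contraction<1 = *-cancelˡ-< (ι-pos (pronic k))
      (<-respˡ (sym pronic*contraction) (<-respʳ (sym (*-identityʳ _)) (ι-mono-< pronicSum<)))

    H-pos : 0# < H t
    H-pos = x<y⇒0<y-x contraction<1

    contraction+H : contraction + H t ≈ 1#
    contraction+H = solve 2 (λ q u → q :+ (u :- q) := u) refl contraction 1#

    -- `Sizes.slack` for s + 2 segments, detached from n, since one bound has to serve every n.
    slack : ℝ
    slack = ι (5 ℕ.+ 2 ℕ.* suc s)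

    module Branching {n : ℕ} (k≤n : k ℕ.≤ n) where

      open Subproblems t k≤n
      open Sizes using (size; weight; total; secondMoment)

      private
        S : ℕ
        S = suc (suc s)
        nw = ι (n ℕ.* total)

      0<nw : 0# < ι (n ℕ.* total)
      0<nw = ι-pos (n ℕ.* total) {{ℕ.m*n≢0 n total {{n≢0}} {{total≢0}}}}

      -- The restriction to j < n is what lets an induction hypothesis be inserted.
      branching-mono : ∀ x y → (∀ j → j ℕ.< n → x j ≤ y j) → branching x ≤ branching y
      branching-mono x y x≤y = sum-mono {S} λ ℓ → sumCompositions-mono S N λ v Σv≡N →
        ι-*-monoˡ-≤ (weight v ℕ.* size v ℓ) (x≤y (size v ℓ) (size<n v ℓ Σv≡N))

      branching-cong : ∀ x y → (∀ j → x j ≈ y j) → branching x ≈ branching y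
      branching-cong x y x≈y = ∑.sum-cong-≋ {S} λ ℓ → sumCompositions-cong S N λ v _ → *-congˡ {ι (weight v ℕ.* size v ℓ)} (x≈y (size v ℓ))

      branching-+ : ∀ x y → branching (λ j → x j + y j) ≈ branching x + branching y
      branching-+ x y = trans
        (∑.sum-cong-≋ {S} λ ℓ → trans
          (sumCompositions-cong S N λ v _ → distribˡ (ι (weight v ℕ.* size v ℓ)) (x (size v ℓ)) (y (size v ℓ)))
          (sumCompositions-+ S N (term x ℓ) (term y ℓ)))
        (∑.∑-distrib-+ {S} (λ ℓ → sumCompositions S N (term x ℓ)) (λ ℓ → sumCompositions S N (term y ℓ)))
        where
        term : (ℕ → ℝ) → Fin S → Vec ℕ S → ℝ
        term x ℓ v = ι (weight v ℕ.* size v ℓ) * x (size v ℓ)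

      branching-* : ∀ c x → branching (λ j → c * x j) ≈ c * branching x
      branching-* c x = trans
        (∑.sum-cong-≋ {S} λ ℓ → trans
          (sumCompositions-cong S N λ v _ →
            solve 3 (λ w c x → w :* (c :* x) := c :* (w :* x)) refl (ι (weight v ℕ.* size v ℓ)) c (x (size v ℓ)))
          (sumCompositions-*ˡ S N c λ v → ι (weight v ℕ.* size v ℓ) * x (size v ℓ)))
        (sym (∑.*-distribˡ-sum c λ ℓ → sumCompositions S N λ v → ι (weight v ℕ.* size v ℓ) * x (size v ℓ)))

      branching-ℕ : ∀ (f : ℕ → ℕ) → branching (ι ∘ f) ≈ ι (Sizes.expect λ v ℓ → size v ℓ ℕ.* f (size v ℓ))
      branching-ℕ f = trans
        (∑.sum-cong-≋ {S} λ ℓ → trans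
          (sumCompositions-cong S N λ v _ → trans (sym (ι-* (weight v ℕ.* size v ℓ) (f (size v ℓ))))
            (ι-cong (ℕ.*-assoc (weight v) (size v ℓ) (f (size v ℓ)))))
          (sym (ι-sumComp S N λ v → weight v ℕ.* (size v ℓ ℕ.* f (size v ℓ)))))
        (sym (ι-sum λ ℓ → sumComp S N λ v → weight v ℕ.* (size v ℓ ℕ.* f (size v ℓ))))

      -- Divided by n · total, the left side is the probability that the sought element is not a
      -- pivot.
      branching-1≤ : branching (λ _ → 1#) ≤ nw
      branching-1≤ = begin
        branching (λ _ → 1#)    ≈⟨ branching-cong (λ _ → ι 1) (λ _ → 1#) (λ _ → ι-1) ⟨
        branching (λ _ → ι 1)   ≈⟨ branching-ℕ (λ _ → 1) ⟩
        ι (Sizes.expect λ v ℓ → size v ℓ ℕ.* 1)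
          ≤⟨ ι-mono-≤ (ℕ.≤-trans (Sizes.expect-mono {λ v ℓ → size v ℓ ℕ.* 1} {size} λ v ℓ → ℕ.≤-reflexive (ℕ.*-identityʳ (size v ℓ))) Sizes.firstMoment≤) ⟩
        ι (Sizes.n ℕ.* total)   ≈⟨ ι-cong (≡.cong (ℕ._* total) n≡) ⟩
        ι (n ℕ.* total)         ∎
        where open ≤-Reasoning

      private
        1≤n : 1 ℕ.≤ Sizes.n
        1≤n = ≡.subst (1 ℕ.≤_) (≡.sym n≡) (ℕ.>-nonZero⁻¹ n {{n≢0}})

        scale-contraction : ι Sizes.T₂ * ι (Sizes.n ℕ.* Sizes.n ℕ.* total) ≈ ι Sizes.C₂ * (nw * (contraction * ι n))
        scale-contraction = begin
          ι Sizes.T₂ * ι (Sizes.n ℕ.* Sizes.n ℕ.* total)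
            ≈⟨ *-congˡ (ι-cong (≡.cong (λ x → x ℕ.* x ℕ.* total) n≡)) ⟩
          ι Sizes.T₂ * ι (n ℕ.* n ℕ.* total)
            ≈⟨ *-cong (sym pronic*contraction) (trans (ι-cong (≡.trans (ℕ.*-assoc n n total) (ℕ.*-comm n (n ℕ.* total)))) (ι-* (n ℕ.* total) n)) ⟩
          (ι (pronic k) * contraction) * (nw * ι n)
            ≈⟨ solve 4 (λ c q w n → (c :* q) :* (w :* n) := c :* (w :* (q :* n))) refl _ _ _ _ ⟩
          ι (pronic k) * (nw * (contraction * ι n))
            ≈⟨ *-congʳ (ι-cong (≡.cong pronic (sampleSize≡ t))) ⟩
          ι Sizes.C₂ * (nw * (contraction * ι n)) ∎
          where open import Relation.Binary.Reasoning.Setoid setoid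

        scale-slack : ι Sizes.C₂ * ι (Sizes.slack ℕ.* (Sizes.n ℕ.* total)) ≈ ι Sizes.C₂ * (nw * slack)
        scale-slack = *-congˡ (trans (ι-* Sizes.slack (Sizes.n ℕ.* total)) (trans (*-comm _ _) (*-congʳ (ι-cong (≡.cong (ℕ._* total) n≡)))))

        T₂≤C₂ : Sizes.T₂ ℕ.≤ Sizes.C₂
        T₂≤C₂ = ℕ.<⇒≤ (≡.subst (λ x → pronicSum ℕ.< pronic x) (sampleSize≡ t) pronicSum<)

      -- A size enters twice, through the probability of its segment and as the argument, so
      -- `branching ι` is the second moment; C₂ is its common denominator.
      branching-ι≤ : branching ι ≤ nw * (contraction * ι n) + nw * slack
      branching-ι≤ = *-cancelˡ-≤ (ι-pos Sizes.C₂) (begin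
        ι Sizes.C₂ * branching ι
          ≈⟨ trans (*-congˡ (branching-ℕ (λ j → j))) (sym (ι-* Sizes.C₂ secondMoment)) ⟩
        ι (Sizes.C₂ ℕ.* secondMoment)
          ≤⟨ ι-mono-≤ (Sizes.secondMoment≤ T₂≤C₂ 1≤n) ⟩
        ι (Sizes.T₂ ℕ.* (Sizes.n ℕ.* Sizes.n ℕ.* total) ℕ.+ Sizes.C₂ ℕ.* (Sizes.slack ℕ.* (Sizes.n ℕ.* total)))
          ≈⟨ trans (ι-+ (Sizes.T₂ ℕ.* (Sizes.n ℕ.* Sizes.n ℕ.* total)) (Sizes.C₂ ℕ.* (Sizes.slack ℕ.* (Sizes.n ℕ.* total))))
               (+-cong (trans (ι-* Sizes.T₂ (Sizes.n ℕ.* Sizes.n ℕ.* total)) scale-contraction) (trans (ι-* Sizes.C₂ (Sizes.slack ℕ.* (Sizes.n ℕ.* total))) scale-slack)) ⟩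
        ι Sizes.C₂ * (nw * (contraction * ι n)) + ι Sizes.C₂ * (nw * slack)
          ≈⟨ distribˡ _ _ _ ⟨
        ι Sizes.C₂ * (nw * (contraction * ι n) + nw * slack) ∎)
        where open ≤-Reasoning

      ≤branching-ι : nw * (contraction * ι n) ≤ branching ι + nw * slack
      ≤branching-ι = *-cancelˡ-≤ (ι-pos Sizes.C₂) (begin
        ι Sizes.C₂ * (nw * (contraction * ι n))
          ≈⟨ trans (ι-* Sizes.T₂ (Sizes.n ℕ.* Sizes.n ℕ.* total)) scale-contraction ⟨
        ι (Sizes.T₂ ℕ.* (Sizes.n ℕ.* Sizes.n ℕ.* total))
          ≤⟨ ι-mono-≤ (Sizes.≤secondMoment 1≤n) ⟩
        ι (Sizes.C₂ ℕ.* secondMoment ℕ.+ Sizes.C₂ ℕ.* (Sizes.slack ℕ.* (Sizes.n ℕ.* total)))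
          ≈⟨ trans (ι-+ (Sizes.C₂ ℕ.* secondMoment) (Sizes.C₂ ℕ.* (Sizes.slack ℕ.* (Sizes.n ℕ.* total))))
               (+-cong (trans (ι-* Sizes.C₂ secondMoment) (*-congˡ (sym (branching-ℕ (λ j → j))))) (trans (ι-* Sizes.C₂ (Sizes.slack ℕ.* (Sizes.n ℕ.* total))) scale-slack)) ⟩
        ι Sizes.C₂ * branching ι + ι Sizes.C₂ * (nw * slack)
          ≈⟨ distribˡ _ _ _ ⟨
        ι Sizes.C₂ * (branching ι + nw * slack) ∎)
        where open ≤-Reasoning

    -- Comparing two sequences along the recursion

    bounded-difference : ∀ (x y : ℕ → ℝ) N → ∃ λ K → ∀ n → n ℕ.< N → x n ≤ y n + ι K
    bounded-difference x y zero    = 0 , λ n ()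
    -- The sum serves as an upper bound for both K and m.
    bounded-difference x y (suc N) = K ℕ.+ m , bound
      where
      K = proj₁ (bounded-difference x y N)
      m = proj₁ (archimedean (x N - y N))
      open ≤-Reasoning
      bound : ∀ n → n ℕ.< suc N → x n ≤ y n + ι (K ℕ.+ m)
      bound n n<1+N with n ℕ.≟ N
      ... | yes ≡.refl = begin
        x n                       ≈⟨ solve 2 (λ x y → x := y :+ (x :- y)) refl (x n) (y n) ⟩
        y n + (x n - y n)         ≤⟨ +-monoʳ-≤ (y n) (<⇒≤ (proj₂ (archimedean (x n - y n)))) ⟩
        y n + ι m                 ≤⟨ +-monoʳ-≤ (y n) (ι-mono-≤ (ℕ.m≤n+m m K)) ⟩
        y n + ι (K ℕ.+ m)         ∎
      ... | no n≢N = begin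
        x n                       ≤⟨ proj₂ (bounded-difference x y N) n (ℕ.≤∧≢⇒< (ℕ.s≤s⁻¹ n<1+N) n≢N) ⟩
        y n + ι K                 ≤⟨ +-monoʳ-≤ (y n) (ι-mono-≤ (ℕ.m≤m+n K m)) ⟩
        y n + ι (K ℕ.+ m)         ∎

    scale : ∀ {n} → k ℕ.≤ n → ℝ
    scale {n} k≤n = ι (n ℕ.* Subproblems.Sizes.total t k≤n)

    branch : ∀ {n} → k ℕ.≤ n → (ℕ → ℝ) → ℝ
    branch k≤n = Subproblems.branching t k≤n

    -- The bound x ≤ y + K + η n survives a step of the recursion: the weights of branch sum to at most
    -- scale, which preserves K, and η n shrinks by H η n = 2 δ n, which pays for the defect and the slack.
    compare : ∀ (x y : ℕ → ℝ) {δ η} → 0# < δ → 0# < η → η * H t ≈ δ + δ → ∀ N₁ →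
      (∀ n (k≤n : k ℕ.≤ n) → N₁ ℕ.≤ n →
        scale k≤n * x n + branch k≤n y ≤ scale k≤n * y n + branch k≤n x + scale k≤n * (δ * ι n)) →
      ∃ λ K → ∀ n → x n ≤ y n + (ι K + η * ι n)
    compare x y {δ} {η} 0<δ 0<η ηH≈2δ N₁ defect = K , <-rec _ bound
      where
      -- From `N₂` on, η · slack is at most δ n. Adding k to the threshold makes `branch` available
      -- beyond it; K covers the finitely many n before it.
      N₂ = proj₁ (archimedean* 0<δ (η * slack))
      N₃ = N₁ ℕ.+ N₂ ℕ.+ k
      K  = proj₁ (bounded-difference x y N₃)
      open ≤-Reasoning

      module _ {n : ℕ} (N₃≤n : N₃ ℕ.≤ n) (ih : ∀ {j} → j ℕ.< n → x j ≤ y j + (ι K + η * ι j)) where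
        k≤n : k ℕ.≤ n
        k≤n = ℕ.≤-trans (ℕ.m≤n+m k (N₁ ℕ.+ N₂)) N₃≤n
        N₁≤n : N₁ ℕ.≤ n
        N₁≤n = ℕ.≤-trans (ℕ.≤-trans (ℕ.m≤m+n N₁ N₂) (ℕ.m≤m+n (N₁ ℕ.+ N₂) k)) N₃≤n
        N₂≤n : N₂ ℕ.≤ n
        N₂≤n = ℕ.≤-trans (ℕ.≤-trans (ℕ.m≤n+m N₂ N₁) (ℕ.m≤m+n (N₁ ℕ.+ N₂) k)) N₃≤n
        open Branching k≤n
        w = scale k≤n
        b = branch k≤n

        b-x≤ : b x ≤ b y + (ι K * w + η * (w * (contraction * ι n) + w * slack))
        b-x≤ = begin
          b x
            ≤⟨ branching-mono x (λ j → y j + (ι K + η * ι j)) (λ j → ih) ⟩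
          b (λ j → y j + (ι K + η * ι j))
            ≈⟨ branching-+ y (λ j → ι K + η * ι j) ⟩
          b y + b (λ j → ι K + η * ι j)
            ≈⟨ +-congˡ (branching-+ (λ _ → ι K) (λ j → η * ι j)) ⟩
          b y + (b (λ _ → ι K) + b (λ j → η * ι j))
            ≈⟨ +-congˡ (+-cong (trans (branching-cong (λ _ → ι K) (λ _ → ι K * 1#) (λ _ → sym (*-identityʳ (ι K))))
                                      (branching-* (ι K) (λ _ → 1#)))
                               (branching-* η ι)) ⟩
          b y + (ι K * b (λ _ → 1#) + η * b ι)
            ≤⟨ +-monoʳ-≤ (b y) (+-mono-≤ (ι-*-monoˡ-≤ K branching-1≤) (*-monoˡ-≤ 0<η branching-ι≤)) ⟩
          b y + (ι K * w + η * (w * (contraction * ι n) + w * slack)) ∎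

        step≤ : x n ≤ y n + (ι K + (η * (contraction * ι n) + η * slack + δ * ι n))
        step≤ = *-cancelˡ-≤ 0<nw (+-cancelʳ-≤ (b y) (begin
          w * x n + b y
            ≤⟨ defect n k≤n N₁≤n ⟩
          w * y n + b x + w * (δ * ι n)
            ≤⟨ +-monoˡ-≤ (w * (δ * ι n)) (+-monoʳ-≤ (w * y n) b-x≤) ⟩
          w * y n + (b y + (ι K * w + η * (w * (contraction * ι n) + w * slack))) + w * (δ * ι n)
            ≈⟨ solve 8 (λ w y b K e q s d → w :* y :+ (b :+ (K :* w :+ e :* (w :* q :+ w :* s))) :+ w :* d
                         := w :* (y :+ (K :+ (e :* q :+ e :* s :+ d))) :+ b)
                 refl w (y n) (b y) (ι K) η (contraction * ι n) slack (δ * ι n) ⟩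
          w * (y n + (ι K + (η * (contraction * ι n) + η * slack + δ * ι n))) + b y ∎))

        bound-large : x n ≤ y n + (ι K + η * ι n)
        bound-large = begin
          x n
            ≤⟨ step≤ ⟩
          y n + (ι K + (η * (contraction * ι n) + η * slack + δ * ι n))
            ≤⟨ +-monoʳ-≤ (y n) (+-monoʳ-≤ (ι K) (+-monoˡ-≤ (δ * ι n) (+-monoʳ-≤ (η * (contraction * ι n))
                 (<⇒≤ (proj₂ (archimedean* 0<δ (η * slack)) n N₂≤n))))) ⟩
          y n + (ι K + (η * (contraction * ι n) + δ * ι n + δ * ι n))
            ≈⟨ +-congˡ (+-congˡ (trans
                 (solve 4 (λ e q d n → e :* (q :* n) :+ d :* n :+ d :* n := (e :* q :+ (d :+ d)) :* n) refl η contraction δ (ι n))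
                 (*-congʳ (trans (+-congˡ (sym ηH≈2δ)) (trans (sym (distribˡ η contraction (H t)))
                   (trans (*-congˡ contraction+H) (*-identityʳ η))))))) ⟩
          y n + (ι K + η * ι n) ∎

      bound : ∀ n → (∀ {j} → j ℕ.< n → x j ≤ y j + (ι K + η * ι j)) → x n ≤ y n + (ι K + η * ι n)
      bound n ih with n ℕ.<? N₃
      ... | yes n<N₃ = begin
        x n                      ≤⟨ proj₂ (bounded-difference x y N₃) n n<N₃ ⟩
        y n + ι K                ≈⟨ +-congˡ (+-identityʳ (ι K)) ⟨
        y n + (ι K + 0#)         ≈⟨ +-congˡ (+-congˡ (zeroʳ η)) ⟨
        y n + (ι K + η * 0#)     ≤⟨ +-monoʳ-≤ (y n) (+-monoʳ-≤ (ι K) (*-monoˡ-≤ 0<η (0≤ι n))) ⟩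
        y n + (ι K + η * ι n)    ∎
      ... | no n≮N₃ = bound-large (ℕ.≮⇒≥ n≮N₃) ih

  -- Asymptotic equivalence with a linear function

  ∼-linear⇒ : ∀ {f a} → 0# < a → f ∼ (λ n → a * ι n) → ∀ δ → 0# < δ →
    ∃ λ N → ∀ n → N ℕ.≤ n → (f n ≤ a * ι n + δ * ι n) × (a * ι n ≤ f n + δ * ι n)
  -- `suc N` forces n ≥ 1: the relation `∼` makes a n apart from 0 only, but scaling the
  -- inequalities requires it to be positive.
  ∼-linear⇒ {f} {a} 0<a f∼ δ 0<δ = suc N , λ n 1+N≤n → near n 1+N≤n (proj₂ eventually n (ℕ.≤-trans (ℕ.n≤1+n N) 1+N≤n))
    where
    a⁻¹ = inverse a (0<⇒#0 0<a)
    -- A relative error δ / a against a n is an absolute error δ n.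
    eventually = f∼ (δ * a⁻¹) (*-pos 0<δ (inverse-pos 0<a))
    N = proj₁ eventually
    open ≤-Reasoning
    near : ∀ n → suc N ℕ.≤ n → (Σ (a * ι n # 0#) λ g#0 → Within (δ * a⁻¹) (f n ÷ a * ι n [ g#0 ]) 1#) →
      (f n ≤ a * ι n + δ * ι n) × (a * ι n ≤ f n + δ * ι n)
    near n 1+N≤n (g#0 , f/g-1< , 1-f/g<) = <⇒≤ upper , <⇒≤ lower
      where
      g = a * ι n
      i = inverse g g#0
      0<g : 0# < g
      0<g = *-pos 0<a (ι-pos n {{ℕ.>-nonZero (ℕ.≤-trans (ℕ.s≤s ℕ.z≤n) 1+N≤n)}})
      δι≈ : g * (δ * a⁻¹) ≈ δ * ι n
      δι≈ = trans (solve 4 (λ a n d i → a :* n :* (d :* i) := (a :* i) :* (d :* n)) refl a (ι n) δ a⁻¹)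
                  (trans (*-congʳ (inverseʳ a _)) (*-identityˡ _))
      f≈ : g * (f n * i) ≈ f n
      f≈ = trans (solve 3 (λ g f i → g :* (f :* i) := (g :* i) :* f) refl g (f n) i)
                 (trans (*-congʳ (inverseʳ g g#0)) (*-identityˡ _))
      upper : f n < g + δ * ι n
      upper = begin-strict
        f n                            ≈⟨ f≈ ⟨
        g * (f n * i)                  ≈⟨ solve 3 (λ g x o → g :* x := g :* o :+ g :* (x :- o)) refl g (f n * i) 1# ⟩
        g * 1# + g * (f n * i - 1#)    <⟨ +-monoʳ-< (g * 1#) (*-monoˡ-< 0<g f/g-1<) ⟩
        g * 1# + g * (δ * a⁻¹)         ≈⟨ +-cong (*-identityʳ g) δι≈ ⟩
        g + δ * ι n                    ∎
      lower : g < f n + δ * ι n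
      lower = begin-strict
        g                              ≈⟨ *-identityʳ g ⟨
        g * 1#                         ≈⟨ solve 3 (λ g x o → g :* o := g :* x :+ g :* (o :- x)) refl g (f n * i) 1# ⟩
        g * (f n * i) + g * (1# - f n * i) <⟨ +-monoʳ-< _ (*-monoˡ-< 0<g 1-f/g<) ⟩
        g * (f n * i) + g * (δ * a⁻¹)  ≈⟨ +-cong f≈ δι≈ ⟩
        f n + δ * ι n                  ∎

  ∼-linear⇐ : ∀ {f c} → 0# < c →
    (∀ η → 0# < η → (∃ λ K → ∀ n → f n ≤ c * ι n + (ι K + η * ι n)) × (∃ λ K → ∀ n → c * ι n ≤ f n + (ι K + η * ι n))) →
    f ∼ (λ n → c * ι n)
  ∼-linear⇐ {f} {c} 0<c bounds ε 0<ε = suc (N₁ ℕ.+ N₂) , λ n N<n → let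
      0<n = ℕ.≤-trans (ℕ.s≤s ℕ.z≤n) N<n
      0<g = *-pos 0<c (ι-pos n {{ℕ.>-nonZero 0<n}})
      N≤n = ℕ.≤-trans (ℕ.n≤1+n _) N<n
    in 0<⇒#0 0<g ,
       *-cancelˡ-< 0<g (close n (f n) (c * ι n) K₁ (f/g n _) (*-identityʳ _) (upper n)
         (proj₂ (archimedean* 0<η (ι K₁)) n (ℕ.≤-trans (ℕ.m≤m+n N₁ N₂) N≤n))) ,
       *-cancelˡ-< 0<g (close n (c * ι n) (f n) K₂ (*-identityʳ _) (f/g n _) (lower n)
         (proj₂ (archimedean* 0<η (ι K₂)) n (ℕ.≤-trans (ℕ.m≤n+m N₂ N₁) N≤n)))
    where
    -- With η = cε / 2, half of the allowed error cε n absorbs η n, and the other half exceeds the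
    -- constant K for large n.
    halves = half (*-pos 0<c 0<ε)
    η = proj₁ halves
    0<η = proj₁ (proj₂ halves)
    2η≈cε = proj₂ (proj₂ halves)
    K₁ = proj₁ (proj₁ (bounds η 0<η))
    K₂ = proj₁ (proj₂ (bounds η 0<η))
    upper = proj₂ (proj₁ (bounds η 0<η))
    lower = proj₂ (proj₂ (bounds η 0<η))
    N₁ = proj₁ (archimedean* 0<η (ι K₁))
    N₂ = proj₁ (archimedean* 0<η (ι K₂))

    f/g : ∀ n g#0 → (c * ι n) * (f n ÷ c * ι n [ g#0 ]) ≈ f n
    f/g n g#0 = trans (solve 3 (λ g f i → g :* (f :* i) := (g :* i) :* f) refl (c * ι n) (f n) _)
                      (trans (*-congʳ (inverseʳ (c * ι n) g#0)) (*-identityˡ _))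

    close : ∀ n u v K {u′ v′} → (c * ι n) * u′ ≈ u → (c * ι n) * v′ ≈ v →
      u ≤ v + (ι K + η * ι n) → ι K < η * ι n → (c * ι n) * (u′ - v′) < (c * ι n) * ε
    close n u v K {u′} {v′} gu′≈u gv′≈v u≤ K< = begin-strict
      g * (u′ - v′)                         ≈⟨ solve 3 (λ g u v → g :* (u :- v) := g :* u :- g :* v) refl g u′ v′ ⟩
      g * u′ - g * v′                       ≈⟨ +-cong gu′≈u (-‿cong gv′≈v) ⟩
      u - v                                 ≤⟨ +-monoˡ-≤ (- v) u≤ ⟩
      v + (ι K + η * ι n) - v               ≈⟨ solve 2 (λ v x → v :+ x :- v := x) refl v (ι K + η * ι n) ⟩
      ι K + η * ι n                         <⟨ +-monoˡ-< (η * ι n) K< ⟩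
      η * ι n + η * ι n                     ≈⟨ distribʳ (ι n) η η ⟨
      (η + η) * ι n                         ≈⟨ *-congʳ 2η≈cε ⟩
      (c * ε) * ι n                         ≈⟨ solve 3 (λ c e n → c :* e :* n := c :* n :* e) refl c ε (ι n) ⟩
      g * ε                                 ∎
      where
      open ≤-Reasoning
      g = c * ι n

  -- The expected cost

  module Cost {s : ℕ} (t : Vec ℕ (suc (suc s))) (Q : Quickselect t) (EA : ℕ → ℝ)
              (tollMean : Quickselect.TollMean Q EA) where

    open Quickselect Q
    open ProbabilitySpace 𝓕 using (mean-unique)

    k≤ : ∀ {n} → n₀ ℕ.≤ n → sampleSize t ℕ.≤ n
    k≤ = ℕ.≤-trans k≤n₀

    module Step {n : ℕ} (n₀≤n : n₀ ℕ.≤ n) = StepMean t (k≤ n₀≤n) (step n n₀≤n)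

    -- The means of the smaller problems and of the toll determine that of F n, so existence spreads
    -- from n < n₀ by strong induction.
    means : ∀ n → ∃ (_HasMeanᶠ_ (F n))
    means = <-rec _ λ n ih → mean n ih
      where
      mean : ∀ n → (∀ {m} → m ℕ.< n → ∃ (_HasMeanᶠ_ (F m))) → ∃ (_HasMeanᶠ_ (F n))
      mean n ih with n ℕ.<? n₀
      ... | yes n<n₀ = small-integrable n n<n₀
      ... | no  n≮n₀ = Step.stepMean n₀≤n (EA n) E ,
          Step.mean-F n₀≤n E (tollMean n n₀≤n) (λ m → proj₂ (ih (Fin.toℕ<n m)))
        where
        n₀≤n = ℕ.≮⇒≥ n≮n₀
        E : Fin n → ℝ
        E m = proj₁ (ih (Fin.toℕ<n m))

    EF : ℕ → ℝ
    EF n = proj₁ (means n)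

    -- `EF` comes out of a well-founded recursion; uniqueness of means is used in place of unfolding
    -- it.
    recursion : ∀ n (n₀≤n : n₀ ℕ.≤ n) →
      scale t (k≤ n₀≤n) * EF n ≈ scale t (k≤ n₀≤n) * EA n + branch t (k≤ n₀≤n) EF
    recursion n n₀≤n = trans
      (*-congˡ (mean-unique (proj₂ (means n)) (Step.mean-F n₀≤n (EF ∘ toℕ) (tollMean n n₀≤n) (λ m → proj₂ (means (toℕ m))))))
      (Step.scaled-stepMean n₀≤n (EA n) EF)

    module _ {a : ℝ} (0<a : 0# < a) (EA∼ : EA ∼ (λ n → a * ι n)) where

      c : ℝ
      c = a ÷ H t [ 0<⇒#0 (H-pos t) ]

      private
        q = contraction t

        0<c : 0# < c
        0<c = *-pos 0<a (inverse-pos (H-pos t))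

        a+cq≈c : a + c * q ≈ c
        a+cq≈c = begin
          a + c * q            ≈⟨ +-congʳ (sym cH≈a) ⟩
          c * H t + c * q      ≈⟨ trans (+-comm _ _) (sym (distribˡ c q (H t))) ⟩
          c * (q + H t)        ≈⟨ trans (*-congˡ (contraction+H t)) (*-identityʳ c) ⟩
          c                    ∎
          where
          open import Relation.Binary.Reasoning.Setoid setoid
          cH≈a : c * H t ≈ a
          cH≈a = trans (*-assoc a _ (H t)) (trans (*-congˡ (trans (*-comm _ _) (inverseʳ (H t) _))) (*-identityʳ a))

      module _ {δ η : ℝ} (0<δ : 0# < δ) (0<η : 0# < η) (ηH≈2δ : η * H t ≈ δ + δ) where
        private
          -- One half of δ pays for the deviation of the toll from a n, the other for the error c ·
          -- slack of the second moment.
          halves = half 0<δ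
          δ′ = proj₁ halves
          0<δ′ = proj₁ (proj₂ halves)
          2δ′≈δ = proj₂ (proj₂ halves)
          toll = ∼-linear⇒ 0<a EA∼ δ′ 0<δ′
          N₁ = proj₁ toll
          N₂ = proj₁ (archimedean* 0<δ′ (c * slack t))
          N = N₁ ℕ.+ N₂ ℕ.+ n₀
          line : ℕ → ℝ
          line n = c * ι n
          open ≤-Reasoning

        module _ {n : ℕ} (k≤n : sampleSize t ℕ.≤ n) (N≤n : N ℕ.≤ n) where
          open Branching t k≤n
          private
            w = scale t k≤n
            b = branch t k≤n
            n₀≤n : n₀ ℕ.≤ n
            n₀≤n = ℕ.≤-trans (ℕ.m≤n+m n₀ (N₁ ℕ.+ N₂)) N≤n
            N₁≤n : N₁ ℕ.≤ n
            N₁≤n = ℕ.≤-trans (ℕ.≤-trans (ℕ.m≤m+n N₁ N₂) (ℕ.m≤m+n (N₁ ℕ.+ N₂) n₀)) N≤n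
            N₂≤n : N₂ ℕ.≤ n
            N₂≤n = ℕ.≤-trans (ℕ.≤-trans (ℕ.m≤n+m N₂ N₁) (ℕ.m≤m+n (N₁ ℕ.+ N₂) n₀)) N≤n

            errors : δ′ * ι n + c * slack t ≤ δ * ι n
            errors = begin
              δ′ * ι n + c * slack t   ≤⟨ +-monoʳ-≤ (δ′ * ι n) (<⇒≤ (proj₂ (archimedean* 0<δ′ (c * slack t)) n N₂≤n)) ⟩
              δ′ * ι n + δ′ * ι n      ≈⟨ trans (sym (distribʳ (ι n) δ′ δ′)) (*-congʳ 2δ′≈δ) ⟩
              δ * ι n                  ∎

          -- `EF` obeys the recursion exactly and the line c n only up to the toll deviation and the
          -- slack. The two branch terms stand on opposite sides, as `compare` expects, so that
          -- nothing is subtracted.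
          defect-EF≤ : w * EF n + b line ≤ w * line n + b EF + w * (δ * ι n)
          defect-EF≤ = begin
            w * EF n + b line
              ≈⟨ +-cong (recursion n n₀≤n) (branching-* c ι) ⟩
            w * EA n + b EF + c * b ι
              ≤⟨ +-mono-≤ (+-monoˡ-≤ (b EF) (*-monoˡ-≤ 0<nw (proj₁ (proj₂ toll n N₁≤n)))) (*-monoˡ-≤ 0<c branching-ι≤) ⟩
            w * (a * ι n + δ′ * ι n) + b EF + c * (w * (q * ι n) + w * slack t)
              ≈⟨ solve 8 (λ w a n d b c q s → w :* (a :* n :+ d :* n) :+ b :+ c :* (w :* (q :* n) :+ w :* s)
                   := w :* ((a :+ c :* q) :* n) :+ b :+ w :* (d :* n :+ c :* s)) refl w a (ι n) δ′ (b EF) c q (slack t) ⟩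
            w * ((a + c * q) * ι n) + b EF + w * (δ′ * ι n + c * slack t)
              ≤⟨ +-mono-≤ (≤-reflexive (+-congʳ (*-congˡ (*-congʳ a+cq≈c)))) (*-monoˡ-≤ 0<nw errors) ⟩
            w * line n + b EF + w * (δ * ι n) ∎

          ≤defect-EF : w * line n + b EF ≤ w * EF n + b line + w * (δ * ι n)
          ≤defect-EF = begin
            w * line n + b EF
              ≈⟨ +-congʳ (*-congˡ (*-congʳ a+cq≈c)) ⟨
            w * ((a + c * q) * ι n) + b EF
              ≈⟨ solve 6 (λ w a n b c q → w :* ((a :+ c :* q) :* n) :+ b := w :* (a :* n) :+ b :+ c :* (w :* (q :* n)))
                   refl w a (ι n) (b EF) c q ⟩
            w * (a * ι n) + b EF + c * (w * (q * ι n))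
              ≤⟨ +-mono-≤ (+-monoˡ-≤ (b EF) (*-monoˡ-≤ 0<nw (proj₂ (proj₂ toll n N₁≤n)))) (*-monoˡ-≤ 0<c ≤branching-ι) ⟩
            w * (EA n + δ′ * ι n) + b EF + c * (b ι + w * slack t)
              ≈⟨ solve 7 (λ w e d b c i s → w :* (e :+ d) :+ b :+ c :* (i :+ w :* s)
                   := w :* e :+ b :+ c :* i :+ w :* (d :+ c :* s)) refl w (EA n) (δ′ * ι n) (b EF) c (b ι) (slack t) ⟩
            w * EA n + b EF + c * b ι + w * (δ′ * ι n + c * slack t)
              ≤⟨ +-mono-≤ (≤-reflexive (+-cong (sym (recursion n n₀≤n)) (sym (branching-* c ι)))) (*-monoˡ-≤ 0<nw errors) ⟩
            w * EF n + b line + w * (δ * ι n) ∎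

        -- `compare` is one-sided; exchanging the roles of `EF` and `line` replaces an absolute
        -- value.
        EF-bounds : (∃ λ K → ∀ n → EF n ≤ c * ι n + (ι K + η * ι n)) × (∃ λ K → ∀ n → c * ι n ≤ EF n + (ι K + η * ι n))
        EF-bounds = compare t EF line 0<δ 0<η ηH≈2δ N (λ n → defect-EF≤)
                  , compare t line EF 0<δ 0<η ηH≈2δ N (λ n → ≤defect-EF)

      EF∼ : EF ∼ (λ n → c * ι n)
      EF∼ = ∼-linear⇐ 0<c λ η 0<η → let (δ , 0<δ , 2δ≈ηH) = half (*-pos 0<η (H-pos t)) in
        EF-bounds 0<δ 0<η (sym 2δ≈ηH)

mainTheorem3 : (𝓡 : RealNumbers) → let open Analysis 𝓡 in
    ∀ (s : ℕ) → 2 ℕ.≤ s → (t : Vec ℕ s) (Q : Quickselect t) → let open Quickselect Q in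
    ∀ (a : ℝ) → 0# < a →
    ∀ (EA : ℕ → ℝ) → TollMean EA → EA ∼ (λ n → a * ι n) →
    Σ (0# < H t) λ H>0 →
    ∃ λ (EF : ℕ → ℝ) →
    (∀ n → F n HasMeanᶠ EF n) ×
    EF ∼ (λ n → (a ÷ H t [ 0<⇒#0 H>0 ]) * ι n)
mainTheorem3 𝓡 (suc (suc s)) (ℕ.s≤s (ℕ.s≤s ℕ.z≤n)) t Q a 0<a EA tollMean EA∼ =
  H-pos t , EF , (λ n → proj₂ (means n)) , EF∼ 0<a EA∼
  where
  open Asymptotics 𝓡
  open Cost t Q EA tollMean
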